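{- For each integer $\ell \ge 3$, there is a constant $c$ such that if $M$ is a simple rank-$r$ matroid that is representable over $\mathbb R$ and has no $U_{2,\ell+2}$-minor, then $|M| \le r^2 + c\cdot r$.
   Context: $|M|$ denotes the number of elements of $M$. A matroid is simple if it has no loops and no two parallel elements. $U_{a,b}$ denotes the rank-$a$ uniform matroid on $b$ elements. -}

module Defs where

open import Level using (0ℓ)
open import Data.Nat using (ℕ; zero; suc; _<_) renaming (_≤_ to _≤ℕ_)
open import Data.Fin using (Fin; zero; suc)
open import Data.Fin.Subset using (Subset; _∈_; _∉_; _⊆_; ⁅_⁆; _∪_; ∣_∣; ⊥; ⊤)
open import Data.Vec using (_∷_; [])
open import Data.Bool using (true; false)
open import Data.Sum using (_⊎_)
open import Data.Product using (Σ; ∃; _×_)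
open import Relation.Nullary using (¬_)
open import Relation.Binary.PropositionalEquality using (_≡_; _≢_)
open import Function using (_∘_)
open import Function.Definitions using (Injective)
open import Algebra.Bundles using (CommutativeRing)

-- A complete ordered field (the real numbers, axiomatised; any two such
-- fields are isomorphic, so quantifying over them = speaking about ℝ).

record CompleteOrderedField : Set₁ where
  field
    commRing : CommutativeRing 0ℓ 0ℓ
  open CommutativeRing commRing public using (Carrier; _≈_; _+_; _*_; 0#; 1#)
  field
    0≉1        : ¬ (0# ≈ 1#)
    inverse    : ∀ x → ¬ (x ≈ 0#) → ∃ λ y → (x * y) ≈ 1#
    _≤_        : Carrier → Carrier → Set
    ≤-resp-≈   : ∀ {x x′ y y′} → x ≈ x′ → y ≈ y′ → x ≤ y → x′ ≤ y′
    ≤-refl     : ∀ {x} → x ≤ x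
    ≤-trans    : ∀ {x y z} → x ≤ y → y ≤ z → x ≤ z
    ≤-antisym  : ∀ {x y} → x ≤ y → y ≤ x → x ≈ y
    ≤-total    : ∀ x y → (x ≤ y) ⊎ (y ≤ x)
    +-mono-≤   : ∀ {x y} z → x ≤ y → (x + z) ≤ (y + z)
    *-nonneg   : ∀ {x y} → 0# ≤ x → 0# ≤ y → 0# ≤ (x * y)
    complete   : (P : Carrier → Set) → ∃ P → (∃ λ b → ∀ x → P x → x ≤ b) →
                 ∃ λ s → (∀ x → P x → x ≤ s) ×
                         (∀ b → (∀ x → P x → x ≤ b) → s ≤ b)

  sumF : ∀ {n} → (Fin n → Carrier) → Carrier
  sumF {zero}  f = 0#
  sumF {suc n} f = f zero + sumF (f ∘ suc)

record Matroid (n : ℕ) : Set₁ where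
  field
    Indep       : Subset n → Set
    indep-⊥     : Indep ⊥
    indep-down  : ∀ {I J} → I ⊆ J → Indep J → Indep I
    indep-aug   : ∀ {I J} → Indep I → Indep J → ∣ I ∣ < ∣ J ∣ →
                  ∃ λ x → x ∈ J × x ∉ I × Indep (⁅ x ⁆ ∪ I)

open Matroid public

-- |M| is the size n of the ground set Fin n.

HasRank : ∀ {n} → Matroid n → ℕ → Set
HasRank M r = (∃ λ B → Indep M B × ∣ B ∣ ≡ r) ×
              (∀ I → Indep M I → ∣ I ∣ ≤ℕ r)

Simple : ∀ {n} → Matroid n → Set
Simple M = (∀ x → Indep M ⁅ x ⁆) ×
           (∀ x y → x ≢ y → Indep M (⁅ x ⁆ ∪ ⁅ y ⁆))

image : ∀ {k n} → (Fin k → Fin n) → Subset k → Subset n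
image {zero}  f []            = ⊥
image {suc k} f (true  ∷ I) = ⁅ f zero ⁆ ∪ image (f ∘ suc) I
image {suc k} f (false ∷ I) = image (f ∘ suc) I

-- M has a minor isomorphic to the matroid on Fin k with independent
-- sets IndepN: there are an injection f : Fin k → Fin n (the isomorphism
-- onto the ground set of the minor), a set C disjoint from the image of f
-- (to be contracted; everything else outside image f is deleted) and a
-- basis B of C, such that I is independent in N iff f(I) ∪ B is
-- independent in M (the independent sets of (M / C) restricted to f(Fin k)).
HasMinor : ∀ {n k} → Matroid n → (Subset k → Set) → Set
HasMinor {n} {k} M IndepN =
  Σ (Fin k → Fin n) λ f → Injective _≡_ _≡_ f ×
  Σ (Subset n) λ C → (∀ x → x ∈ image f ⊤ → x ∉ C) ×
  Σ (Subset n) λ B → B ⊆ C × Indep M B ×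
    (∀ J → J ⊆ C → Indep M J → ∣ J ∣ ≤ℕ ∣ B ∣) ×
    (∀ I → (IndepN I → Indep M (image f I ∪ B)) ×
           (Indep M (image f I ∪ B) → IndepN I))

UniformIndep : (a b : ℕ) → Subset b → Set
UniformIndep a b I = ∣ I ∣ ≤ℕ a

module _ (F : CompleteOrderedField) where
  open CompleteOrderedField F

  LinIndep : ∀ {n m} → (Fin n → Fin m → Carrier) → Subset n → Set
  LinIndep {n} {m} v I =
    ∀ (a : Fin n → Carrier) → (∀ i → i ∉ I → a i ≈ 0#) →
    (∀ j → sumF (λ i → a i * v i j) ≈ 0#) → ∀ i → a i ≈ 0#

  Representable : ∀ {n} → Matroid n → Set
  Representable {n} M =
    Σ ℕ λ m → Σ (Fin n → Fin m → Carrier) λ v →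
      ∀ I → (Indep M I → LinIndep v I) × (LinIndep v I → Indep M I)

{-# OPTIONS --safe #-}

-- Contract an element e, the root. A point p of M/e carries a set S_p of at most ℓ reals (its labels), one for each element
-- other than e on the line ep. Contracting a further element, of point u and label α, merges the points on each line through u:
-- if o = x u + y q, a label a of o becomes the label (a − x α) / y of q. Suppose u has the maximal number of labels. Unless some
-- choice of α gives q a new label, q has as many labels as u, every other point o of the line has a single label a, and
-- α ↦ (a − x α) / y maps S_u onto S_q. An affine map of ℝ between given finite sets of size at least 2 is determined by its
-- orientation, so there are at most two such points o on the line; this is where the leading coefficient 1 of r² comes from.
--
-- Weigh a point with i labels by Q^(i−1). On average over α, contracting a point u of maximal level loses only the weight of u
-- and the points o above, with which u is called tight. If all points have at least two labels there is no such o, so the weight is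
-- linear in the rank k of M/e; hence every element is on O(k) lines with three or more points. In general the weight is at most
-- k² + c k. In a minimal counterexample every u of maximal level is tight with at least 2k + c points o, minus its own weight. If some o is
-- tight with points of two different lines, then three contractions, which lose weight O(k), give a new label to at
-- least k/ℓ³ points, which is impossible for Q large. So each o is counted for at most two points u, and double counting the
-- pairs (u , o) contradicts minimality.

module Submission where

open import Defs
open import Level using (0ℓ)
open import Data.Nat as ℕ using (ℕ; zero; suc; s≤s; z≤n; _≤_; _<_)
import Data.Nat.Properties as ℕₚ
open import Data.Nat.Induction using (<-rec)
import Data.Integer.Base as ℤ
open import Data.Integer.Base using (ℤ; -[1+_]; _⊖_; _◃_) renaming (+_ to pos; _+_ to _+ℤ_; _*_ to _*ℤ_; -_ to -ℤ_)
import Data.Integer.Properties as ℤₚ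
import Data.Sign as Sign
open import Data.Bool using (true; false; if_then_else_)
open import Data.Maybe using (Maybe; just; nothing)
open import Data.Fin using (Fin; zero; suc)
import Data.Fin as Fin
import Data.Fin.Properties as Finₚ
import Data.Vec
open import Data.Fin.Subset as Subset using (Subset; ∣_∣)
import Data.Fin.Subset.Properties as Subₚ
open import Data.List using (List; []; _∷_; _++_; length; map; concatMap; filter; lookup; tabulate)
import Data.List.Properties as Listₚ
open import Data.List.Relation.Unary.All as All using (All; []; _∷_)
import Data.List.Relation.Unary.All.Properties as Allₚ
open import Data.List.Relation.Unary.Any as Any using (Any; here; there)
import Data.List.Relation.Unary.Any.Properties as Anyₚ
open import Data.List.Relation.Unary.AllPairs as AllPairs using (AllPairs; []; _∷_)
import Data.List.Relation.Unary.AllPairs.Properties as AllPairsₚ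
open import Data.List.Relation.Binary.Permutation.Propositional as Perm using (_↭_; ↭-refl; ↭-sym; ↭-trans; prep; swap)
import Data.List.Relation.Binary.Permutation.Propositional.Properties as Permₚ
open import Data.List.Relation.Binary.Sublist.Propositional as Sublist using ([]; _∷_; _∷ʳ_; ⊆-refl; minimum)
import Data.List.Relation.Binary.Sublist.Propositional.Properties as Sublistₚ
import Data.List.Membership.Propositional as Membership
import Data.List.Membership.Propositional.Properties as ∈ₚ
open import Data.Sum using (_⊎_; inj₁; inj₂; [_,_]′)
open import Data.Product using (Σ; ∃; _×_; _,_; proj₁; proj₂)
open import Data.Empty using (⊥; ⊥-elim)
open import Function using (_∘_; id)
open import Function.Definitions using (Injective)
open import Algebra.Bundles using (CommutativeRing; RawRing)
open import Algebra.Properties.CommutativeSemigroup ℕₚ.+-commutativeSemigroup using (interchange)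
import Algebra.Solver.Ring
import Algebra.Solver.Ring.AlmostCommutativeRing as ACR
open import Relation.Nullary using (¬_; Dec; yes; no; does; ¬?; _×-dec_)
open import Relation.Nullary.Decidable using (decidable-stable)
open import Relation.Unary using (Decidable)
open import Relation.Binary.Definitions using (tri<; tri≈; tri>)
open import Relation.Binary.PropositionalEquality as ≡ using (_≡_; _≢_)
import Relation.Binary.Reasoning.Setoid

-- The base of the weights must beat losses that involve the bound for heavy points, while that
-- bound itself comes from a weight argument. The circle is broken by treating the heavy case for
-- every base from ℓ² on: base ℓ² yields `C`, and only then are `K₁` and `Q` chosen. In `Q` the
-- summand ℓ² lets one new label, at a single α, pay for a line of at most ℓ points at all of the at
-- most ℓ labels of u; `K₁` lets new labels pay for the losses of three contractions. In
-- `c = L + 2 D`, `L` absorbs the weight of u, and 2 D the additive loss of partners q under three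
-- projections. The final count also needs an upper bound for the weight. Minimality in the number
-- of points supplies it: without one light point, of weight 1, the bound holds, so the weight is at
-- most `quota k + 1`. Let x be the weight of a point of maximal level. A point of that level needs
-- 2k + c - x light points, at most two for each q, and these q have maximal level too; hence the
-- number N of such points is more than k + (c - x)/2. Every light point is counted at most twice,
-- so the weight is at least N (x + k + (c - x)/2), which exceeds k² + c k + 1.

-- Natural-number estimates for the counting arguments

module Arithmetic where
  open import Data.Nat.Tactic.RingSolver using (solve-∀)
  open ℕₚ.≤-Reasoning

  quadratic-suc : ∀ k c → suc k ℕ.* suc k ℕ.+ c ℕ.* suc k ≡ k ℕ.* k ℕ.+ c ℕ.* k ℕ.+ (2 ℕ.* k ℕ.+ 1 ℕ.+ c)
  quadratic-suc = solve-∀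

  shift : ∀ x k c → x ℕ.+ (2 ℕ.* suc k ℕ.+ c) ≡ suc (x ℕ.+ (2 ℕ.* k ℕ.+ 1 ℕ.+ c))
  shift = solve-∀

  rotate : ∀ a b d → a ℕ.+ (b ℕ.+ d) ≡ b ℕ.+ (d ℕ.+ a)
  rotate = solve-∀

  double-suc : ∀ q x → 2 ℕ.* q ℕ.+ x ℕ.+ 2 ≡ 2 ℕ.* suc q ℕ.+ x
  double-suc = solve-∀

  module _ (ℓ C k : ℕ) where
    private
      K₁ E : ℕ
      K₁ = (ℓ ℕ.* ℓ ℕ.* ℓ) ℕ.* (3 ℕ.+ 3 ℕ.* (ℓ ℕ.* C) ℕ.+ C)
      E = suc (ℓ ℕ.* (C ℕ.* k))

    -- The left side is what three contractions can lose: at most `E` points each, and the weight in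
    -- excess of 1 of at most `C * k` heavy points, with `a` the top weight. The right side is the
    -- gain of `s` points that rise above the top level. `K₁` is the factor that this comparison
    -- requires.
    lost≤gained : ∀ {a t s} → 1 ≤ a → 1 ≤ k → k ≤ (ℓ ℕ.* ℓ ℕ.* ℓ) ℕ.* t → t ≤ s →
      E ℕ.+ E ℕ.+ E ℕ.+ a ℕ.* (C ℕ.* k) ≤ (ℓ ℕ.* ℓ ℕ.+ K₁) ℕ.* a ℕ.* s
    lost≤gained {a} {t} {s} 1≤a 1≤k k≤ t≤s = begin
      E ℕ.+ E ℕ.+ E ℕ.+ a ℕ.* (C ℕ.* k) ≡⟨ lemma₁ (ℓ ℕ.* (C ℕ.* k)) (a ℕ.* (C ℕ.* k)) ⟩
      3 ℕ.* (1 ℕ.* 1) ℕ.+ 3 ℕ.* (1 ℕ.* (ℓ ℕ.* (C ℕ.* k))) ℕ.+ a ℕ.* (C ℕ.* k) ≤⟨ ℕₚ.+-monoˡ-≤ (a ℕ.* (C ℕ.* k)) (ℕₚ.+-mono-≤ (ℕₚ.*-monoʳ-≤ 3 (ℕₚ.*-mono-≤ 1≤a 1≤k)) (ℕₚ.*-monoʳ-≤ 3 (ℕₚ.*-monoˡ-≤ (ℓ ℕ.* (C ℕ.* k)) 1≤a))) ⟩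
      3 ℕ.* (a ℕ.* k) ℕ.+ 3 ℕ.* (a ℕ.* (ℓ ℕ.* (C ℕ.* k))) ℕ.+ a ℕ.* (C ℕ.* k) ≡⟨ lemma₂ a k ℓ C ⟩
      a ℕ.* ((3 ℕ.+ 3 ℕ.* (ℓ ℕ.* C) ℕ.+ C) ℕ.* k) ≤⟨ ℕₚ.*-monoʳ-≤ a (ℕₚ.*-monoʳ-≤ (3 ℕ.+ 3 ℕ.* (ℓ ℕ.* C) ℕ.+ C) k≤) ⟩
      a ℕ.* ((3 ℕ.+ 3 ℕ.* (ℓ ℕ.* C) ℕ.+ C) ℕ.* ((ℓ ℕ.* ℓ ℕ.* ℓ) ℕ.* t)) ≡⟨ lemma₃ a (3 ℕ.+ 3 ℕ.* (ℓ ℕ.* C) ℕ.+ C) (ℓ ℕ.* ℓ ℕ.* ℓ) t ⟩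
      K₁ ℕ.* a ℕ.* t ≤⟨ ℕₚ.*-mono-≤ (ℕₚ.*-monoˡ-≤ a (ℕₚ.m≤n+m K₁ (ℓ ℕ.* ℓ))) t≤s ⟩
      (ℓ ℕ.* ℓ ℕ.+ K₁) ℕ.* a ℕ.* s ∎
      where
      lemma₁ : ∀ e x → suc e ℕ.+ suc e ℕ.+ suc e ℕ.+ x ≡ 3 ℕ.* (1 ℕ.* 1) ℕ.+ 3 ℕ.* (1 ℕ.* e) ℕ.+ x
      lemma₁ = solve-∀
      lemma₂ : ∀ a k l C → 3 ℕ.* (a ℕ.* k) ℕ.+ 3 ℕ.* (a ℕ.* (l ℕ.* (C ℕ.* k))) ℕ.+ a ℕ.* (C ℕ.* k) ≡ a ℕ.* ((3 ℕ.+ 3 ℕ.* (l ℕ.* C) ℕ.+ C) ℕ.* k)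
      lemma₂ = solve-∀
      lemma₃ : ∀ a x y t → a ℕ.* (x ℕ.* (y ℕ.* t)) ≡ y ℕ.* x ℕ.* a ℕ.* t
      lemma₃ = solve-∀

    -- Each of three projections loses one of the q partners outright and identifies at most ℓ of
    -- the others, whence the nested bound. It expands to ℓ³ t + `D`, and the summand 2 `D` of the
    -- constant `c` is there to cancel this `D`.
    partners-survive : ∀ {L Λ o q t} → 2 ℕ.* k ℕ.+ (L ℕ.+ 2 ℕ.* suc (ℓ ℕ.* suc ℓ)) ≤ o ℕ.+ Λ → o ≤ 2 ℕ.* q → Λ ≤ L →
      q ≤ suc (ℓ ℕ.* suc (ℓ ℕ.* suc (ℓ ℕ.* t))) → k ≤ (ℓ ℕ.* ℓ ℕ.* ℓ) ℕ.* t
    partners-survive {L} {Λ} {o} {q} {t} many o≤ Λ≤ q≤ = ℕₚ.+-cancelʳ-≤ D _ _ (begin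
      k ℕ.+ D ≤⟨ ℕₚ.*-cancelˡ-≤ 2 (ℕₚ.+-cancelʳ-≤ L _ _ twice) ⟩
      q ≤⟨ q≤ ⟩
      suc (ℓ ℕ.* suc (ℓ ℕ.* suc (ℓ ℕ.* t))) ≡⟨ lemma₂ ℓ t ⟩
      (ℓ ℕ.* ℓ ℕ.* ℓ) ℕ.* t ℕ.+ D ∎)
      where
      D = suc (ℓ ℕ.* suc ℓ)
      lemma₁ : ∀ k D L → 2 ℕ.* (k ℕ.+ D) ℕ.+ L ≡ 2 ℕ.* k ℕ.+ (L ℕ.+ 2 ℕ.* D)
      lemma₁ = solve-∀
      lemma₂ : ∀ ℓ t → suc (ℓ ℕ.* suc (ℓ ℕ.* suc (ℓ ℕ.* t))) ≡ (ℓ ℕ.* ℓ ℕ.* ℓ) ℕ.* t ℕ.+ suc (ℓ ℕ.* suc ℓ)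
      lemma₂ = solve-∀
      twice : 2 ℕ.* (k ℕ.+ D) ℕ.+ L ≤ 2 ℕ.* q ℕ.+ L
      twice = begin
        2 ℕ.* (k ℕ.+ D) ℕ.+ L ≡⟨ lemma₁ k D L ⟩
        2 ℕ.* k ℕ.+ (L ℕ.+ 2 ℕ.* D) ≤⟨ many ⟩
        o ℕ.+ Λ ≤⟨ ℕₚ.+-mono-≤ o≤ Λ≤ ⟩
        2 ℕ.* q ℕ.+ L ∎

    -- The final count: N points of maximal level with weight x, each tight with many of the O light points.
    clash : ∀ {x L N O S} → x ≤ L → 1 ≤ x → N ℕ.* (2 ℕ.* k ℕ.+ (L ℕ.+ 2 ℕ.* suc (ℓ ℕ.* suc ℓ))) ≤ 2 ℕ.* O ℕ.+ N ℕ.* x →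
      2 ℕ.* k ℕ.+ (L ℕ.+ 2 ℕ.* suc (ℓ ℕ.* suc ℓ)) ℕ.+ 2 ≤ 2 ℕ.* N ℕ.+ x → x ℕ.* N ℕ.+ O ≤ S → S ≤ suc (k ℕ.* k ℕ.+ (L ℕ.+ 2 ℕ.* suc (ℓ ℕ.* suc ℓ)) ℕ.* k) → ⊥
    clash {x} {L} {N} {O} {S} x≤L 1≤x edges degree weight S≤ = subst-L (ℕₚ.m≤n⇒∃[o]m+o≡n x≤L)
      where
      subst-L : (∃ λ e → x ℕ.+ e ≡ L) → ⊥
      subst-L (e , ≡.refl) = final (ℕₚ.m≤n⇒∃[o]m+o≡n 1≤x) N-large
        where
        d = e ℕ.+ 2 ℕ.* suc (ℓ ℕ.* suc ℓ)
        lemma₁ : ∀ N k x e D → N ℕ.* (2 ℕ.* k ℕ.+ (x ℕ.+ e ℕ.+ 2 ℕ.* D)) ≡ N ℕ.* (2 ℕ.* k ℕ.+ (e ℕ.+ 2 ℕ.* D)) ℕ.+ N ℕ.* x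
        lemma₁ = solve-∀
        edges′ : N ℕ.* (2 ℕ.* k ℕ.+ d) ≤ 2 ℕ.* O
        edges′ = ℕₚ.+-cancelʳ-≤ (N ℕ.* x) _ _ (≡.subst (_≤ 2 ℕ.* O ℕ.+ N ℕ.* x) (lemma₁ N k x e (suc (ℓ ℕ.* suc ℓ))) edges)
        lemma₂ : ∀ k x e D → 2 ℕ.* k ℕ.+ (x ℕ.+ e ℕ.+ 2 ℕ.* D) ℕ.+ 2 ≡ (2 ℕ.* k ℕ.+ (e ℕ.+ 2 ℕ.* D) ℕ.+ 2) ℕ.+ x
        lemma₂ = solve-∀
        N-large : 2 ℕ.* k ℕ.+ d ℕ.+ 2 ≤ 2 ℕ.* N
        N-large = ℕₚ.+-cancelʳ-≤ x _ _ (≡.subst (_≤ 2 ℕ.* N ℕ.+ x) (lemma₂ k x e (suc (ℓ ℕ.* suc ℓ))) degree)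
        final : (∃ λ y → 1 ℕ.+ y ≡ x) → 2 ℕ.* k ℕ.+ d ℕ.+ 2 ≤ 2 ℕ.* N → ⊥
        -- With `d` standing for `c - x`, both sides share the terms 4 k² + 4 (x + d) k. The
        -- expression in braces is the remaining surplus, less one.
        final (y , ≡.refl) N-large = ℕₚ.m+1+n≰m (4 ℕ.* suc (k ℕ.* k ℕ.+ (suc y ℕ.+ d) ℕ.* k)) {2 ℕ.* (suc y ℕ.* d) ℕ.+ d ℕ.* d ℕ.+ 4 ℕ.* y ℕ.+ 4 ℕ.* k ℕ.+ d ℕ.+ (e ℕ.+ 2 ℕ.* (ℓ ℕ.* suc ℓ)) ℕ.+ 1} (begin
          4 ℕ.* suc (k ℕ.* k ℕ.+ (suc y ℕ.+ d) ℕ.* k) ℕ.+ suc (2 ℕ.* (suc y ℕ.* d) ℕ.+ d ℕ.* d ℕ.+ 4 ℕ.* y ℕ.+ 4 ℕ.* k ℕ.+ d ℕ.+ (e ℕ.+ 2 ℕ.* (ℓ ℕ.* suc ℓ)) ℕ.+ 1)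
                                                                          ≡⟨ lemma₃ k y e (ℓ ℕ.* suc ℓ) ⟩
          (2 ℕ.* k ℕ.+ d ℕ.+ 2) ℕ.* (2 ℕ.* k ℕ.+ 2 ℕ.* suc y ℕ.+ d) ≤⟨ ℕₚ.*-monoˡ-≤ (2 ℕ.* k ℕ.+ 2 ℕ.* suc y ℕ.+ d) N-large ⟩
          2 ℕ.* N ℕ.* (2 ℕ.* k ℕ.+ 2 ℕ.* suc y ℕ.+ d) ≡⟨ lemma₄ N k (suc y) d ⟩
          4 ℕ.* (suc y ℕ.* N) ℕ.+ 2 ℕ.* (N ℕ.* (2 ℕ.* k ℕ.+ d)) ≤⟨ ℕₚ.+-monoʳ-≤ (4 ℕ.* (suc y ℕ.* N)) (ℕₚ.*-monoʳ-≤ 2 edges′) ⟩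
          4 ℕ.* (suc y ℕ.* N) ℕ.+ 2 ℕ.* (2 ℕ.* O) ≡⟨ lemma₅ (suc y ℕ.* N) O ⟩
          4 ℕ.* (suc y ℕ.* N ℕ.+ O) ≤⟨ ℕₚ.*-monoʳ-≤ 4 (ℕₚ.≤-trans weight S≤) ⟩
          4 ℕ.* suc (k ℕ.* k ℕ.+ (suc y ℕ.+ e ℕ.+ 2 ℕ.* suc (ℓ ℕ.* suc ℓ)) ℕ.* k) ≡⟨ ≡.cong (λ z → 4 ℕ.* suc (k ℕ.* k ℕ.+ z ℕ.* k)) (ℕₚ.+-assoc (suc y) e _) ⟩
          4 ℕ.* suc (k ℕ.* k ℕ.+ (suc y ℕ.+ d) ℕ.* k) ∎)
          where
          lemma₃ : ∀ k y e z → 4 ℕ.* suc (k ℕ.* k ℕ.+ (suc y ℕ.+ (e ℕ.+ 2 ℕ.* suc z)) ℕ.* k) ℕ.+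
            suc (2 ℕ.* (suc y ℕ.* (e ℕ.+ 2 ℕ.* suc z)) ℕ.+ (e ℕ.+ 2 ℕ.* suc z) ℕ.* (e ℕ.+ 2 ℕ.* suc z) ℕ.+ 4 ℕ.* y ℕ.+ 4 ℕ.* k ℕ.+ (e ℕ.+ 2 ℕ.* suc z) ℕ.+ (e ℕ.+ 2 ℕ.* z) ℕ.+ 1) ≡
            (2 ℕ.* k ℕ.+ (e ℕ.+ 2 ℕ.* suc z) ℕ.+ 2) ℕ.* (2 ℕ.* k ℕ.+ 2 ℕ.* suc y ℕ.+ (e ℕ.+ 2 ℕ.* suc z))
          lemma₃ = solve-∀
          lemma₄ : ∀ N k x d → 2 ℕ.* N ℕ.* (2 ℕ.* k ℕ.+ 2 ℕ.* x ℕ.+ d) ≡ 4 ℕ.* (x ℕ.* N) ℕ.+ 2 ℕ.* (N ℕ.* (2 ℕ.* k ℕ.+ d))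
          lemma₄ = solve-∀
          lemma₅ : ∀ a b → 4 ℕ.* a ℕ.+ 2 ℕ.* (2 ℕ.* b) ≡ 4 ℕ.* (a ℕ.+ b)
          lemma₅ = solve-∀

-- Complete ordered fields: ring solver, decidable equality, order

module Field (R : CompleteOrderedField) where
  open CompleteOrderedField R public renaming (_≤_ to infix 4 _≼_; ≤-refl to ≼-refl; ≤-trans to ≼-trans; ≤-antisym to ≼-antisym; ≤-total to ≼-total; ≤-resp-≈ to ≼-resp-≈; +-mono-≤ to +-mono-≼)
  open CommutativeRing commRing public hiding (Carrier; _≈_; _+_; _*_; 0#; 1#; zero)
  open import Algebra.Properties.Ring (CommutativeRing.ring commRing) public
    using (-‿distribˡ-*; -‿distribʳ-*; -0#≈0#; -‿involutive; x∙y⁻¹≈ε⇒x≈y)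
  open import Algebra.Properties.Semiring.Mult (CommutativeRing.semiring commRing)
    using (×-homo-+; ×1-homo-*) renaming (_×_ to _·ℕ_)
  module ≈-Reasoning = Relation.Binary.Reasoning.Setoid (CommutativeRing.setoid commRing)

  acr : ACR.AlmostCommutativeRing 0ℓ 0ℓ
  acr = ACR.fromCommutativeRing commRing

  -- The solver takes coefficients from ℤ, where zero is recognised by computation: equality in the
  -- field is not decided yet, and opposite terms have to cancel.
  fromℤ : ℤ → Carrier
  fromℤ (pos n)  = n ·ℕ 1#
  fromℤ -[1+ n ] = - (suc n ·ℕ 1#)

  -‿+-comm : ∀ x y → - x + - y ≈ - (x + y)
  -‿+-comm = ACR.AlmostCommutativeRing.-‿+-comm acr

  fromℤ-⊖ : ∀ m n → fromℤ (m ⊖ n) ≈ m ·ℕ 1# + - (n ·ℕ 1#)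
  fromℤ-⊖ m       zero    = sym (trans (+-congˡ -0#≈0#) (+-identityʳ _))
  fromℤ-⊖ zero    (suc n) = sym (+-identityˡ _)
  fromℤ-⊖ (suc m) (suc n) = begin
    fromℤ (suc m ⊖ suc n) ≡⟨ ≡.cong fromℤ (ℤₚ.[1+m]⊖[1+n]≡m⊖n m n) ⟩
    fromℤ (m ⊖ n) ≈⟨ fromℤ-⊖ m n ⟩
    a + - b ≈⟨ +-congʳ (+-identityˡ a) ⟨
    (0# + a) + - b ≈⟨ +-congʳ (+-congʳ (-‿inverseʳ 1#)) ⟨
    ((1# + - 1#) + a) + - b ≈⟨ +-congʳ (+-assoc 1# (- 1#) a) ⟩
    (1# + (- 1# + a)) + - b ≈⟨ +-congʳ (+-congˡ (+-comm (- 1#) a)) ⟩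
    (1# + (a + - 1#)) + - b ≈⟨ +-congʳ (+-assoc 1# a (- 1#)) ⟨
    ((1# + a) + - 1#) + - b ≈⟨ +-assoc (1# + a) (- 1#) (- b) ⟩
    (1# + a) + (- 1# + - b) ≈⟨ +-congˡ (-‿+-comm 1# b) ⟩
    (1# + a) + - (1# + b) ∎
    where
    open ≈-Reasoning
    a = m ·ℕ 1#
    b = n ·ℕ 1#

  fromℤ-+ : ∀ i j → fromℤ (i +ℤ j) ≈ fromℤ i + fromℤ j
  fromℤ-+ (pos m)  (pos n)  = ×-homo-+ 1# m n
  fromℤ-+ (pos m)  -[1+ n ] = fromℤ-⊖ m (suc n)
  fromℤ-+ -[1+ m ] (pos n)  = trans (fromℤ-⊖ n (suc m)) (+-comm _ _)
  fromℤ-+ -[1+ m ] -[1+ n ] = begin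
    - (1# + (1# + (m ℕ.+ n) ·ℕ 1#)) ≈⟨ -‿cong (+-congˡ (+-congˡ (×-homo-+ 1# m n))) ⟩
    - (1# + (1# + (m ·ℕ 1# + n ·ℕ 1#))) ≈⟨ -‿cong (+-congˡ (+-assoc _ _ _)) ⟨
    - (1# + ((1# + m ·ℕ 1#) + n ·ℕ 1#)) ≈⟨ -‿cong (+-congˡ (+-congʳ (+-comm _ _))) ⟩
    - (1# + ((m ·ℕ 1# + 1#) + n ·ℕ 1#)) ≈⟨ -‿cong (+-congˡ (+-assoc _ _ _)) ⟩
    - (1# + (m ·ℕ 1# + (1# + n ·ℕ 1#))) ≈⟨ -‿cong (+-assoc _ _ _) ⟨
    - ((1# + m ·ℕ 1#) + (1# + n ·ℕ 1#)) ≈⟨ -‿+-comm _ _ ⟨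
    - (1# + m ·ℕ 1#) + - (1# + n ·ℕ 1#) ∎
    where open ≈-Reasoning

  fromℤ-neg : ∀ i → fromℤ (-ℤ i) ≈ - fromℤ i
  fromℤ-neg (pos zero)    = sym -0#≈0#
  fromℤ-neg (pos (suc n)) = refl
  fromℤ-neg -[1+ n ]      = sym (-‿involutive _)

  fromℤ-◃- : ∀ n → fromℤ (Sign.- ◃ n) ≈ - (n ·ℕ 1#)
  fromℤ-◃- zero    = sym -0#≈0#
  fromℤ-◃- (suc n) = refl

  fromℤ-◃+ : ∀ n → fromℤ (Sign.+ ◃ n) ≈ n ·ℕ 1#
  fromℤ-◃+ zero    = refl
  fromℤ-◃+ (suc n) = refl

  fromℤ-* : ∀ i j → fromℤ (i *ℤ j) ≈ fromℤ i * fromℤ j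
  fromℤ-* (pos m)  (pos n)  = trans (fromℤ-◃+ (m ℕ.* n)) (×1-homo-* m n)
  fromℤ-* (pos m)  -[1+ n ] = trans (fromℤ-◃- (m ℕ.* suc n)) (trans (-‿cong (×1-homo-* m (suc n))) (-‿distribʳ-* _ _))
  fromℤ-* -[1+ m ] (pos n)  = trans (fromℤ-◃- (suc m ℕ.* n)) (trans (-‿cong (×1-homo-* (suc m) n)) (-‿distribˡ-* _ _))
  fromℤ-* -[1+ m ] -[1+ n ] = trans (fromℤ-◃+ (suc m ℕ.* suc n)) (trans (×1-homo-* (suc m) (suc n))
    (trans (sym (-‿involutive _)) (trans (-‿cong (-‿distribˡ-* _ _)) (-‿distribʳ-* _ _))))

  ℤ-rawRing : RawRing 0ℓ 0ℓ
  ℤ-rawRing = record { _≈_ = _≡_ ; _+_ = _+ℤ_ ; _*_ = _*ℤ_ ; -_ = -ℤ_ ; 0# = ℤ.0ℤ ; 1# = ℤ.1ℤ }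

  ℤ-morphism : ℤ-rawRing ACR.-Raw-AlmostCommutative⟶ acr
  ℤ-morphism = record
    { ⟦_⟧ = fromℤ ; +-homo = fromℤ-+ ; *-homo = fromℤ-* ; -‿homo = fromℤ-neg
    ; 0-homo = refl ; 1-homo = +-identityʳ 1# }

  fromℤ-≟ : ∀ i j → Maybe (fromℤ i ≈ fromℤ j)
  fromℤ-≟ i j with i ℤₚ.≟ j
  ... | yes p = just (reflexive (≡.cong fromℤ p))
  ... | no _  = nothing

  open Algebra.Solver.Ring ℤ-rawRing acr ℤ-morphism fromℤ-≟ public
    using (solve; _:=_; con; _:+_; _:*_; _:-_; :-_)

  0≼-neg : ∀ {x} → x ≼ 0# → 0# ≼ - x
  0≼-neg {x} x≼0 = ≼-resp-≈ (-‿inverseʳ x) (+-identityˡ (- x)) (+-mono-≼ (- x) x≼0)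

  0≼1 : 0# ≼ 1#
  0≼1 with ≼-total 0# 1#
  ... | inj₁ p = p
  ... | inj₂ p = ≼-resp-≈ refl (trans (solve 1 (λ x → :- x :* :- x := x :* x) refl 1#) (*-identityˡ 1#)) (*-nonneg (0≼-neg p) (0≼-neg p))

  1⋠0 : ¬ 1# ≼ 0#
  1⋠0 1≼0 = 0≉1 (≼-antisym 0≼1 1≼0)

  -- The infinitesimals {y | ¬¬ y ≈ 0} are bounded, and their supremum s satisfies s ≤ s − d for each of them.
  ≈0-stable : ∀ d → ¬ ¬ (d ≈ 0#) → d ≈ 0#
  ≈0-stable d ¬¬d≈0 = ≼-antisym d≼0 0≼d
    where
    Inf : Carrier → Set
    Inf y = ¬ ¬ (y ≈ 0#)

    Inf≼1 : ∀ y → Inf y → y ≼ 1#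
    Inf≼1 y p with ≼-total y 1#
    ... | inj₁ q = q
    ... | inj₂ q = ⊥-elim (p λ y≈0 → 1⋠0 (≼-resp-≈ refl y≈0 q))

    sup = complete Inf (0# , λ k → k refl) (1# , Inf≼1)
    s = proj₁ sup

    nonpos : ∀ e → Inf e → e ≼ 0#
    nonpos e p = ≼-resp-≈ (solve 2 (λ s e → s :+ (e :- s) := e) refl s e) (solve 2 (λ s e → (s :- e) :+ (e :- s) := con ℤ.0ℤ) refl s e)
      (+-mono-≼ (e - s) (proj₂ (proj₂ sup) (s - e) λ y q →
        ≼-resp-≈ (solve 2 (λ y e → (y :+ e) :+ (:- e) := y) refl y e) refl
          (+-mono-≼ (- e) (proj₁ (proj₂ sup) (y + e) λ k → q λ y≈0 → p λ e≈0 → k (trans (+-cong y≈0 e≈0) (+-identityˡ 0#))))))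

    d≼0 : d ≼ 0#
    d≼0 = nonpos d ¬¬d≈0

    0≼d : 0# ≼ d
    0≼d = ≼-resp-≈ refl (-‿involutive d) (0≼-neg (nonpos (- d) λ k → ¬¬d≈0 λ d≈0 → k (trans (-‿cong d≈0) -0#≈0#)))

  -- The supremum of {0} ∪ {2 | Q} is compared with 1.
  weak-excluded-middle : (Q : Set) → ¬ Q ⊎ ¬ ¬ Q
  weak-excluded-middle Q = decide (≼-total s 1#)
    where
    P : Carrier → Set
    P x = x ≈ 0# ⊎ (x ≈ 1# + 1# × Q)

    0≼2 : 0# ≼ 1# + 1#
    0≼2 = ≼-trans 0≼1 (≼-resp-≈ (+-identityˡ 1#) refl (+-mono-≼ 1# 0≼1))

    bound : ∀ x → P x → x ≼ 1# + 1#
    bound x (inj₁ x≈0)       = ≼-resp-≈ (sym x≈0) refl 0≼2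
    bound x (inj₂ (x≈2 , _)) = ≼-resp-≈ (sym x≈2) refl ≼-refl

    sup = complete P (0# , inj₁ refl) (1# + 1# , bound)
    s = proj₁ sup

    decide : (s ≼ 1#) ⊎ (1# ≼ s) → ¬ Q ⊎ ¬ ¬ Q
    decide (inj₁ s≼1) = inj₁ λ q → 1⋠0 (≼-resp-≈ (solve 1 (λ x → (x :+ x) :- x := x) refl 1#) (-‿inverseʳ 1#)
      (+-mono-≼ (- 1#) (≼-trans (proj₁ (proj₂ sup) (1# + 1#) (inj₂ (refl , q))) s≼1)))
    decide (inj₂ 1≼s) = inj₂ λ ¬q → 1⋠0 (≼-trans 1≼s (proj₂ (proj₂ sup) 0# λ where
      x (inj₁ x≈0)     → ≼-resp-≈ (sym x≈0) refl ≼-refl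
      x (inj₂ (_ , q)) → ⊥-elim (¬q q)))

  infix 4 _≟_

  ≟0 : ∀ x → Dec (x ≈ 0#)
  ≟0 x with weak-excluded-middle (x ≈ 0#)
  ... | inj₁ x≉0 = no x≉0
  ... | inj₂ p   = yes (≈0-stable x p)

  -- Pivots, membership among labels and the grouping of parallel vectors rest on this decision. It
  -- is extracted from completeness and the total order, so no classical axiom is assumed.
  _≟_ : ∀ x y → Dec (x ≈ y)
  x ≟ y with ≟0 (x - y)
  ... | yes p = yes (x∙y⁻¹≈ε⇒x≈y x y p)
  ... | no ¬p = no λ x≈y → ¬p (trans (+-congʳ x≈y) (-‿inverseʳ y))

  1≉0 : 1# ≉ 0#
  1≉0 p = 0≉1 (sym p)

  inv : ∀ x → x ≉ 0# → Carrier
  inv x x≉0 = proj₁ (inverse x x≉0)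

  *-inv : ∀ x (x≉0 : x ≉ 0#) → x * inv x x≉0 ≈ 1#
  *-inv x x≉0 = proj₂ (inverse x x≉0)

  inv-* : ∀ x (x≉0 : x ≉ 0#) → inv x x≉0 * x ≈ 1#
  inv-* x x≉0 = trans (*-comm _ _) (*-inv x x≉0)

  *-cancelˡ : ∀ {x y z} → x ≉ 0# → x * y ≈ x * z → y ≈ z
  *-cancelˡ {x} {y} {z} x≉0 p = trans (lem y) (trans (*-congˡ p) (sym (lem z)))
    where
    lem : ∀ y → y ≈ inv x x≉0 * (x * y)
    lem y = sym (trans (sym (*-assoc _ _ _)) (trans (*-congʳ (inv-* x x≉0)) (*-identityˡ y)))

  x*y≈0⇒y≈0 : ∀ {x y} → x ≉ 0# → x * y ≈ 0# → y ≈ 0#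
  x*y≈0⇒y≈0 {x} x≉0 p = *-cancelˡ x≉0 (trans p (sym (zeroʳ x)))

  *-≉0 : ∀ {x y} → x ≉ 0# → y ≉ 0# → x * y ≉ 0#
  *-≉0 x≉0 y≉0 p = y≉0 (x*y≈0⇒y≈0 x≉0 p)

  inv-≉0 : ∀ x (x≉0 : x ≉ 0#) → inv x x≉0 ≉ 0#
  inv-≉0 x x≉0 p = 1≉0 (trans (sym (*-inv x x≉0)) (trans (*-congˡ p) (zeroʳ x)))

  neg-≉0 : ∀ {x} → x ≉ 0# → - x ≉ 0#
  neg-≉0 {x} x≉0 p = x≉0 (trans (sym (-‿involutive x)) (trans (-‿cong p) -0#≈0#))

  *-mono-≼ : ∀ {d x y} → 0# ≼ d → x ≼ y → d * x ≼ d * y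
  *-mono-≼ {d} {x} {y} 0≼d x≼y = ≼-resp-≈ (+-identityˡ _) (solve 3 (λ d x y → d :* (y :- x) :+ d :* x := d :* y) refl d x y)
    (+-mono-≼ (d * x) (*-nonneg 0≼d (≼-resp-≈ (-‿inverseʳ x) refl (+-mono-≼ (- x) x≼y))))

  *-antimono-≼ : ∀ {d x y} → d ≼ 0# → x ≼ y → d * y ≼ d * x
  *-antimono-≼ {d} {x} {y} d≼0 x≼y = ≼-resp-≈
    (solve 3 (λ d x y → (:- d) :* x :+ (d :* x :+ d :* y) := d :* y) refl d x y)
    (solve 3 (λ d x y → (:- d) :* y :+ (d :* x :+ d :* y) := d :* x) refl d x y)
    (+-mono-≼ (d * x + d * y) (*-mono-≼ (0≼-neg d≼0) x≼y))

-- Subsets of finite sets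

module Subsets where
  open import Data.Fin.Subset using (_∈_; _∉_; _⊆_; ⁅_⁆; _∪_)
  open Subₚ
  open Data.Vec using ([]; _∷_; here; there)

  ∣⁅x⁆∪p∣ : ∀ {n} (x : Fin n) (p : Subset n) → x ∉ p → ∣ ⁅ x ⁆ ∪ p ∣ ≡ suc ∣ p ∣
  ∣⁅x⁆∪p∣ zero    (true  ∷ p) x∉p = ⊥-elim (x∉p here)
  ∣⁅x⁆∪p∣ zero    (false ∷ p) x∉p = ≡.cong suc (≡.cong ∣_∣ (∪-identityˡ p))
  ∣⁅x⁆∪p∣ (suc x) (true  ∷ p) x∉p = ≡.cong suc (∣⁅x⁆∪p∣ x p (x∉p ∘ there))
  ∣⁅x⁆∪p∣ (suc x) (false ∷ p) x∉p = ∣⁅x⁆∪p∣ x p (x∉p ∘ there)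

  three∈⇒3≤∣p∣ : ∀ {n} {i j l : Fin n} {p : Subset n} → i ∈ p → j ∈ p → l ∈ p → j ≢ i → l ≢ i → l ≢ j → 3 ≤ ∣ p ∣
  three∈⇒3≤∣p∣ {n} {i} {j} {l} {p} i∈p j∈p l∈p j≢i l≢i l≢j = ≡.subst (ℕ._≤ ∣ p ∣) size (p⊆q⇒∣p∣≤∣q∣ sub)
    where
    q = ⁅ l ⁆ ∪ (⁅ j ⁆ ∪ ⁅ i ⁆)
    j∉ : j ∉ ⁅ i ⁆
    j∉ = x≢y⇒x∉⁅y⁆ j≢i
    l∉ : l ∉ ⁅ j ⁆ ∪ ⁅ i ⁆
    l∉ l∈ = [ x≢y⇒x∉⁅y⁆ l≢j , x≢y⇒x∉⁅y⁆ l≢i ]′ (x∈p∪q⁻ _ _ l∈)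
    size : ∣ q ∣ ≡ 3
    size = ≡.trans (∣⁅x⁆∪p∣ l _ l∉) (≡.cong suc (≡.trans (∣⁅x⁆∪p∣ j _ j∉) (≡.cong suc (∣⁅x⁆∣≡1 i))))
    sub : q ⊆ p
    sub x∈ with x∈p∪q⁻ ⁅ l ⁆ _ x∈
    ... | inj₁ x∈l rewrite x∈⁅y⁆⇒x≡y l x∈l = l∈p
    ... | inj₂ x∈ji with x∈p∪q⁻ ⁅ j ⁆ _ x∈ji
    ...   | inj₁ x∈j rewrite x∈⁅y⁆⇒x≡y j x∈j = j∈p
    ...   | inj₂ x∈i rewrite x∈⁅y⁆⇒x≡y i x∈i = i∈p

  extract : ∀ {n c} (p : Subset n) → suc c ≤ ∣ p ∣ → ∃ λ x → x ∈ p × ∃ λ q → q ⊆ p × x ∉ q × c ≤ ∣ q ∣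
  extract (true  ∷ p) (s≤s c≤) = zero , here , false ∷ p , sub , (λ ()) , c≤
    where
    sub : false ∷ p ⊆ true ∷ p
    sub (there x∈) = there x∈
  extract (false ∷ p) c≤ with extract p c≤
  ... | x , x∈p , q , q⊆p , x∉q , c≤′ = suc x , there x∈p , false ∷ q , sub , (λ { (there x∈) → x∉q x∈ }) , c≤′
    where
    sub : false ∷ q ⊆ false ∷ p
    sub (there x∈) = there (q⊆p x∈)

  ∈-image⁺ : ∀ {k n} (f : Fin k → Fin n) {I i} → i ∈ I → f i ∈ image f I
  ∈-image⁺ f {true ∷ I}  {zero}  here        = x∈p∪q⁺ (inj₁ (x∈⁅x⁆ _))
  ∈-image⁺ f {true ∷ I}  {suc i} (there i∈I) = x∈p∪q⁺ (inj₂ (∈-image⁺ (f ∘ suc) i∈I))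
  ∈-image⁺ f {false ∷ I} {suc i} (there i∈I) = ∈-image⁺ (f ∘ suc) i∈I

  ∈-image⁻ : ∀ {k n} (f : Fin k → Fin n) (I : Subset k) {x} → x ∈ image f I → ∃ λ i → i ∈ I × f i ≡ x
  ∈-image⁻ f []          x∈ = ⊥-elim (∉⊥ x∈)
  ∈-image⁻ f (true ∷ I)  x∈ with x∈p∪q⁻ ⁅ f zero ⁆ _ x∈
  ... | inj₁ x∈₀ = zero , here , ≡.sym (x∈⁅y⁆⇒x≡y _ x∈₀)
  ... | inj₂ x∈₁ with ∈-image⁻ (f ∘ suc) I x∈₁
  ...   | i , i∈I , eq = suc i , there i∈I , eq
  ∈-image⁻ f (false ∷ I) x∈ with ∈-image⁻ (f ∘ suc) I x∈
  ... | i , i∈I , eq = suc i , there i∈I , eq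

-- Contractions of a represented matroid in coordinates

module LinearAlgebra (R : CompleteOrderedField) where
  open Field R
  open import Data.Fin.Subset using (_∈_; _∉_; _⊆_; ⁅_⁆; _∪_)
  open Subₚ
  open Subsets

  Vector : ℕ → Set
  Vector m = Fin m → Carrier

  infix 4 _≋_
  _≋_ : ∀ {m} → Vector m → Vector m → Set
  v ≋ w = ∀ i → v i ≈ w i

  sumF-cong : ∀ {n} {f g : Vector n} → f ≋ g → sumF f ≈ sumF g
  sumF-cong {zero}  f≋g = refl
  sumF-cong {suc n} f≋g = +-cong (f≋g zero) (sumF-cong (f≋g ∘ suc))

  sumF-+ : ∀ {n} (f g : Vector n) → sumF (λ x → f x + g x) ≈ sumF f + sumF g
  sumF-+ {zero}  f g = sym (+-identityˡ 0#)
  sumF-+ {suc n} f g = trans (+-congˡ (sumF-+ (f ∘ suc) (g ∘ suc)))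
    (solve 4 (λ a b c d → (a :+ b) :+ (c :+ d) := (a :+ c) :+ (b :+ d)) refl _ _ _ _)

  sumF-* : ∀ {n} (f : Vector n) c → sumF (λ x → f x * c) ≈ sumF f * c
  sumF-* {zero}  f c = sym (zeroˡ c)
  sumF-* {suc n} f c = trans (+-congˡ (sumF-* (f ∘ suc) c)) (sym (distribʳ c _ _))

  sumF-0 : ∀ {n} {f : Vector n} → (∀ x → f x ≈ 0#) → sumF f ≈ 0#
  sumF-0 {zero}  f≈0 = refl
  sumF-0 {suc n} f≈0 = trans (+-cong (f≈0 zero) (sumF-0 (f≈0 ∘ suc))) (+-identityˡ 0#)

  sumF-one : ∀ {n} {f : Vector n} x → (∀ y → y ≢ x → f y ≈ 0#) → sumF f ≈ f x
  sumF-one {suc n} zero    f≈0 = trans (+-congˡ (sumF-0 λ y → f≈0 (suc y) λ ())) (+-identityʳ _)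
  sumF-one {suc n} (suc x) f≈0 = trans (+-cong (f≈0 zero λ ()) (sumF-one x λ y y≢x → f≈0 (suc y) (y≢x ∘ Finₚ.suc-injective))) (+-identityˡ _)

  sumF-two : ∀ {n} {f : Vector n} x y → x ≢ y → (∀ z → z ≢ x → z ≢ y → f z ≈ 0#) → sumF f ≈ f x + f y
  sumF-two zero    zero    x≢y f≈0 = ⊥-elim (x≢y ≡.refl)
  sumF-two zero    (suc y) x≢y f≈0 = +-congˡ (sumF-one y λ z z≢y → f≈0 (suc z) (λ ()) (z≢y ∘ Finₚ.suc-injective))
  sumF-two (suc x) zero    x≢y f≈0 = trans (+-congˡ (sumF-one x λ z z≢x → f≈0 (suc z) (z≢x ∘ Finₚ.suc-injective) (λ ()))) (+-comm _ _)
  sumF-two (suc x) (suc y) x≢y f≈0 = trans (+-cong (f≈0 zero (λ ()) (λ ()))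
    (sumF-two x y (x≢y ∘ ≡.cong suc) λ z z≢x z≢y → f≈0 (suc z) (z≢x ∘ Finₚ.suc-injective) (z≢y ∘ Finₚ.suc-injective))) (+-identityˡ _)

  comb : ∀ {n m} → Vector n → (Fin n → Vector m) → Vector m
  comb a w j = sumF λ x → a x * w x j

  comb-cong : ∀ {n m} {a b : Vector n} (w : Fin n → Vector m) → a ≋ b → comb a w ≋ comb b w
  comb-cong {n} w a≋b j = sumF-cong {n} λ x → *-congʳ (a≋b x)

  comb-+ : ∀ {n m} (a b : Vector n) (w : Fin n → Vector m) j → comb (λ x → a x + b x) w j ≈ comb a w j + comb b w j
  comb-+ {n} a b w j = trans (sumF-cong {n} λ x → distribʳ (w x j) (a x) (b x)) (sumF-+ {n} _ _)

  δ : ∀ {n} → Fin n → Carrier → Vector n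
  δ x c y = if does (y Fin.≟ x) then c else 0#

  δ-same : ∀ {n} (x : Fin n) c → δ x c x ≈ c
  δ-same x c with x Fin.≟ x
  ... | yes _  = refl
  ... | no x≢x = ⊥-elim (x≢x ≡.refl)

  δ-other : ∀ {n} (x y : Fin n) c → y ≢ x → δ x c y ≈ 0#
  δ-other x y c y≢x with y Fin.≟ x
  ... | yes y≡x = ⊥-elim (y≢x y≡x)
  ... | no _    = refl

  comb-δ : ∀ {n m} x c (w : Fin n → Vector m) j → comb (δ x c) w j ≈ c * w x j
  comb-δ {n} x c w j = trans (sumF-one {n} x λ y y≢x → trans (*-congʳ (δ-other x y c y≢x)) (zeroˡ _)) (*-congʳ (δ-same x c))

  -- The vector z represents an element up to scaling. Points and labels know the matroid only
  -- through this relation.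
  Avail : ∀ {n m} → (Fin n → Vector m) → Vector m → Set
  Avail w z = ∃ λ x → ∃ λ s → s ≉ 0# × (∀ j → z j ≈ s * w x j)

  root : ∀ {m} → Vector (suc m)
  root zero    = 1#
  root (suc _) = 0#

  -- The coordinates with respect to z (pivot j) are moved to the front, so that z becomes the root.
  reroot : ∀ {m} (z : Vector m) (j : Fin m) → z j ≉ 0# → Vector m → Vector (suc m)
  reroot z j zj≉0 w zero    = w j * inv (z j) zj≉0
  reroot z j zj≉0 w (suc i) = w i - (w j * inv (z j) zj≉0) * z i

  comb-reroot : ∀ {n m} (a : Vector n) (w : Fin n → Vector m) z j zj≉0 →
    comb a (reroot z j zj≉0 ∘ w) ≋ reroot z j zj≉0 (comb a w)
  comb-reroot {n} a w z j zj≉0 zero = trans (sumF-cong {n} λ x → sym (*-assoc _ _ _)) (sumF-* {n} _ _)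
  comb-reroot {n} a w z j zj≉0 (suc i) = begin
    sumF (λ x → a x * (w x i - (w x j * c) * z i))
      ≈⟨ sumF-cong {n} (λ x → solve 5 (λ a wi wj c zi → a :* (wi :- (wj :* c) :* zi) := a :* wi :+ (a :* wj) :* (:- (c :* zi))) refl (a x) (w x i) (w x j) c (z i)) ⟩
    sumF (λ x → a x * w x i + (a x * w x j) * (- (c * z i)))
      ≈⟨ sumF-+ {n} _ _ ⟩
    comb a w i + sumF (λ x → (a x * w x j) * (- (c * z i)))
      ≈⟨ +-congˡ (sumF-* {n} _ _) ⟩
    comb a w i + comb a w j * (- (c * z i))
      ≈⟨ solve 4 (λ p q c zi → p :+ q :* (:- (c :* zi)) := p :- (q :* c) :* zi) refl _ _ _ _ ⟩
    comb a w i - (comb a w j * c) * z i ∎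
    where
    open ≈-Reasoning
    c = inv (z j) zj≉0

  reroot-cong : ∀ {m} {z : Vector m} {j} {zj≉0} {v w : Vector m} → v ≋ w → reroot z j zj≉0 v ≋ reroot z j zj≉0 w
  reroot-cong v≋w zero    = *-congʳ (v≋w _)
  reroot-cong v≋w (suc i) = +-cong (v≋w i) (-‿cong (*-congʳ (*-congʳ (v≋w _))))

  reroot-0 : ∀ {m} (z : Vector m) {j} {zj≉0} {v : Vector m} → (∀ i → v i ≈ 0#) → ∀ i → reroot z j zj≉0 v i ≈ 0#
  reroot-0 z v≈0 zero    = trans (*-congʳ (v≈0 _)) (zeroˡ _)
  reroot-0 z v≈0 (suc i) = trans (+-cong (v≈0 i) (-‿cong (trans (*-congʳ (trans (*-congʳ (v≈0 _)) (zeroˡ _))) (zeroˡ _))))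
    (trans (+-identityˡ _) -0#≈0#)

  -- The pivot coordinate, now zero, is kept instead of being removed. The change of coordinates is
  -- therefore injective and preserves all linear relations, without completing z to a basis.
  reroot-0⁻ : ∀ {m} (z : Vector m) {j} {zj≉0} {v : Vector m} → (∀ i → reroot z j zj≉0 v i ≈ 0#) → ∀ i → v i ≈ 0#
  reroot-0⁻ z {j} {zj≉0} {v} r≈0 i = begin
    v i ≈⟨ solve 2 (λ v t → v := (v :- t) :+ t) refl _ _ ⟩
    (v i - (v j * inv (z j) zj≉0) * z i) + (v j * inv (z j) zj≉0) * z i ≈⟨ +-cong (r≈0 (suc i)) (trans (*-congʳ (r≈0 zero)) (zeroˡ _)) ⟩
    0# + 0# ≈⟨ +-identityˡ 0# ⟩
    0# ∎
    where open ≈-Reasoning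

  reroot-self : ∀ {m} (z : Vector m) j zj≉0 → reroot z j zj≉0 z ≋ root
  reroot-self z j zj≉0 zero    = *-inv _ _
  reroot-self z j zj≉0 (suc i) = trans (+-congˡ (-‿cong (trans (*-congʳ (*-inv _ _)) (*-identityˡ _)))) (-‿inverseʳ _)

  reroot-scale : ∀ {m} (z : Vector m) j zj≉0 s (v : Vector m) i → reroot z j zj≉0 (λ i → s * v i) i ≈ s * reroot z j zj≉0 v i
  reroot-scale z j zj≉0 s v zero    = *-assoc _ _ _
  reroot-scale z j zj≉0 s v (suc i) = solve 5 (λ s vi vj c zi → s :* vi :- ((s :* vj) :* c) :* zi := s :* (vi :- (vj :* c) :* zi)) refl _ _ _ _ _

  module Representation {n m₀ : ℕ} (M : Matroid n) (v₀ : Fin n → Vector m₀)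
    (rep : ∀ I → (Indep M I → LinIndep R v₀ I) × (LinIndep R v₀ I → Indep M I))
    (r : ℕ) (rank≤ : ∀ I → Indep M I → ∣ I ∣ ≤ r)
    (ℓ : ℕ) (noLine : ¬ HasMinor M (UniformIndep 2 (ℓ ℕ.+ 2))) where

    -- w represents the contraction of M by the independent set C, and k is the rank that remains.
    record Contraction {m} (w : Fin n → Vector m) (k : ℕ) : Set where
      field
        C     : Subset n
        indep : LinIndep R v₀ C
        size  : ∣ C ∣ ℕ.+ k ≡ r
        kills : ∀ {x} → x ∈ C → ∀ j → w x j ≈ 0#
        push  : ∀ (a : Vector n) → (∀ j → comb a v₀ j ≈ 0#) → ∀ j → comb a w j ≈ 0#
        lift  : ∀ (a : Vector n) → (∀ j → comb a w j ≈ 0#) →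
                ∃ λ (b : Vector n) → (∀ x → x ∉ C → b x ≈ 0#) × (∀ j → comb (λ x → a x + b x) v₀ j ≈ 0#)

    contraction-initial : Contraction v₀ r
    contraction-initial = record
      { C     = Subset.⊥
      ; indep = proj₁ (rep Subset.⊥) (indep-⊥ M)
      ; size  = ≡.cong (ℕ._+ r) (∣⊥∣≡0 n)
      ; kills = λ x∈⊥ → ⊥-elim (∉⊥ x∈⊥)
      ; push  = λ a p → p
      ; lift  = λ a p → (λ _ → 0#) , (λ _ _ → refl) , λ j → trans (comb-cong v₀ (λ x → +-identityʳ (a x)) j) (p j)
      }

    contraction-reroot : ∀ {m k} {w : Fin n → Vector m} → Contraction w k → ∀ z j (zj≉0 : z j ≉ 0#) → Contraction (reroot z j zj≉0 ∘ w) k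
    contraction-reroot {w = w} K z j zj≉0 = record
      { C     = C
      ; indep = indep
      ; size  = size
      ; kills = λ x∈C → reroot-0 z (kills x∈C)
      ; push  = λ a p i → trans (comb-reroot a w z j zj≉0 i) (reroot-0 z (push a p) i)
      ; lift  = λ a p → lift a (reroot-0⁻ z λ i → trans (sym (comb-reroot a w z j zj≉0 i)) (p i))
      }
      where open Contraction K

    -- Forgetting coordinate zero contracts an element x that spans the root. In a relation
    -- supported on {x} ∪ `C` only x contributes to coordinate zero, because `C` is killed; so {x} ∪
    -- `C` is independent, and the bound on the rank forces k to be a successor.
    contraction-unroot : ∀ {m k} {w : Fin n → Vector (suc m)} → Contraction w k → Avail w root →
      ∃ λ k′ → k ≡ suc k′ × Contraction (λ x → w x ∘ suc) k′
    contraction-unroot {m} {k} {w} K (x , s , s≉0 , root≈) = k′ , k≡ , record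
      { C     = C′
      ; indep = indep′
      ; size  = size′ k′ k≡
      ; kills = kills′
      ; push  = λ a p j → push a p (suc j)
      ; lift  = lift′
      }
      where
      open Contraction K
      C′ = ⁅ x ⁆ ∪ C

      w₀≉0 : w x zero ≉ 0#
      w₀≉0 p = 1≉0 (trans (root≈ zero) (trans (*-congˡ p) (zeroʳ s)))

      w₊≈0 : ∀ j → w x (suc j) ≈ 0#
      w₊≈0 j = x*y≈0⇒y≈0 s≉0 (sym (root≈ (suc j)))

      x∉C : x ∉ C
      x∉C x∈C = w₀≉0 (kills x∈C zero)

      card : ∣ C′ ∣ ≡ suc ∣ C ∣
      card = ∣⁅x⁆∪p∣ x C x∉C

      indep′ : LinIndep R v₀ C′
      indep′ a a≈0 p = indep a outsideC p
        where
        ax≈0 : a x ≈ 0#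
        ax≈0 = x*y≈0⇒y≈0 w₀≉0 (trans (*-comm _ _) (trans (sym (sumF-one {n} x others)) (push a p zero)))
          where
          others : ∀ y → y ≢ x → a y * w y zero ≈ 0#
          others y y≢x with y ∈? C
          ... | yes y∈C = trans (*-congˡ (kills y∈C zero)) (zeroʳ _)
          ... | no y∉C  = trans (*-congʳ (a≈0 y λ y∈C′ → [ x≢y⇒x∉⁅y⁆ y≢x , y∉C ]′ (x∈p∪q⁻ ⁅ x ⁆ C y∈C′))) (zeroˡ _)
        outsideC : ∀ y → y ∉ C → a y ≈ 0#
        outsideC y y∉C with y Fin.≟ x
        ... | yes ≡.refl = ax≈0
        ... | no y≢x     = a≈0 y λ y∈C′ → [ x≢y⇒x∉⁅y⁆ y≢x , y∉C ]′ (x∈p∪q⁻ ⁅ x ⁆ C y∈C′)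

      C<r : suc ∣ C ∣ ≤ r
      C<r = ≡.subst (ℕ._≤ r) card (rank≤ C′ (proj₂ (rep C′) indep′))

      predecessor : ∀ k → ∣ C ∣ ℕ.+ k ≡ r → ∃ λ k′ → k ≡ suc k′
      predecessor zero    eq = ⊥-elim (ℕₚ.<-irrefl (≡.trans (≡.sym (ℕₚ.+-identityʳ _)) eq) C<r)
      predecessor (suc k) eq = k , ≡.refl

      k′ = proj₁ (predecessor k size)
      k≡ = proj₂ (predecessor k size)

      size′ : ∀ k′ → k ≡ suc k′ → ∣ C′ ∣ ℕ.+ k′ ≡ r
      size′ k′ ≡.refl = ≡.trans (≡.cong (ℕ._+ k′) card) (≡.trans (≡.sym (ℕₚ.+-suc _ _)) size)

      kills′ : ∀ {y} → y ∈ C′ → ∀ j → w y (suc j) ≈ 0#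
      kills′ y∈C′ j with x∈p∪q⁻ ⁅ x ⁆ C y∈C′
      ... | inj₁ y∈x rewrite x∈⁅y⁆⇒x≡y x y∈x = w₊≈0 j
      ... | inj₂ y∈C = kills y∈C (suc j)

      lift′ : ∀ (a : Vector n) → (∀ j → comb a (λ x → w x ∘ suc) j ≈ 0#) →
        ∃ λ (b : Vector n) → (∀ y → y ∉ C′ → b y ≈ 0#) × (∀ j → comb (λ y → a y + b y) v₀ j ≈ 0#)
      lift′ a p = lifted (lift (λ y → a y + δ x c y) ≈0)
        where
        -- This multiple of x cancels coordinate zero, as `s * w x zero` equals 1.
        c = - (comb a w zero * s)
        ≈0 : ∀ j → comb (λ y → a y + δ x c y) w j ≈ 0#
        ≈0 zero = begin
          comb (λ y → a y + δ x c y) w zero ≈⟨ trans (comb-+ a (δ x c) w zero) (+-congˡ (comb-δ x c w zero)) ⟩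
          comb a w zero + c * w x zero ≈⟨ solve 3 (λ σ s w → σ :+ (:- (σ :* s)) :* w := σ :- σ :* (s :* w)) refl _ _ _ ⟩
          comb a w zero - comb a w zero * (s * w x zero) ≈⟨ +-congˡ (-‿cong (trans (*-congˡ (sym (root≈ zero))) (*-identityʳ _))) ⟩
          comb a w zero - comb a w zero ≈⟨ -‿inverseʳ _ ⟩
          0# ∎
          where open ≈-Reasoning
        ≈0 (suc j) = trans (comb-+ a (δ x c) w (suc j)) (trans (+-cong (p j) (trans (comb-δ x c w (suc j)) (trans (*-congˡ (w₊≈0 j)) (zeroʳ c)))) (+-identityˡ 0#))
        lifted : (∃ λ (b : Vector n) → (∀ y → y ∉ C → b y ≈ 0#) × (∀ j → comb (λ y → (a y + δ x c y) + b y) v₀ j ≈ 0#)) →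
          ∃ λ (b : Vector n) → (∀ y → y ∉ C′ → b y ≈ 0#) × (∀ j → comb (λ y → a y + b y) v₀ j ≈ 0#)
        lifted (b , b≈0 , q) = (λ y → δ x c y + b y) ,
          (λ y y∉C′ → trans (+-cong (δ-other x y c λ { ≡.refl → y∉C′ (x∈p∪q⁺ (inj₁ (x∈⁅x⁆ x))) }) (b≈0 y λ y∈C → y∉C′ (x∈p∪q⁺ (inj₂ y∈C)))) (+-identityˡ 0#)) ,
          λ j → trans (comb-cong v₀ (λ y → sym (+-assoc _ _ _)) j) (q j)

    -- The family (p i , q i) of pairwise independent coordinate pairs exhibits the points f i of the contraction
    -- as points on the line spanned by root and (0 , v).
    line-minor : ∀ {m k K} {w : Fin n → Vector (suc m)} → Contraction w k → (f : Fin K → Fin n) (v : Vector m) (j₀ : Fin m) → v j₀ ≉ 0# →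
      (p q : Fin K → Carrier) →
      (∀ i → w (f i) zero ≈ p i) → (∀ i j → w (f i) (suc j) ≈ q i * v j) →
      (∀ i j → i ≢ j → p i * q j - p j * q i ≉ 0#) → (∀ i → ¬ (p i ≈ 0# × q i ≈ 0#)) →
      HasMinor M (UniformIndep 2 K)
    line-minor {m} {k} {K} {w} Kw f v j₀ v≉0 p q wp wq det nonzero =
      f , f-injective , C , disjoint , C , id , proj₂ (rep C) indep , (λ J J⊆C _ → p⊆q⇒∣p∣≤∣q∣ J⊆C) ,
      λ I → (λ ∣I∣≤2 → proj₂ (rep _) (small I ∣I∣≤2)) , λ ind → large I (proj₁ (rep _) ind)
      where
      open Contraction Kw

      w≉0 : ∀ i → ¬ (∀ j → w (f i) j ≈ 0#)
      w≉0 i z = nonzero i (trans (sym (wp i)) (z zero) , x*y≈0⇒y≈0 v≉0 (trans (*-comm _ _) (trans (sym (wq i j₀)) (z (suc j₀)))))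

      fi∉C : ∀ i → f i ∉ C
      fi∉C i fi∈C = w≉0 i (kills fi∈C)

      v-cancel : ∀ {x y} → x * v j₀ ≈ y * v j₀ → x ≈ y
      v-cancel e = *-cancelˡ v≉0 (trans (*-comm _ _) (trans e (*-comm _ _)))

      f-injective : Injective _≡_ _≡_ f
      f-injective {i} {j} fi≡fj with i Fin.≟ j
      ... | yes i≡j = i≡j
      ... | no i≢j  = ⊥-elim (det i j i≢j (trans (+-cong (*-congʳ pi≈pj) (-‿cong (*-congˡ qi≈qj))) (-‿inverseʳ _)))
        where
        pi≈pj : p i ≈ p j
        pi≈pj = trans (sym (wp i)) (trans (reflexive (≡.cong (λ x → w x zero) fi≡fj)) (wp j))
        qi≈qj : q i ≈ q j
        qi≈qj = v-cancel (trans (sym (wq i j₀)) (trans (reflexive (≡.cong (λ x → w x (suc j₀)) fi≡fj)) (wq j j₀)))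

      disjoint : ∀ x → x ∈ image f Subset.⊤ → x ∉ C
      disjoint x x∈ x∈C with ∈-image⁻ f Subset.⊤ x∈
      ... | i , _ , ≡.refl = fi∉C i x∈C

      small : ∀ I → ∣ I ∣ ≤ 2 → LinIndep R v₀ (image f I ∪ C)
      small I ∣I∣≤2 a a≈0 a·v≈0 = indep a outsideC a·v≈0
        where
        a·w≈0 : ∀ j → comb a w j ≈ 0#
        a·w≈0 = push a a·v≈0

        support : ∀ x → (∀ i → i ∈ I → x ≢ f i) → ∀ j → a x * w x j ≈ 0#
        support x x∉fI j with x ∈? C
        ... | yes x∈C = trans (*-congˡ (kills x∈C j)) (zeroʳ _)
        ... | no x∉C  = trans (*-congʳ (a≈0 x λ x∈ → [ (λ x∈f → let (i , i∈I , eq) = ∈-image⁻ f I x∈f in x∉fI i i∈I (≡.sym eq)) , x∉C ]′ (x∈p∪q⁻ (image f I) C x∈))) (zeroˡ _)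

        onImage : ∀ i → i ∈ I → a (f i) ≈ 0#
        -- Since `I` has at most two elements, at most one other index j interferes, and the
        -- determinant of i and j eliminates it.
        onImage i i∈I with Finₚ.any? (λ j → ¬? (j Fin.≟ i) ×-dec (j ∈? I))
        ... | yes (j , j≢i , j∈I) = x*y≈0⇒y≈0 (det i j (j≢i ∘ ≡.sym)) (begin
          (p i * q j - p j * q i) * a (f i)
            ≈⟨ solve 6 (λ pi qj pj qi a b → (pi :* qj :- pj :* qi) :* a := (a :* pi :+ b :* pj) :* qj :- (a :* qi :+ b :* qj) :* pj) refl (p i) (q j) (p j) (q i) (a (f i)) (a (f j)) ⟩
          (a (f i) * p i + a (f j) * p j) * q j - (a (f i) * q i + a (f j) * q j) * p j
            ≈⟨ +-cong (trans (*-congʳ e₀) (zeroˡ _)) (-‿cong (trans (*-congʳ e₁) (zeroˡ _))) ⟩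
          0# - 0# ≈⟨ -‿inverseʳ 0# ⟩
          0# ∎)
          where
          open ≈-Reasoning
          two : ∀ c → a (f i) * w (f i) c + a (f j) * w (f j) c ≈ 0#
          two c = trans (sym (sumF-two {n} (f i) (f j) (j≢i ∘ ≡.sym ∘ f-injective) λ x x≢fi x≢fj → support x (others x x≢fi x≢fj) c)) (a·w≈0 c)
            where
            others : ∀ x → x ≢ f i → x ≢ f j → ∀ l → l ∈ I → x ≢ f l
            others x x≢fi x≢fj l l∈I ≡.refl = ℕₚ.<-irrefl ≡.refl
              (ℕₚ.≤-trans (three∈⇒3≤∣p∣ i∈I j∈I l∈I j≢i (λ { ≡.refl → x≢fi ≡.refl }) (λ { ≡.refl → x≢fj ≡.refl })) ∣I∣≤2)
          e₀ : a (f i) * p i + a (f j) * p j ≈ 0#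
          e₀ = trans (+-cong (*-congˡ (sym (wp i))) (*-congˡ (sym (wp j)))) (two zero)
          e₁ : a (f i) * q i + a (f j) * q j ≈ 0#
          e₁ = x*y≈0⇒y≈0 v≉0 (begin
            v j₀ * (a (f i) * q i + a (f j) * q j) ≈⟨ solve 5 (λ v a q b q′ → v :* (a :* q :+ b :* q′) := a :* (q :* v) :+ b :* (q′ :* v)) refl _ _ _ _ _ ⟩
            a (f i) * (q i * v j₀) + a (f j) * (q j * v j₀) ≈⟨ +-cong (*-congˡ (wq i j₀)) (*-congˡ (wq j j₀)) ⟨
            a (f i) * w (f i) (suc j₀) + a (f j) * w (f j) (suc j₀) ≈⟨ two (suc j₀) ⟩
            0# ∎)
        ... | no alone = decidable-stable (≟0 _) λ a≉0 → w≉0 i λ c → x*y≈0⇒y≈0 a≉0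
          (trans (sym (sumF-one {n} (f i) λ x x≢fi → support x (λ l l∈I x≡fl → alone (l , (λ { ≡.refl → x≢fi x≡fl }) , l∈I)) c)) (a·w≈0 c))

        outsideC : ∀ x → x ∉ C → a x ≈ 0#
        outsideC x x∉C with x ∈? image f I
        ... | yes x∈ with ∈-image⁻ f I x∈
        ...   | i , i∈I , ≡.refl = onImage i i∈I
        outsideC x x∉C | no x∉ = a≈0 x λ x∈ → [ x∉ , x∉C ]′ (x∈p∪q⁻ _ _ x∈)

      large : ∀ I → LinIndep R v₀ (image f I ∪ C) → ∣ I ∣ ≤ 2
      large I ind = ℕₚ.≮⇒≥ λ 3≤ → contra (extract I 3≤)
        where
        contra : (∃ λ x → x ∈ I × ∃ λ J → J ⊆ I × x ∉ J × 2 ≤ ∣ J ∣) → ⊥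
        contra (i , i∈I , J , J⊆I , i∉J , 2≤) with extract J 2≤
        ... | j , j∈J , J′ , J′⊆J , j∉J′ , 1≤ with extract J′ 1≤
        ...   | l , l∈J′ , _ = det i j i≢j (begin
          p i * q j - p j * q i ≈⟨ +-identityʳ _ ⟨
          (p i * q j - p j * q i) + 0# ≈⟨ +-cong (sym al) (sym (b≈0 (f l) (fi∉C l))) ⟩
          a (f l) + b (f l) ≈⟨ ind _ outsideAll q′ (f l) ⟩
          0# ∎)
          where
          open ≈-Reasoning
          i≢j : i ≢ j
          i≢j ≡.refl = i∉J j∈J
          i≢l : i ≢ l
          i≢l ≡.refl = i∉J (J′⊆J l∈J′)
          j≢l : j ≢ l
          j≢l ≡.refl = j∉J′ l∈J′
          -- The 2 × 2 minors are the coefficients of a linear relation among three vectors of a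
          -- plane. Lifting changes coefficients on `C` only, so the nonzero coefficient of `f l`
          -- contradicts independence.
          cl = p i * q j - p j * q i
          ci = p j * q l - p l * q j
          cj = p l * q i - p i * q l
          a : Vector n
          a x = δ (f i) ci x + (δ (f j) cj x + δ (f l) cl x)
          expand : ∀ c → comb a w c ≈ ci * w (f i) c + (cj * w (f j) c + cl * w (f l) c)
          expand c = trans (comb-+ (δ (f i) ci) (λ x → δ (f j) cj x + δ (f l) cl x) w c) (+-cong (comb-δ (f i) ci w c) (trans (comb-+ (δ (f j) cj) (δ (f l) cl) w c) (+-cong (comb-δ (f j) cj w c) (comb-δ (f l) cl w c))))
          a·w≈0 : ∀ c → comb a w c ≈ 0#
          a·w≈0 zero = trans (expand zero) (trans (+-cong (*-congˡ (wp i)) (+-cong (*-congˡ (wp j)) (*-congˡ (wp l))))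
            (solve 6 (λ pi pj pl qi qj ql → (pj :* ql :- pl :* qj) :* pi :+ ((pl :* qi :- pi :* ql) :* pj :+ (pi :* qj :- pj :* qi) :* pl) := con ℤ.0ℤ) refl (p i) (p j) (p l) (q i) (q j) (q l)))
          a·w≈0 (suc c) = trans (expand (suc c)) (trans (+-cong (*-congˡ (wq i c)) (+-cong (*-congˡ (wq j c)) (*-congˡ (wq l c))))
            (solve 7 (λ pi pj pl qi qj ql v → (pj :* ql :- pl :* qj) :* (qi :* v) :+ ((pl :* qi :- pi :* ql) :* (qj :* v) :+ (pi :* qj :- pj :* qi) :* (ql :* v)) := con ℤ.0ℤ) refl (p i) (p j) (p l) (q i) (q j) (q l) (v c)))
          lifted = lift a a·w≈0
          b = proj₁ lifted
          b≈0 = proj₁ (proj₂ lifted)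
          q′ = proj₂ (proj₂ lifted)
          al : a (f l) ≈ cl
          al = trans (+-cong (δ-other (f i) (f l) ci (i≢l ∘ ≡.sym ∘ f-injective)) (+-cong (δ-other (f j) (f l) cj (j≢l ∘ ≡.sym ∘ f-injective)) (δ-same (f l) cl)))
            (trans (+-identityˡ _) (+-identityˡ _))
          ∉fI : ∀ {x} t → t ∈ I → x ∉ image f I ∪ C → x ≢ f t
          ∉fI t t∈I x∉ ≡.refl = x∉ (x∈p∪q⁺ (inj₁ (∈-image⁺ f t∈I)))
          outsideAll : ∀ x → x ∉ image f I ∪ C → a x + b x ≈ 0#
          outsideAll x x∉ = trans (+-cong (trans (+-cong (δ-other (f i) x ci (∉fI i i∈I x∉)) (trans (+-cong (δ-other (f j) x cj (∉fI j (J⊆I j∈J) x∉)) (δ-other (f l) x cl (∉fI l (J⊆I (J′⊆J l∈J′)) x∉))) (+-identityˡ 0#))) (+-identityˡ 0#))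
            (b≈0 x (λ x∈C → x∉ (x∈p∪q⁺ (inj₂ x∈C))))) (+-identityˡ 0#)

    -- Distinct labels over one direction are distinct points of a line that also carries the root,
    -- so ℓ + 1 labels would make ℓ + 2 points.
    labels≤ℓ : ∀ {m k} {w : Fin n → Vector (suc m)} → Contraction w k → Avail w root → (v : Vector m) (j₀ : Fin m) → v j₀ ≉ 0# →
      (g : Fin (suc ℓ) → Carrier) → (∀ i j → i ≢ j → g i ≉ g j) →
      (∀ i → ∃ λ x → ∃ λ s → s ≉ 0# × g i ≈ s * w x zero × (∀ j → v j ≈ s * w x (suc j))) → ⊥
    labels≤ℓ {m} {k} {w} Kw (x₀ , s₀ , s₀≉0 , root≈) v j₀ v≉0 g g-distinct avail =
      noLine (≡.subst (λ K → HasMinor M (UniformIndep 2 K)) (ℕₚ.+-comm 2 ℓ)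
        (line-minor Kw f v j₀ v≉0 p q wp wq det nonzero))
      where
      s⁻¹ : Fin (suc ℓ) → Carrier
      s⁻¹ i = inv _ (proj₁ (proj₂ (proj₂ (avail i))))

      unscale : ∀ {s a b} (s≉0 : s ≉ 0#) → a ≈ s * b → b ≈ inv s s≉0 * a
      unscale s≉0 e = sym (trans (*-congˡ e) (trans (sym (*-assoc _ _ _)) (trans (*-congʳ (inv-* _ s≉0)) (*-identityˡ _))))

      f : Fin (suc (suc ℓ)) → Fin n
      f zero    = x₀
      f (suc i) = proj₁ (avail i)

      p q : Fin (suc (suc ℓ)) → Carrier
      p zero    = inv s₀ s₀≉0
      p (suc i) = s⁻¹ i * g i
      q zero    = 0#
      q (suc i) = s⁻¹ i

      wp : ∀ i → w (f i) zero ≈ p i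
      wp zero    = trans (unscale s₀≉0 (root≈ zero)) (*-identityʳ _)
      wp (suc i) = unscale _ (proj₁ (proj₂ (proj₂ (proj₂ (avail i)))))

      wq : ∀ i j → w (f i) (suc j) ≈ q i * v j
      wq zero    j = trans (unscale s₀≉0 (root≈ (suc j))) (trans (zeroʳ _) (sym (zeroˡ _)))
      wq (suc i) j = unscale _ (proj₂ (proj₂ (proj₂ (proj₂ (avail i)))) j)

      s⁻¹≉0 : ∀ i → s⁻¹ i ≉ 0#
      s⁻¹≉0 i = inv-≉0 _ _

      s₀⁻¹≉0 : inv s₀ s₀≉0 ≉ 0#
      s₀⁻¹≉0 = inv-≉0 _ _

      det : ∀ i j → i ≢ j → p i * q j - p j * q i ≉ 0#
      det zero    zero    i≢j e = i≢j ≡.refl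
      det zero    (suc j) i≢j e = *-≉0 s₀⁻¹≉0 (s⁻¹≉0 j) (trans (solve 3 (λ a b c → a :* b := a :* b :- c :* con ℤ.0ℤ) refl _ _ _) e)
      det (suc i) zero    i≢j e = neg-≉0 (*-≉0 s₀⁻¹≉0 (s⁻¹≉0 i)) (trans (solve 3 (λ a b c → :- (a :* b) := c :* con ℤ.0ℤ :- a :* b) refl _ _ _) e)
      det (suc i) (suc j) i≢j e = g-distinct i j (i≢j ∘ ≡.cong suc) (x∙y⁻¹≈ε⇒x≈y _ _ (x*y≈0⇒y≈0 (*-≉0 (s⁻¹≉0 i) (s⁻¹≉0 j))
        (trans (solve 4 (λ a b x y → (a :* b) :* (x :- y) := (a :* x) :* b :- (b :* y) :* a) refl _ _ _ _) e)))

      nonzero : ∀ i → ¬ (p i ≈ 0# × q i ≈ 0#)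
      nonzero zero    (e , _) = s₀⁻¹≉0 e
      nonzero (suc i) (_ , e) = s⁻¹≉0 i e

open Membership using (_∈_; lose; find)
open Sublist using (_⊆_)

-- Counting in lists and grouping by an equivalence relation

module Lists where
  open import Data.Nat using (_+_; _*_)

  remove : ∀ {A : Set} {P : A → Set} {xs : List A} → Any P xs → List A
  remove {xs = _ ∷ xs} (here _)  = xs
  remove {xs = x ∷ xs} (there p) = x ∷ remove p

  length-remove : ∀ {A : Set} {P : A → Set} {xs : List A} (p : Any P xs) → length xs ≡ suc (length (remove p))
  length-remove (here _)  = ≡.refl
  length-remove (there p) = ≡.cong suc (length-remove p)

  -- Here `R` may be many-valued. Only one partner of the first entry is removed from ys, and no
  -- other entry is deprived by this because no y serves two entries.
  pigeonhole : ∀ {A B : Set} {R : A → B → Set} {xs : List A} {ys : List B} →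
    AllPairs (λ x x′ → ∀ y → R x y → R x′ y → ⊥) xs → All (λ x → Any (R x) ys) xs → length xs ≤ length ys
  pigeonhole [] [] = z≤n
  pigeonhole {A} {B} {R} {x ∷ xs} {ys} (x∤ ∷ apart) (x∈ ∷ xs∈) =
    ≡.subst (suc (length xs) ≤_) (≡.sym (length-remove x∈)) (s≤s (pigeonhole apart (All.map (λ (x∤x′ , x′∈) → other x∈ x∤x′ x′∈) (All.zip (x∤ , xs∈)))))
    where
    other : ∀ {x′} {ys} (p : Any (R x) ys) → (∀ y → R x y → R x′ y → ⊥) → Any (R x′) ys → Any (R x′) (remove p)
    other (here r)  x∤x′ (here r′)  = ⊥-elim (x∤x′ _ r r′)
    other (here r)  x∤x′ (there q)  = q
    other (there p) x∤x′ (here r′)  = here r′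
    other (there p) x∤x′ (there q)  = there (other p x∤x′ q)

  AllPairs-resp-↭ : ∀ {A : Set} {R : A → A → Set} {xs ys : List A} → (∀ {x y} → R x y → R y x) → xs ↭ ys → AllPairs R xs → AllPairs R ys
  AllPairs-resp-↭ s Perm.refl           ps             = ps
  AllPairs-resp-↭ s (Perm.prep x p)     (q ∷ ps)       = Permₚ.All-resp-↭ p q ∷ AllPairs-resp-↭ s p ps
  AllPairs-resp-↭ s (Perm.swap x y p)   ((r ∷ q) ∷ q′ ∷ ps) = (s r ∷ Permₚ.All-resp-↭ p q′) ∷ Permₚ.All-resp-↭ p q ∷ AllPairs-resp-↭ s p ps
  AllPairs-resp-↭ s (Perm.trans p p′)   ps             = AllPairs-resp-↭ s p′ (AllPairs-resp-↭ s p ps)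

  AllPairs-++⁻ : ∀ {A : Set} {R : A → A → Set} (xs : List A) {ys} → AllPairs R (xs ++ ys) → AllPairs R xs × AllPairs R ys
  AllPairs-++⁻ []       ps       = [] , ps
  AllPairs-++⁻ (x ∷ xs) (p ∷ ps) = let (l , r) = AllPairs-++⁻ xs ps in (Allₚ.++⁻ˡ xs p ∷ l) , r

  AllPairs-concatMap⁻ : ∀ {A B : Set} {R : B → B → Set} (f : A → List B) (xs : List A) → AllPairs R (concatMap f xs) → All (λ x → AllPairs R (f x)) xs
  AllPairs-concatMap⁻ f []       ps = []
  AllPairs-concatMap⁻ f (x ∷ xs) ps = let (l , r) = AllPairs-++⁻ (f x) ps in l ∷ AllPairs-concatMap⁻ f xs r

  All-concatMap⁻ : ∀ {A B : Set} {P : B → Set} (f : A → List B) (xs : List A) → All P (concatMap f xs) → All (λ x → All P (f x)) xs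
  All-concatMap⁻ f []       ps = []
  All-concatMap⁻ f (x ∷ xs) ps = Allₚ.++⁻ˡ (f x) ps ∷ All-concatMap⁻ f xs (Allₚ.++⁻ʳ (f x) ps)

  sumBy : ∀ {A : Set} → (A → ℕ) → List A → ℕ
  sumBy f []       = 0
  sumBy f (x ∷ xs) = f x + sumBy f xs

  sumBy-++ : ∀ {A : Set} (f : A → ℕ) xs ys → sumBy f (xs ++ ys) ≡ sumBy f xs + sumBy f ys
  sumBy-++ f []       ys = ≡.refl
  sumBy-++ f (x ∷ xs) ys = ≡.trans (≡.cong (f x +_) (sumBy-++ f xs ys)) (≡.sym (ℕₚ.+-assoc (f x) _ _))

  sumBy-↭ : ∀ {A : Set} (f : A → ℕ) {xs ys} → xs ↭ ys → sumBy f xs ≡ sumBy f ys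
  sumBy-↭ f Perm.refl         = ≡.refl
  sumBy-↭ f (Perm.prep x p)   = ≡.cong (f x +_) (sumBy-↭ f p)
  sumBy-↭ f (Perm.swap {xs} x y p) = ≡.trans (≡.sym (ℕₚ.+-assoc (f x) _ _)) (≡.trans (≡.cong (_+ sumBy f xs) (ℕₚ.+-comm (f x) (f y)))
    (≡.trans (ℕₚ.+-assoc (f y) _ _) (≡.cong (λ t → f y + (f x + t)) (sumBy-↭ f p))))
  sumBy-↭ f (Perm.trans p q)  = ≡.trans (sumBy-↭ f p) (sumBy-↭ f q)

  sumBy-concatMap : ∀ {A B : Set} (f : B → ℕ) (g : A → List B) xs → sumBy f (concatMap g xs) ≡ sumBy (sumBy f ∘ g) xs
  sumBy-concatMap f g []       = ≡.refl
  sumBy-concatMap f g (x ∷ xs) = ≡.trans (sumBy-++ f (g x) _) (≡.cong (sumBy f (g x) +_) (sumBy-concatMap f g xs))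

  sumBy-map : ∀ {A B : Set} (f : B → ℕ) (g : A → B) xs → sumBy f (map g xs) ≡ sumBy (f ∘ g) xs
  sumBy-map f g []       = ≡.refl
  sumBy-map f g (x ∷ xs) = ≡.cong (f (g x) +_) (sumBy-map f g xs)

  sumBy-mono : ∀ {A : Set} {f g : A → ℕ} {xs} → All (λ x → f x ≤ g x) xs → sumBy f xs ≤ sumBy g xs
  sumBy-mono []       = z≤n
  sumBy-mono (p ∷ ps) = ℕₚ.+-mono-≤ p (sumBy-mono ps)

  sumBy-const : ∀ {A : Set} c (xs : List A) → sumBy (λ _ → c) xs ≡ length xs * c
  sumBy-const c []       = ≡.refl
  sumBy-const c (x ∷ xs) = ≡.cong (c +_) (sumBy-const c xs)

  sumBy-≤ : ∀ {A : Set} {f : A → ℕ} {c} {xs} → All (λ x → f x ≤ c) xs → sumBy f xs ≤ length xs * c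
  sumBy-≤ {c = c} {xs} ps = ≡.subst (_ ≤_) (sumBy-const c xs) (sumBy-mono ps)

  sumBy-≥ : ∀ {A : Set} {f : A → ℕ} {c} {xs} → All (λ x → c ≤ f x) xs → length xs * c ≤ sumBy f xs
  sumBy-≥ {c = c} {xs} ps = ≡.subst (_≤ _) (sumBy-const c xs) (sumBy-mono ps)

  sumBy-1 : ∀ {A : Set} (xs : List A) → sumBy (λ _ → 1) xs ≡ length xs
  sumBy-1 xs = ≡.trans (sumBy-const 1 xs) (ℕₚ.*-identityʳ _)

  sumBy-+ : ∀ {A : Set} (f g : A → ℕ) xs → sumBy (λ x → f x + g x) xs ≡ sumBy f xs + sumBy g xs
  sumBy-+ f g []       = ≡.refl
  sumBy-+ f g (x ∷ xs) = ≡.trans (≡.cong (f x + g x +_) (sumBy-+ f g xs))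
    (interchange (f x) (g x) _ _)

  sumBy-* : ∀ {A : Set} c (f : A → ℕ) xs → sumBy (λ x → c * f x) xs ≡ c * sumBy f xs
  sumBy-* c f []       = ≡.sym (ℕₚ.*-zeroʳ c)
  sumBy-* c f (x ∷ xs) = ≡.trans (≡.cong (c * f x +_) (sumBy-* c f xs)) (≡.sym (ℕₚ.*-distribˡ-+ c (f x) _))

  sumBy-0 : ∀ {A : Set} (xs : List A) → sumBy (λ _ → 0) xs ≡ 0
  sumBy-0 []       = ≡.refl
  sumBy-0 (x ∷ xs) = sumBy-0 xs

  sumBy-swap : ∀ {A B : Set} (f : A → B → ℕ) xs ys → sumBy (λ x → sumBy (f x) ys) xs ≡ sumBy (λ y → sumBy (λ x → f x y) xs) ys
  sumBy-swap f []       ys = ≡.sym (sumBy-0 ys)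
  sumBy-swap f (x ∷ xs) ys = ≡.trans (≡.cong (sumBy (f x) ys +_) (sumBy-swap f xs ys)) (≡.sym (sumBy-+ (f x) _ ys))

  ∈⇒≤sumBy : ∀ {A : Set} (f : A → ℕ) {x xs} → x ∈ xs → f x ≤ sumBy f xs
  ∈⇒≤sumBy f {xs = x ∷ xs} (here ≡.refl) = ℕₚ.m≤m+n (f x) _
  ∈⇒≤sumBy f {xs = y ∷ xs} (there p)     = ℕₚ.≤-trans (∈⇒≤sumBy f p) (ℕₚ.m≤n+m _ (f y))

  indicator : ∀ {P : Set} → Dec P → ℕ
  indicator (yes _) = 1
  indicator (no _)  = 0

  length-filter-sumBy : ∀ {A : Set} {P : A → Set} (P? : Decidable P) xs → length (filter P? xs) ≡ sumBy (indicator ∘ P?) xs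
  length-filter-sumBy P? []       = ≡.refl
  length-filter-sumBy P? (x ∷ xs) with P? x
  ... | yes _ = ≡.cong suc (length-filter-sumBy P? xs)
  ... | no _  = length-filter-sumBy P? xs

  AllPairs-filter : ∀ {A : Set} {P : A → Set} {R : A → A → Set} (P? : Decidable P) {xs} → AllPairs R xs → AllPairs R (filter P? xs)
  AllPairs-filter P? {[]}     []       = []
  AllPairs-filter P? {x ∷ xs} (p ∷ ps) with P? x
  ... | yes _ = Allₚ.filter⁺ P? p ∷ AllPairs-filter P? ps
  ... | no _  = AllPairs-filter P? ps

  argmax : ∀ {A : Set} (f : A → ℕ) x xs → ∃ λ y → y ∈ x ∷ xs × All (λ z → f z ≤ f y) (x ∷ xs)
  argmax f x []        = x , here ≡.refl , ℕₚ.≤-refl ∷ []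
  argmax f x (x′ ∷ xs) with argmax f x′ xs
  ... | y , y∈ , max with ℕₚ.≤-total (f x) (f y)
  ...   | inj₁ le = y , there y∈ , le ∷ max
  ...   | inj₂ ge = x , here ≡.refl , ℕₚ.≤-refl ∷ All.map (λ q → ℕₚ.≤-trans q ge) max

  module Grouping {A : Set} {_~_ : A → A → Set}
    (~-refl : ∀ {x} → x ~ x) (~-sym : ∀ {x y} → x ~ y → y ~ x) (~-trans : ∀ {x y z} → x ~ y → y ~ z → x ~ z)
    (_~?_ : ∀ x y → Dec (x ~ y)) (level : A → ℕ) where

    -- Members carry the proof of their relation to the head because this proof has content: for
    -- parallel vectors it contains the scalar by which labels are divided when points merge.
    record Group : Set where
      constructor group
      field
        head    : A
        members : List (Σ A (_~ head))
      elems : List A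
      elems = head ∷ map proj₁ members
    open Group public

    -- The head of a group is kept of maximal level.
    join : (x : A) (g : Group) → x ~ head g → Dec (level (head g) ≤ level x) → Group
    join x (group h ms) p (yes _) = group x ((h , ~-sym p) ∷ map (λ (y , q) → y , ~-trans q (~-sym p)) ms)
    join x (group h ms) p (no _)  = group h ((x , p) ∷ ms)

    insert : A → List Group → List Group
    insert′ : (x : A) (g : Group) (gs : List Group) → Dec (x ~ head g) → List Group
    insert x []       = group x [] ∷ []
    insert x (g ∷ gs) = insert′ x g gs (x ~? head g)
    insert′ x g gs (yes p) = join x g p (level (head g) ℕ.≤? level x) ∷ gs
    insert′ x g gs (no _)  = g ∷ insert x gs

    groups : List A → List Group
    groups []       = []
    groups (x ∷ xs) = insert x (groups xs)

    join-elems : ∀ x g p d → elems (join x g p d) ↭ x ∷ elems g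
    join-elems x (group h ms) p (yes _) = prep x (prep h (Perm.↭-reflexive (≡.trans (≡.sym (Listₚ.map-∘ ms)) ≡.refl)))
    join-elems x (group h ms) p (no _)  = swap h x ↭-refl

    insert-elems : ∀ x gs → concatMap elems (insert x gs) ↭ x ∷ concatMap elems gs
    insert-elems x []       = ↭-refl
    insert-elems x (g ∷ gs) with x ~? head g
    ... | yes p = Permₚ.++⁺ʳ (concatMap elems gs) (join-elems x g p (level (head g) ℕ.≤? level x))
    ... | no _  = ↭-trans (Permₚ.++⁺ˡ (elems g) (insert-elems x gs)) (Permₚ.shift x (elems g) (concatMap elems gs))

    groups-elems : ∀ xs → concatMap elems (groups xs) ↭ xs
    groups-elems []       = ↭-refl
    groups-elems (x ∷ xs) = ↭-trans (insert-elems x (groups xs)) (prep x (groups-elems xs))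

    Maximal : Group → Set
    Maximal g = All (λ m → level (proj₁ m) ≤ level (head g)) (members g)

    insert-maximal : ∀ x {gs} → All Maximal gs → All Maximal (insert x gs)
    insert-maximal x {[]}     []       = [] ∷ []
    insert-maximal x {g ∷ gs} (m ∷ ms) with x ~? head g
    ... | no _  = m ∷ insert-maximal x ms
    ... | yes p with level (head g) ℕ.≤? level x
    ...   | yes le = (le ∷ Allₚ.map⁺ (All.map (λ q → ℕₚ.≤-trans q le) m)) ∷ ms
    ...   | no gt  = (ℕₚ.<⇒≤ (ℕₚ.≰⇒> gt) ∷ m) ∷ ms

    groups-maximal : ∀ xs → All Maximal (groups xs)
    groups-maximal []       = []
    groups-maximal (x ∷ xs) = insert-maximal x (groups-maximal xs)

    Apart : Group → Group → Set
    Apart g g′ = ¬ head g ~ head g′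

    join-head : ∀ x g p d → head (join x g p d) ~ head g
    join-head x (group h ms) p (yes _) = p
    join-head x (group h ms) p (no _)  = ~-refl

    insert-heads : ∀ {P : A → Set} → (∀ {x y} → x ~ y → P x → P y) → ∀ x {gs} → P x → All (P ∘ head) gs → All (P ∘ head) (insert x gs)
    insert-heads resp x {[]}     px []       = px ∷ []
    insert-heads resp x {g ∷ gs} px (q ∷ qs) with x ~? head g
    ... | yes p = resp (~-sym (join-head x g p (level (head g) ℕ.≤? level x))) q ∷ qs
    ... | no _  = q ∷ insert-heads resp x px qs

    insert-apart : ∀ x {gs} → AllPairs Apart gs → AllPairs Apart (insert x gs)
    insert-apart x {[]}     []       = [] ∷ []
    insert-apart x {g ∷ gs} (a ∷ as) with x ~? head g
    ... | yes p = All.map (λ q r → q (~-trans (~-sym (join-head x g p (level (head g) ℕ.≤? level x))) r)) a ∷ as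
    ... | no ¬p = insert-heads (λ x~y ¬g~x g~y → ¬g~x (~-trans g~y (~-sym x~y))) x (λ g~x → ¬p (~-sym g~x)) a ∷ insert-apart x as

    groups-apart : ∀ xs → AllPairs Apart (groups xs)
    groups-apart []       = []
    groups-apart (x ∷ xs) = insert-apart x (groups-apart xs)

    groups-All : ∀ {P : A → Set} {xs} → All P xs → All (All P ∘ elems) (groups xs)
    groups-All {xs = xs} ps = All-concatMap⁻ elems (groups xs) (Permₚ.All-resp-↭ (↭-sym (groups-elems xs)) ps)

    groups-AllPairs : ∀ {R : A → A → Set} → (∀ {x y} → R x y → R y x) → ∀ {xs} → AllPairs R xs → All (AllPairs R ∘ elems) (groups xs)
    groups-AllPairs s {xs} ps = AllPairs-concatMap⁻ elems (groups xs) (AllPairs-resp-↭ s (↭-sym (groups-elems xs)) ps)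

    sumBy-groups : ∀ (f : A → ℕ) xs → sumBy (sumBy f ∘ elems) (groups xs) ≡ sumBy f xs
    sumBy-groups f xs = ≡.trans (≡.sym (sumBy-concatMap f elems (groups xs))) (sumBy-↭ f (groups-elems xs))

    elem~head : ∀ g → All (_~ head g) (elems g)
    elem~head g = ~-refl ∷ Allₚ.map⁺ (All.universal proj₂ (members g))

    ∈-groups : ∀ {x xs} → x ∈ xs → Any (λ g → x ∈ elems g) (groups xs)
    ∈-groups {x} {xs} x∈ = ∈ₚ.∈-concatMap⁻ elems {xs = groups xs} (Permₚ.∈-resp-↭ (↭-sym (groups-elems xs)) x∈)

  AllPairs-lookup : ∀ {A : Set} {R : A → A → Set} {xs : List A} → (∀ {x y} → R x y → R y x) → AllPairs R xs →
    ∀ i j → i ≢ j → R (lookup xs i) (lookup xs j)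
  AllPairs-lookup s (p ∷ ps) zero    zero    i≢j = ⊥-elim (i≢j ≡.refl)
  AllPairs-lookup s (p ∷ ps) zero    (suc j) i≢j = All.lookup p (∈ₚ.∈-lookup j)
  AllPairs-lookup s (p ∷ ps) (suc i) zero    i≢j = s (All.lookup p (∈ₚ.∈-lookup i))
  AllPairs-lookup s (p ∷ ps) (suc i) (suc j) i≢j = AllPairs-lookup s ps i j (i≢j ∘ ≡.cong suc)

  AllPairs-resp-⊆ : ∀ {A : Set} {R : A → A → Set} {xs ys : List A} → xs ⊆ ys → AllPairs R ys → AllPairs R xs
  AllPairs-resp-⊆ []             []       = []
  AllPairs-resp-⊆ (y ∷ʳ s)       (p ∷ ps) = AllPairs-resp-⊆ s ps
  AllPairs-resp-⊆ (≡.refl ∷ s)   (p ∷ ps) = Sublistₚ.All-resp-⊆ s p ∷ AllPairs-resp-⊆ s ps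

  pick : ∀ {A : Set} {x : A} {xs} → x ∈ xs → ∃ λ rest → xs ↭ x ∷ rest
  pick (here ≡.refl)       = _ , ↭-refl
  pick {x = x} {y ∷ xs} (there x∈) = let (rest , σ) = pick x∈ in y ∷ rest , ↭-trans (prep y σ) (swap y x ↭-refl)

  length-filter-split : ∀ {A : Set} {P : A → Set} (P? : ∀ x → Dec (P x)) xs → length xs ≡ length (filter P? xs) ℕ.+ length (filter (¬? ∘ P?) xs)
  length-filter-split P? []       = ≡.refl
  length-filter-split P? (x ∷ xs) with P? x
  ... | yes _ = ≡.cong suc (length-filter-split P? xs)
  ... | no _  = ≡.trans (≡.cong suc (length-filter-split P? xs)) (≡.sym (ℕₚ.+-suc _ _))

  apart⇒≡ : ∀ {A : Set} {S : A → A → Set} {xs : List A} → (∀ {x y} → S x y → S y x) → AllPairs (λ x y → ¬ S x y) xs →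
    ∀ {x y} → x ∈ xs → y ∈ xs → S x y → x ≡ y
  apart⇒≡ s (p ∷ ps) (here ≡.refl) (here ≡.refl) _ = ≡.refl
  apart⇒≡ s (p ∷ ps) (here ≡.refl) (there y∈)    r = ⊥-elim (All.lookup p y∈ r)
  apart⇒≡ s (p ∷ ps) (there x∈)    (here ≡.refl) r = ⊥-elim (All.lookup p x∈ (s r))
  apart⇒≡ s (p ∷ ps) (there x∈)    (there y∈)    r = apart⇒≡ s ps x∈ y∈ r

open Lists

-- Affine maps between finite sets of reals; points and their labels

module Points (R : CompleteOrderedField) where
  open Field R public
  open LinearAlgebra R public

  infix 4 _∈ₗ_
  _∈ₗ_ : Carrier → List Carrier → Set
  x ∈ₗ xs = Any (x ≈_) xs

  _∈ₗ?_ : ∀ x xs → Dec (x ∈ₗ xs)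
  x ∈ₗ? xs = Any.any? (x ≟_) xs

  ∈ₗ-resp : ∀ {x y xs} → x ≈ y → y ∈ₗ xs → x ∈ₗ xs
  ∈ₗ-resp x≈y = Any.map (trans x≈y)

  Distinct : List Carrier → Set
  Distinct = AllPairs _≉_

  distinct-length : ∀ {xs ys} → Distinct xs → All (_∈ₗ ys) xs → length xs ≤ length ys
  distinct-length d = pigeonhole (AllPairs.map (λ x≉x′ y x≈y x′≈y → x≉x′ (trans x≈y (sym x′≈y))) d)

  dedup : List Carrier → List Carrier
  dedup-insert : ∀ x xs → Dec (x ∈ₗ xs) → List Carrier
  dedup []       = []
  dedup (x ∷ xs) = dedup-insert x (dedup xs) (x ∈ₗ? dedup xs)
  dedup-insert x xs (yes _) = xs
  dedup-insert x xs (no _)  = x ∷ xs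

  dedup-distinct : ∀ xs → Distinct (dedup xs)
  dedup-distinct []       = []
  dedup-distinct (x ∷ xs) with x ∈ₗ? dedup xs
  ... | yes _ = dedup-distinct xs
  ... | no x∉ = Allₚ.¬Any⇒All¬ _ x∉ ∷ dedup-distinct xs

  dedup-All : ∀ {P : Carrier → Set} {xs} → All P xs → All P (dedup xs)
  dedup-All {xs = []}     []       = []
  dedup-All {xs = x ∷ xs} (p ∷ ps) with x ∈ₗ? dedup xs
  ... | yes _ = dedup-All ps
  ... | no _  = p ∷ dedup-All ps

  dedup-∈ : ∀ {x} xs → x ∈ₗ xs → x ∈ₗ dedup xs
  dedup-∈ (y ∷ ys) x∈ with y ∈ₗ? dedup ys
  dedup-∈ (y ∷ ys) (here x≈y) | yes y∈ = ∈ₗ-resp x≈y y∈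
  dedup-∈ (y ∷ ys) (there x∈) | yes y∈ = dedup-∈ ys x∈
  dedup-∈ (y ∷ ys) (here x≈y) | no _   = here x≈y
  dedup-∈ (y ∷ ys) (there x∈) | no _   = there (dedup-∈ ys x∈)

  extremum : (_⊑_ : Carrier → Carrier → Set) → (∀ {x} → x ⊑ x) → (∀ {x y z} → x ⊑ y → y ⊑ z → x ⊑ z) → (∀ x y → x ⊑ y ⊎ y ⊑ x) →
    ∀ x xs → ∃ λ M → M ∈ x ∷ xs × All (_⊑ M) (x ∷ xs)
  extremum _⊑_ rfl trn tot x [] = x , here ≡.refl , rfl ∷ []
  extremum _⊑_ rfl trn tot x (y ∷ ys) with extremum _⊑_ rfl trn tot y ys
  ... | M , M∈ , max with tot x M
  ...   | inj₁ x⊑M = M , there M∈ , x⊑M ∷ max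
  ...   | inj₂ M⊑x = x , here ≡.refl , rfl ∷ All.map (λ p → trn p M⊑x) max

  affine : Carrier → Carrier → Carrier → Carrier
  affine γ d s = γ + d * s

  affine-injective : ∀ {γ d x y} → d ≉ 0# → x ≉ y → affine γ d x ≉ affine γ d y
  affine-injective d≉0 x≉y e = x≉y (*-cancelˡ d≉0 (trans (solve 2 (λ g a → a := (g :+ a) :- g) refl _ _) (trans (+-congʳ e) (solve 2 (λ g a → (g :+ a) :- g := a) refl _ _))))

  SameSign : Carrier → Carrier → Set
  SameSign d d′ = (0# ≼ d × 0# ≼ d′) ⊎ (d ≼ 0# × d′ ≼ 0#)

  -- Affine maps of the same orientation from S onto T agree at the maximum and at the minimum of S.
  module Affine {S T : List Carrier} (S-distinct : Distinct S) (T≤S : length T ≤ length S)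
    {γ d γ′ d′ : Carrier} (d≉0 : d ≉ 0#) (d′≉0 : d′ ≉ 0#)
    (into : All (λ s → affine γ d s ∈ₗ T) S) (into′ : All (λ s → affine γ′ d′ s ∈ₗ T) S) where

    -- A missed t, together with the images of `S`, would form a list of distinct elements of `T`
    -- longer than `T`.
    onto : ∀ {γ d} → d ≉ 0# → All (λ s → affine γ d s ∈ₗ T) S → ∀ {t} → t ∈ₗ T → Any (λ s → t ≈ affine γ d s) S
    onto {γ} {d} d≉0 into {t} t∈T with Any.any? (λ s → t ≟ affine γ d s) S
    ... | yes p = p
    ... | no ¬p = ⊥-elim (ℕₚ.<-irrefl (Listₚ.length-map (affine γ d) S) (ℕₚ.≤-trans
      (distinct-length {t ∷ map (affine γ d) S} (Allₚ.map⁺ (Allₚ.¬Any⇒All¬ _ ¬p) ∷ AllPairsₚ.map⁺ (AllPairs.map (affine-injective d≉0) S-distinct)) (t∈T ∷ Allₚ.map⁺ into))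
      T≤S))

    -- Both maps reach all of `T`, so both values at M are the last element of `T` in the order ⊑.
    -- The order is a parameter in order to serve maxima and minima alike.
    agree : (_⊑_ : Carrier → Carrier → Set) → (∀ {x y} → x ⊑ y → y ⊑ x → x ≈ y) → (∀ {x y z} → x ≈ y → y ⊑ z → x ⊑ z) →
      ∀ {M} → M ∈ S → All (λ s → affine γ d s ⊑ affine γ d M) S → All (λ s → affine γ′ d′ s ⊑ affine γ′ d′ M) S →
      affine γ d M ≈ affine γ′ d′ M
    agree _⊑_ antisym resp {M} M∈S max max′ = antisym (below d′≉0 into′ max′ (All.lookup into M∈S)) (below d≉0 into max (All.lookup into′ M∈S))
      where
      below : ∀ {γ d t} → d ≉ 0# → All (λ s → affine γ d s ∈ₗ T) S → All (λ s → affine γ d s ⊑ affine γ d M) S → t ∈ₗ T → t ⊑ affine γ d M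
      below d≉0 into max t∈T with All.lookupAny max (onto d≉0 into t∈T)
      ... | s⊑M , t≈s = resp t≈s s⊑M

    private
      _≽_ : Carrier → Carrier → Set
      x ≽ y = y ≼ x

      affine-mono : ∀ {γ d x y} → 0# ≼ d → x ≼ y → affine γ d x ≼ affine γ d y
      affine-mono {γ} 0≼d x≼y = ≼-resp-≈ (+-comm _ _) (+-comm _ _) (+-mono-≼ γ (*-mono-≼ 0≼d x≼y))

      affine-anti : ∀ {γ d x y} → d ≼ 0# → x ≼ y → affine γ d y ≼ affine γ d x
      affine-anti {γ} d≼0 x≼y = ≼-resp-≈ (+-comm _ _) (+-comm _ _) (+-mono-≼ γ (*-antimono-≼ d≼0 x≼y))

    agree-max : SameSign d d′ → ∀ {M} → M ∈ S → All (_≼ M) S → affine γ d M ≈ affine γ′ d′ M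
    agree-max (inj₁ (p , p′)) M∈ max = agree _≼_ ≼-antisym (λ e → ≼-resp-≈ (sym e) refl) M∈ (All.map (affine-mono p) max) (All.map (affine-mono p′) max)
    agree-max (inj₂ (p , p′)) M∈ max = agree _≽_ (λ a b → ≼-antisym b a) (λ e → ≼-resp-≈ refl (sym e)) M∈ (All.map (affine-anti p) max) (All.map (affine-anti p′) max)

    agree-min : SameSign d d′ → ∀ {M} → M ∈ S → All (M ≼_) S → affine γ d M ≈ affine γ′ d′ M
    agree-min (inj₂ (p , p′)) M∈ min = agree _≼_ ≼-antisym (λ e → ≼-resp-≈ (sym e) refl) M∈ (All.map (affine-anti p) min) (All.map (affine-anti p′) min)
    agree-min (inj₁ (p , p′)) M∈ min = agree _≽_ (λ a b → ≼-antisym b a) (λ e → ≼-resp-≈ refl (sym e)) M∈ (All.map (affine-mono p) min) (All.map (affine-mono p′) min)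

  sign : ∀ d → (0# ≼ d) ⊎ (d ≼ 0#)
  sign d = ≼-total 0# d

  -- Maps of equal slope send the maximum of `S` to the same extreme element of `T`, which fixes the
  -- translation. This excludes a second label of o in `fits-single` and produces the new label in
  -- `Crossing`.
  affine-offset : ∀ {S T γ γ′ d} → Distinct S → 1 ≤ length S → length T ≤ length S → d ≉ 0# →
    All (λ s → affine γ d s ∈ₗ T) S → All (λ s → affine γ′ d s ∈ₗ T) S → γ ≈ γ′
  affine-offset {s ∷ S} {d = d} distinct _ T≤S d≉0 into into′ with extremum _≼_ ≼-refl ≼-trans ≼-total s S
  ... | M , M∈ , max = trans (solve 2 (λ g a → g := (g :+ a) :- a) refl _ _) (trans (+-congʳ (agree-max same M∈ max)) (solve 2 (λ g a → (g :+ a) :- a := g) refl _ _))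
    where
    open Affine distinct T≤S d≉0 d≉0 into into′
    same : SameSign d d
    same with sign d
    ... | inj₁ p = inj₁ (p , p)
    ... | inj₂ p = inj₂ (p , p)

  -- The maps agree at the maximum and at the minimum of `S`, and these differ because `S` has two
  -- elements.
  affine-unique : ∀ {S T γ γ′ d d′} → Distinct S → 2 ≤ length S → length T ≤ length S → d ≉ 0# → d′ ≉ 0# → SameSign d d′ →
    All (λ s → affine γ d s ∈ₗ T) S → All (λ s → affine γ′ d′ s ∈ₗ T) S → γ ≈ γ′ × d ≈ d′
  affine-unique {s ∷ []} _ (s≤s ())
  affine-unique {s ∷ s′ ∷ S} {γ = γ} {γ′} {d} {d′} distinct@((s≉s′ ∷ _) ∷ _) _ T≤S d≉0 d′≉0 same into into′
    with extremum _≼_ ≼-refl ≼-trans ≼-total s (s′ ∷ S)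
       | extremum (λ x y → y ≼ x) ≼-refl (λ p q → ≼-trans q p) (λ x y → ≼-total y x) s (s′ ∷ S)
  ... | M , M∈ , max@(s≼M ∷ s′≼M ∷ _) | m , m∈ , min@(m≼s ∷ m≼s′ ∷ _) = γ≈γ′ , d≈d′
    where
    open Affine distinct T≤S d≉0 d′≉0 into into′
    M≉m : M - m ≉ 0#
    M≉m e = s≉s′ (trans (eq s≼M m≼s) (sym (eq s′≼M m≼s′)))
      where
      M≈m = x∙y⁻¹≈ε⇒x≈y M m e
      eq : ∀ {t} → t ≼ M → m ≼ t → t ≈ M
      eq t≼M m≼t = ≼-antisym t≼M (≼-resp-≈ (sym M≈m) refl m≼t)
    eM = agree-max same M∈ max
    em = agree-min same m∈ min
    d≈d′ : d ≈ d′
    d≈d′ = *-cancelˡ M≉m (trans (solve 4 (λ g d M m → (M :- m) :* d := (g :+ d :* M) :- (g :+ d :* m)) refl γ d M m)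
      (trans (+-cong eM (-‿cong em)) (solve 4 (λ g d M m → (g :+ d :* M) :- (g :+ d :* m) := (M :- m) :* d) refl γ′ d′ M m)))
    γ≈γ′ : γ ≈ γ′
    γ≈γ′ = trans (solve 2 (λ g a → g := (g :+ a) :- a) refl _ _) (trans (+-cong eM (-‿cong (*-congʳ d≈d′))) (solve 2 (λ g a → (g :+ a) :- a := g) refl _ _))

  infix 4 _∥_
  _∥_ : ∀ {m} → Vector m → Vector m → Set
  v ∥ z = ∃ λ y → y ≉ 0# × (∀ i → v i ≈ y * z i)

  ∥-refl : ∀ {m} {v : Vector m} → v ∥ v
  ∥-refl = 1# , 1≉0 , λ i → sym (*-identityˡ _)

  ∥-sym : ∀ {m} {v z : Vector m} → v ∥ z → z ∥ v
  ∥-sym {v = v} {z} (y , y≉0 , e) = inv y y≉0 , inv-≉0 y y≉0 , λ i → sym (trans (*-congˡ (e i)) (trans (sym (*-assoc _ _ _)) (trans (*-congʳ (inv-* y y≉0)) (*-identityˡ _))))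

  ∥-trans : ∀ {m} {u v z : Vector m} → u ∥ v → v ∥ z → u ∥ z
  ∥-trans (y , y≉0 , e) (y′ , y′≉0 , e′) = y * y′ , *-≉0 y≉0 y′≉0 , λ i → trans (e i) (trans (*-congˡ (e′ i)) (sym (*-assoc _ _ _)))

  Nonzero : ∀ {m} → Vector m → Set
  Nonzero v = ∃ λ j → v j ≉ 0#

  nonzero? : ∀ {m} (v : Vector m) → Dec (Nonzero v)
  nonzero? v = Finₚ.any? λ j → ¬? (≟0 (v j))

  ∥-nonzero : ∀ {m} {v z : Vector m} → v ∥ z → Nonzero z → Nonzero v
  ∥-nonzero (y , y≉0 , e) (j , zj≉0) = j , λ vj≈0 → *-≉0 y≉0 zj≉0 (trans (sym (e j)) vj≈0)

  ¬nonzero⇒≈0 : ∀ {m} {v : Vector m} → ¬ Nonzero v → ∀ i → v i ≈ 0#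
  ¬nonzero⇒≈0 ¬nz i = decidable-stable (≟0 _) λ vi≉0 → ¬nz (i , vi≉0)

  infix 4 _∥?_
  _∥?_ : ∀ {m} (v z : Vector m) → Dec (v ∥ z)
  v ∥? z with nonzero? z
  ... | no z≈0 with nonzero? v
  ...   | no v≈0  = yes (1# , 1≉0 , λ i → trans (¬nonzero⇒≈0 v≈0 i) (sym (trans (*-congˡ (¬nonzero⇒≈0 z≈0 i)) (zeroʳ _))))
  ...   | yes v≉0 = no λ v∥z → z≈0 (∥-nonzero (∥-sym v∥z) v≉0)
  v ∥? z | yes (j , zj≉0) with ≟0 (v j)
  ...   | yes vj≈0 = no λ (y , y≉0 , e) → *-≉0 y≉0 zj≉0 (trans (sym (e j)) vj≈0)
  ...   | no vj≉0 with Finₚ.all? (λ i → v i ≟ (v j * inv (z j) zj≉0) * z i)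
  ...     | yes e = yes (_ , *-≉0 vj≉0 (inv-≉0 _ _) , e)
  ...     | no ¬e = no λ (y , y≉0 , e) → ¬e λ i → trans (e i) (*-congʳ (sym
    (trans (*-congʳ (e j)) (trans (*-assoc _ _ _) (trans (*-congˡ (*-inv _ _)) (*-identityʳ _))))))

  coef : ∀ {m} (z : Vector m) (j : Fin m) → z j ≉ 0# → Vector m → Carrier
  coef z j zj≉0 v = v j * inv (z j) zj≉0

  proj : ∀ {m} (z : Vector m) (j : Fin m) → z j ≉ 0# → Vector m → Vector m
  proj z j zj≉0 v i = v i - coef z j zj≉0 v * z i

  proj-∥ : ∀ {m} (z : Vector m) j zj≉0 {v v′} → ((y , _) : proj z j zj≉0 v ∥ proj z j zj≉0 v′) →
    ∀ i → v i ≈ (coef z j zj≉0 v - y * coef z j zj≉0 v′) * z i + y * v′ i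
  proj-∥ z j zj≉0 {v} {v′} (y , _ , e) i = begin
    v i ≈⟨ solve 2 (λ a b → a := (a :- b) :+ b) refl _ _ ⟩
    (v i - t * z i) + t * z i ≈⟨ +-congʳ (e i) ⟩
    y * (v′ i - t′ * z i) + t * z i ≈⟨ solve 5 (λ y v t t′ z → y :* (v :- t′ :* z) :+ t :* z := (t :- y :* t′) :* z :+ y :* v) refl _ _ _ _ _ ⟩
    (t - y * t′) * z i + y * v′ i ∎
    where
    open ≈-Reasoning
    t = coef z j zj≉0 v
    t′ = coef z j zj≉0 v′

  proj-≈0 : ∀ {m} (z : Vector m) j zj≉0 {v} → (∀ i → proj z j zj≉0 v i ≈ 0#) → ∀ i → v i ≈ coef z j zj≉0 v * z i
  proj-≈0 z j zj≉0 e i = x∙y⁻¹≈ε⇒x≈y _ _ (e i)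

  proj-nonzero : ∀ {m} (z : Vector m) j zj≉0 {v} → Nonzero v → ¬ v ∥ z → Nonzero (proj z j zj≉0 v)
  proj-nonzero z j zj≉0 {v} (i , vi≉0) v∦z with nonzero? (proj z j zj≉0 v)
  ... | yes p = p
  ... | no ¬p = ⊥-elim (v∦z (coef z j zj≉0 v , (λ c≈0 → vi≉0 (trans (v≈ i) (trans (*-congʳ c≈0) (zeroˡ _)))) , v≈))
    where v≈ = proj-≈0 z j zj≉0 (¬nonzero⇒≈0 ¬p)

  infixr 5 _⊹_
  _⊹_ : ∀ {m} → Carrier → Vector m → Vector (suc m)
  (a ⊹ v) zero    = a
  (a ⊹ v) (suc i) = v i

  -- A point of the contraction by the root: the elements on it are the vectors a ⊹ dir, up to scaling, for its labels a.
  record Point (m : ℕ) : Set where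
    constructor point
    field
      dir    : Vector m
      labels : List Carrier
  open Point public

  level : ∀ {m} → Point m → ℕ
  level p = length (labels p)

  -- Every label is realised by an element, but elements need not all be listed as labels. The
  -- weight bounds thus hold for partial lists, and points may be filtered out or deleted.
  record Valid {n m} (w : Fin n → Vector (suc m)) (p : Point m) : Set where
    constructor valid
    field
      nonzero  : Nonzero (dir p)
      distinct : Distinct (labels p)
      nonempty : 1 ≤ level p
      avail    : All (λ a → Avail w (a ⊹ dir p)) (labels p)

  Avail-scale : ∀ {n m} {w : Fin n → Vector m} {v z s} → s ≉ 0# → (∀ i → z i ≈ s * v i) → Avail w v → Avail w z
  Avail-scale {s = s} s≉0 e (x , t , t≉0 , e′) = x , s * t , *-≉0 s≉0 t≉0 , λ i → trans (e i) (trans (*-congˡ (e′ i)) (sym (*-assoc _ _ _)))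

  Avail-resp : ∀ {n m} {w : Fin n → Vector m} {v z} → z ≋ v → Avail w v → Avail w z
  Avail-resp e = Avail-scale 1≉0 λ i → trans (e i) (sym (*-identityˡ _))

  Avail-reroot : ∀ {n m} {w : Fin n → Vector m} z j zj≉0 {v} → Avail w v → Avail (reroot z j zj≉0 ∘ w) (reroot z j zj≉0 v)
  Avail-reroot z j zj≉0 (x , s , s≉0 , e) = x , s , s≉0 , λ i → trans (reroot-cong e i) (reroot-scale z j zj≉0 s _ i)

  Avail-tail : ∀ {n m} {w : Fin n → Vector (suc m)} {v} → Avail w v → Avail (λ x → w x ∘ suc) (v ∘ suc)
  Avail-tail (x , s , s≉0 , e) = x , s , s≉0 , e ∘ suc

  module Merging {A : Set} {m} (vec : A → Vector m) (lvl : A → ℕ) where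
    open Grouping {A} {λ x y → vec x ∥ vec y} ∥-refl ∥-sym ∥-trans (λ x y → vec x ∥? vec y) lvl public

    -- If the vector of x is y times that of h, then a over x and a / y over h span the same line.
    scaled : (A → List Carrier) → ∀ {h} → Σ A (λ x → vec x ∥ vec h) → List Carrier
    scaled lab (x , y , y≉0 , _) = map (_* inv y y≉0) (lab x)

    rawLabels : (A → List Carrier) → Group → List Carrier
    rawLabels lab (group h ms) = lab h ++ concatMap (scaled lab) ms

    merged : (A → List Carrier) → Group → Point m
    merged lab g = point (vec (head g)) (dedup (rawLabels lab g))

    level-merged : ∀ lab g {L} → Distinct L → All (_∈ₗ rawLabels lab g) L → length L ≤ level (merged lab g)
    level-merged lab g d L⊆ = distinct-length d (All.map (dedup-∈ (rawLabels lab g)) L⊆)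

    merged-valid : ∀ {n} {w : Fin n → Vector (suc m)} lab {xs} →
      All (λ x → Nonzero (vec x)) xs → All (λ x → 1 ≤ length (lab x)) xs → All (λ x → All (λ a → Avail w (a ⊹ vec x)) (lab x)) xs →
      All (Valid w ∘ merged lab) (groups xs)
    merged-valid {w = w} lab nz ne av = All.map (λ {g} → build g) (All.zip (groups-All nz , All.zip (groups-All ne , groups-All av)))
      where
      Av : A → Set
      Av x = All (λ a → Avail w (a ⊹ vec x)) (lab x)
      build : ∀ g → All (λ x → Nonzero (vec x)) (elems g) × All (λ x → 1 ≤ length (lab x)) (elems g) × All Av (elems g) → Valid w (merged lab g)
      build g@(group h ms) (nz ∷ _ , ne ∷ _ , av ∷ avs) = valid nz (dedup-distinct (rawLabels lab g)) (nonempty (lab h) ne) (dedup-All (Allₚ.++⁺ av (Allₚ.concat⁺ (Allₚ.map⁺ (All.map (λ {x} → member x) (Allₚ.map⁻ avs))))))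
        where
        nonempty : ∀ L {K} → 1 ≤ length L → 1 ≤ length (dedup (L ++ K))
        nonempty (a ∷ L) {K} _ = distinct-length {a ∷ []} ([] ∷ []) (dedup-∈ (a ∷ L ++ K) (here refl) ∷ [])
        member : ∀ (x : Σ A (λ x → vec x ∥ vec h)) → Av (proj₁ x) → All (λ a → Avail w (a ⊹ vec h)) (scaled lab x)
        member (x , y , y≉0 , e) av = Allₚ.map⁺ (All.map (Avail-scale (inv-≉0 y y≉0) λ where
          zero    → *-comm _ _
          (suc i) → sym (trans (*-congˡ (e i)) (trans (sym (*-assoc _ _ _)) (trans (*-congʳ (inv-* y y≉0)) (*-identityˡ _))))) av)

    merged-apart : ∀ lab xs → AllPairs (λ p q → ¬ dir p ∥ dir q) (map (merged lab) (groups xs))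
    merged-apart lab xs = AllPairsₚ.map⁺ (groups-apart xs)

    head⊆rawLabels : ∀ lab g {a} → a ∈ₗ lab (head g) → a ∈ₗ rawLabels lab g
    head⊆rawLabels lab (group h ms) a∈ = Anyₚ.++⁺ˡ a∈

    member⊆rawLabels : ∀ lab g {x} ((y , y≉0 , e) : vec x ∥ vec (head g)) → (x , y , y≉0 , e) ∈ members g → ∀ {a b} → a ∈ₗ lab x → b ≈ a * inv y y≉0 → b ∈ₗ rawLabels lab g
    member⊆rawLabels lab (group h ms) (y , y≉0 , e) m∈ a∈ b≈ = Anyₚ.++⁺ʳ (lab h) (Anyₚ.concat⁺ (Anyₚ.map⁺ (Any.map (λ { ≡.refl → ∈ₗ-resp b≈ (Anyₚ.map⁺ (Any.map *-congʳ a∈)) }) m∈)))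

    elem⊆rawLabels : ∀ lab g {x} → x ∈ elems g → ∃ λ y → Σ (y ≉ 0#) λ y≉0 → (∀ i → vec x i ≈ y * vec (head g) i) ×
      (∀ {a b} → a ∈ₗ lab x → b ≈ a * inv y y≉0 → b ∈ₗ rawLabels lab g)
    elem⊆rawLabels lab g (here ≡.refl) = 1# , 1≉0 , (λ i → sym (*-identityˡ _)) , λ a∈ b≈ → head⊆rawLabels lab g
      (∈ₗ-resp (trans b≈ (trans (*-congˡ (trans (sym (*-identityˡ _)) (*-inv _ 1≉0))) (*-identityʳ _))) a∈)
    elem⊆rawLabels lab g (there x∈) with find (Anyₚ.map⁻ x∈)
    ... | (x , y , y≉0 , e) , m∈ , ≡.refl = y , y≉0 , e , member⊆rawLabels lab g (y , y≉0 , e) m∈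

-- Tight lines

module Lines (R : CompleteOrderedField) where
  open Points R public

  -- The affine map α ↦ (a − x α) / y sends labels of u to labels of q, for every label a of o.
  Fits : ∀ {m} (u o q : Point m) (x y : Carrier) → Set
  Fits u o q x y = All (λ α → All (λ a → Any (λ b → a ≈ x * α + y * b) (labels q)) (labels o)) (labels u)

  record Tight {m} (u o q : Point m) : Set where
    field
      x y    : Carrier
      x≉0    : x ≉ 0#
      y≉0    : y ≉ 0#
      dir≈   : ∀ i → dir o i ≈ x * dir u i + y * dir q i
      single : level o ≡ 1
      same   : level q ≡ level u
      fits   : Fits u o q x y

  module _ {m} {u o q : Point m} {x y} (y≉0 : y ≉ 0#) (fits : Fits u o q x y) where
    slope : Carrier
    slope = - (x * inv y y≉0)

    offset : Carrier → Carrier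
    offset a = a * inv y y≉0

    fits-affine : ∀ {a} → a ∈ labels o → All (λ α → affine (offset a) slope α ∈ₗ labels q) (labels u)
    fits-affine a∈ = All.map (λ {α} f → Any.map (λ {b} e → trans (+-congʳ (*-congʳ e)) (trans
      (solve 5 (λ x α y b c → (x :* α :+ y :* b) :* c :+ (:- (x :* c)) :* α := (y :* c) :* b) refl x α y b _) (trans (*-congʳ (*-inv y y≉0)) (*-identityˡ b)))) (All.lookup f a∈)) fits

    slope≉0 : x ≉ 0# → slope ≉ 0#
    slope≉0 x≉0 = neg-≉0 (*-≉0 x≉0 (inv-≉0 y y≉0))

    fits-level : x ≉ 0# → Distinct (labels u) → 1 ≤ level o → level u ≤ level q
    fits-level x≉0 d ne = go (labels o) ne fits-affine
      where
      go : ∀ L → 1 ≤ length L → (∀ {a} → a ∈ L → All (λ α → affine (offset a) slope α ∈ₗ labels q) (labels u)) → level u ≤ level q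
      go (a ∷ L) _ f = ≡.subst (_≤ level q) (Listₚ.length-map (affine (offset a) slope) (labels u))
        (distinct-length (AllPairsₚ.map⁺ (AllPairs.map (affine-injective (slope≉0 x≉0)) d)) (Allₚ.map⁺ (f (here ≡.refl))))

    -- Two labels of o would give maps of the same slope -x / y but different offsets from the
    -- labels of u to the labels of q, which are no more numerous.
    fits-single : x ≉ 0# → Distinct (labels u) → 1 ≤ level u → level q ≤ level u → Distinct (labels o) → level o ≤ 1
    fits-single x≉0 d ne q≤u dₒ = go (labels o) dₒ fits-affine
      where
      go : ∀ L → Distinct L → (∀ {a} → a ∈ L → All (λ α → affine (offset a) slope α ∈ₗ labels q) (labels u)) → length L ≤ 1
      go []          d′ f = z≤n
      go (a ∷ [])    d′ f = s≤s z≤n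
      go (a ∷ b ∷ L) ((a≉b ∷ _) ∷ _) f = ⊥-elim (a≉b (*-cancelˡ (inv-≉0 y y≉0) (trans (*-comm _ _) (trans
        (affine-offset d ne q≤u (slope≉0 x≉0) (f (here ≡.refl)) (f (there (here ≡.refl)))) (*-comm _ _)))))

  -- Equal orientation makes the slopes -x / y and -x′ / y′ equal, and the ratio x : y alone
  -- determines the position of o on the line through u and q.
  fits-same-sign : ∀ {m} {u o o′ q : Point m} {x y x′ y′} (y≉0 : y ≉ 0#) (y′≉0 : y′ ≉ 0#) → x ≉ 0# → x′ ≉ 0# →
    (∀ i → dir o i ≈ x * dir u i + y * dir q i) → (∀ i → dir o′ i ≈ x′ * dir u i + y′ * dir q i) →
    (f : Fits u o q x y) (f′ : Fits u o′ q x′ y′) → Distinct (labels u) → 2 ≤ level u → level q ≤ level u → 1 ≤ level o → 1 ≤ level o′ →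
    SameSign (slope {u = u} {o} {q} y≉0 f) (slope {u = u} {o′} {q} y′≉0 f′) → dir o ∥ dir o′
  fits-same-sign {u = u} {o} {o′} {q} {x} {y} {x′} {y′} y≉0 y′≉0 x≉0 x′≉0 e e′ f f′ d 2≤ q≤u ne ne′ ss =
    y * inv y′ y′≉0 , *-≉0 y≉0 (inv-≉0 _ _) , λ i → begin
      dir o i ≈⟨ e i ⟩
      x * dir u i + y * dir q i ≈⟨ +-congʳ (*-congʳ x≈) ⟩
      (y * (x′ * inv y′ y′≉0)) * dir u i + y * dir q i ≈⟨ +-congˡ (trans (*-congʳ (sym (trans (*-congˡ (inv-* y′ y′≉0)) (*-identityʳ y)))) refl) ⟩
      (y * (x′ * inv y′ y′≉0)) * dir u i + (y * (inv y′ y′≉0 * y′)) * dir q i ≈⟨ solve 6 (λ y x c u y′ q → (y :* (x :* c)) :* u :+ (y :* (c :* y′)) :* q := (y :* c) :* (x :* u :+ y′ :* q)) refl _ _ _ _ _ _ ⟩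
      (y * inv y′ y′≉0) * (x′ * dir u i + y′ * dir q i) ≈⟨ *-congˡ (e′ i) ⟨
      (y * inv y′ y′≉0) * dir o′ i ∎
    where
    open ≈-Reasoning
    slopes : slope {u = u} {o} {q} y≉0 f ≈ slope {u = u} {o′} {q} y′≉0 f′
    slopes = go (labels o) (labels o′) ne ne′ (fits-affine {u = u} {o} {q} y≉0 f) (fits-affine {u = u} {o′} {q} y′≉0 f′)
      where
      go : ∀ L L′ → 1 ≤ length L → 1 ≤ length L′ →
        (∀ {a} → a ∈ L → All (λ α → affine (offset {u = u} {o} {q} y≉0 f a) (slope {u = u} {o} {q} y≉0 f) α ∈ₗ labels q) (labels u)) →
        (∀ {a} → a ∈ L′ → All (λ α → affine (offset {u = u} {o′} {q} y′≉0 f′ a) (slope {u = u} {o′} {q} y′≉0 f′) α ∈ₗ labels q) (labels u)) →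
        slope {u = u} {o} {q} y≉0 f ≈ slope {u = u} {o′} {q} y′≉0 f′
      go (a ∷ _) (b ∷ _) _ _ g g′ = proj₂ (affine-unique d 2≤ q≤u (slope≉0 {u = u} {o} {q} y≉0 f x≉0) (slope≉0 {u = u} {o′} {q} y′≉0 f′ x′≉0) ss (g (here ≡.refl)) (g′ (here ≡.refl)))
    ratio : x * inv y y≉0 ≈ x′ * inv y′ y′≉0
    ratio = trans (sym (-‿involutive _)) (trans (-‿cong slopes) (-‿involutive _))
    x≈ : x ≈ y * (x′ * inv y′ y′≉0)
    x≈ = trans (sym (*-identityʳ x)) (trans (*-congˡ (sym (*-inv y y≉0))) (trans (solve 3 (λ x y c → x :* (y :* c) := y :* (x :* c)) refl _ _ _) (*-congˡ ratio)))

  infix 4 _∦_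
  _∦_ : ∀ {m} → Point m → Point m → Set
  p ∦ q = ¬ dir p ∥ dir q

  ∦-sym : ∀ {m} {p q : Point m} → p ∦ q → q ∦ p
  ∦-sym p∦q q∥p = p∦q (∥-sym q∥p)

  module Through {m} (u : Point m) (j : Fin m) (uj≉0 : dir u j ≉ 0#) where
    t : Point m → Carrier
    t p = coef (dir u) j uj≉0 (dir p)

    open Merging (λ p → proj (dir u) j uj≉0 (dir p)) level public

    labelsAt : Carrier → Point m → List Carrier
    labelsAt α p = map (λ a → a - t p * α) (labels p)

    labelsAt-distinct : ∀ α p → Distinct (labels p) → Distinct (labelsAt α p)
    labelsAt-distinct α p d = AllPairsₚ.map⁺ (AllPairs.map (λ a≉b e → a≉b (trans (solve 2 (λ a b → a := (a :- b) :+ b) refl _ _) (trans (+-congʳ e) (solve 2 (λ a b → (a :- b) :+ b := a) refl _ _)))) d)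

    head-level≤merged : ∀ α g → Distinct (labels (head g)) → level (head g) ≤ level (merged (labelsAt α) g)
    head-level≤merged α g d = ≡.subst (_≤ level (merged (labelsAt α) g)) (Listₚ.length-map _ (labels (head g)))
      (level-merged (labelsAt α) g (labelsAt-distinct α (head g) d) (All.tabulate λ a∈ → head⊆rawLabels (labelsAt α) g (lose a∈ refl)))

    Outgrown : Group → Set
    Outgrown g = Any (λ α → suc (level (head g)) ≤ level (merged (labelsAt α) g)) (labels u)

    -- A member o satisfies dir o = X u + y q, where X is nonzero because o and q are different
    -- points. When the search for a label outside those of q fails at every α, its failures,
    -- multiplied by y, are the equations of `Fits`.
    dichotomy : ∀ g → Distinct (labels u) → 2 ≤ level u → All (λ p → Distinct (labels p) × 1 ≤ level p) (elems g) → AllPairs _∦_ (elems g) →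
      level (head g) ≤ level u → Outgrown g ⊎ (All (λ o → Tight u o (head g)) (map proj₁ (members g)) × length (map proj₁ (members g)) ≤ 2)
    dichotomy g@(group q ms) du 2≤u ((dq , _) ∷ dms) (q∦ms ∷ ms∦) q≤u = decide (Any.any? (λ α → Any.any? (outside? α) ms) (labels u))
      where
      Member = Σ (Point m) (λ p → proj (dir u) j uj≉0 (dir p) ∥ proj (dir u) j uj≉0 (dir q))

      new : Carrier → Member → Carrier → Carrier
      new α (p , y , y≉0 , _) a = (a - t p * α) * inv y y≉0

      Outside : Carrier → Member → Set
      Outside α mb = Any (λ a → ¬ new α mb a ∈ₗ labelsAt α q) (labels (proj₁ mb))

      outside? : ∀ α mb → Dec (Outside α mb)
      outside? α mb = Any.any? (λ a → ¬? (new α mb a ∈ₗ? labelsAt α q)) (labels (proj₁ mb))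

      grows : ∀ {α} → Any (Outside α) ms → suc (level q) ≤ level (merged (labelsAt α) g)
      grows {α} out with find out
      ... | mb@(p , y , y≉0 , e) , mb∈ , out′ with find out′
      ...   | a , a∈ , a∉ = ≡.subst (λ l → suc l ≤ level (merged (labelsAt α) g)) (Listₚ.length-map _ (labels q))
        (level-merged (labelsAt α) g {new α mb a ∷ labelsAt α q} (Allₚ.¬Any⇒All¬ _ a∉ ∷ labelsAt-distinct α q dq)
          (member⊆rawLabels (labelsAt α) g (y , y≉0 , e) mb∈ (Anyₚ.map⁺ (lose a∈ refl)) refl ∷ All.tabulate λ b∈ → head⊆rawLabels (labelsAt α) g (lose b∈ refl)))

      X : Member → Carrier
      X (p , y , _) = t p - y * t q

      dir≈′ : ∀ ((p , e) : Member) → ∀ i → dir p i ≈ X (p , e) * dir u i + proj₁ e * dir q i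
      dir≈′ (p , e) = proj-∥ (dir u) j uj≉0 {dir p} {dir q} e

      X≉0 : ∀ (mb : Member) → q ∦ proj₁ mb → X mb ≉ 0#
      X≉0 mb@(p , y , y≉0 , e) q∦p X≈0 = q∦p (∥-sym (y , y≉0 , λ i → trans (dir≈′ mb i) (trans (+-congʳ (trans (*-congʳ X≈0) (zeroˡ _))) (+-identityˡ _))))

      decide : Dec (Any (λ α → Any (Outside α) ms) (labels u)) → Outgrown g ⊎ (All (λ o → Tight u o q) (map proj₁ ms) × length (map proj₁ ms) ≤ 2)
      decide (yes out) = inj₁ (Any.map grows out)
      decide (no ¬out) = inj₂ (Allₚ.map⁺ (All.tabulate tight) , atMostTwo ms id ms∦)
        where
        inside : ∀ {α mb a} → α ∈ labels u → mb ∈ ms → a ∈ labels (proj₁ mb) → new α mb a ∈ₗ labelsAt α q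
        inside {α} {mb} {a} α∈ mb∈ a∈ with new α mb a ∈ₗ? labelsAt α q
        ... | yes p = p
        ... | no ¬p = ⊥-elim (¬out (lose α∈ (lose mb∈ (lose a∈ ¬p))))

        fits′ : ∀ {mb} → mb ∈ ms → Fits u (proj₁ mb) q (X mb) (proj₁ (proj₂ mb))
        fits′ {mb@(p , y , y≉0 , e)} mb∈ = All.tabulate λ {α} α∈ → All.tabulate λ {a} a∈ → Any.map (λ {b} → equation α a b) (Anyₚ.map⁻ (inside α∈ mb∈ a∈))
          where
          equation : ∀ α a b → (a - t p * α) * inv y y≉0 ≈ b - t q * α → a ≈ X mb * α + y * b
          equation α a b eq = begin
            a ≈⟨ solve 2 (λ a c → a := (a :- c) :+ c) refl _ _ ⟩
            (a - t p * α) + t p * α ≈⟨ +-congʳ (trans (sym (*-identityʳ _)) (*-congˡ (sym (inv-* y y≉0)))) ⟩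
            (a - t p * α) * (inv y y≉0 * y) + t p * α ≈⟨ +-congʳ (sym (*-assoc _ _ _)) ⟩
            ((a - t p * α) * inv y y≉0) * y + t p * α ≈⟨ +-congʳ (*-congʳ eq) ⟩
            (b - t q * α) * y + t p * α ≈⟨ solve 5 (λ b tq α y tp → (b :- tq :* α) :* y :+ tp :* α := (tp :- y :* tq) :* α :+ y :* b) refl _ _ _ _ _ ⟩
            X mb * α + y * b ∎
            where open ≈-Reasoning

        q∦ : ∀ {mb} → mb ∈ ms → q ∦ proj₁ mb
        q∦ mb∈ = All.lookup (Allₚ.map⁻ q∦ms) mb∈

        valid′ : ∀ {mb} → mb ∈ ms → Distinct (labels (proj₁ mb)) × 1 ≤ level (proj₁ mb)
        valid′ mb∈ = All.lookup (Allₚ.map⁻ dms) mb∈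

        1≤u : 1 ≤ level u
        1≤u = ℕₚ.≤-trans (s≤s z≤n) 2≤u

        tight : ∀ {mb} → mb ∈ ms → Tight u (proj₁ mb) q
        tight {mb@(p , y , y≉0 , e)} mb∈ = record
          { x = X mb ; y = y ; x≉0 = x≉0 ; y≉0 = y≉0 ; dir≈ = dir≈′ mb
          ; single = ℕₚ.≤-antisym (fits-single {u = u} {p} {q} y≉0 f x≉0 du 1≤u q≤u (proj₁ (valid′ mb∈))) (proj₂ (valid′ mb∈))
          ; same = ℕₚ.≤-antisym q≤u (fits-level {u = u} {p} {q} y≉0 f x≉0 du (proj₂ (valid′ mb∈)))
          ; fits = f }
          where
          x≉0 = X≉0 mb (q∦ mb∈)
          f = fits′ mb∈

        parallel : ∀ {mb mb′} (mb∈ : mb ∈ ms) (mb∈′ : mb′ ∈ ms) → let y≉0 = proj₁ (proj₂ (proj₂ mb)); y′≉0 = proj₁ (proj₂ (proj₂ mb′)) in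
          SameSign (slope {u = u} {proj₁ mb} {q} y≉0 (fits′ mb∈)) (slope {u = u} {proj₁ mb′} {q} y′≉0 (fits′ mb∈′)) → dir (proj₁ mb) ∥ dir (proj₁ mb′)
        parallel {mb} {mb′} mb∈ mb∈′ = fits-same-sign {u = u} {proj₁ mb} {proj₁ mb′} {q} (proj₁ (proj₂ (proj₂ mb))) (proj₁ (proj₂ (proj₂ mb′))) (X≉0 mb (q∦ mb∈)) (X≉0 mb′ (q∦ mb∈′))
          (dir≈′ mb) (dir≈′ mb′) (fits′ mb∈) (fits′ mb∈′) du 2≤u q≤u (proj₂ (valid′ mb∈)) (proj₂ (valid′ mb∈′))

        sign′ : ∀ {mb} (mb∈ : mb ∈ ms) → let s = slope {u = u} {proj₁ mb} {q} (proj₁ (proj₂ (proj₂ mb))) (fits′ mb∈) in (0# ≼ s) ⊎ (s ≼ 0#)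
        sign′ mb∈ = sign _

        atMostTwo : ∀ ns → (∀ {mb} → mb ∈ ns → mb ∈ ms) → AllPairs _∦_ (map proj₁ ns) → length (map proj₁ ns) ≤ 2
        atMostTwo []                sub ap = z≤n
        atMostTwo (a ∷ [])          sub ap = s≤s z≤n
        atMostTwo (a ∷ b ∷ [])      sub ap = ℕₚ.≤-refl
        -- Two of the three slopes have the same sign, which makes their points parallel.
        atMostTwo (a ∷ b ∷ c ∷ _) sub ((a∦b ∷ a∦c ∷ _) ∷ (b∦c ∷ _) ∷ _) = ⊥-elim (choose (sign′ a∈) (sign′ b∈) (sign′ c∈))
          where
          a∈ = sub (here ≡.refl)
          b∈ = sub (there (here ≡.refl))
          c∈ = sub (there (there (here ≡.refl)))
          choose : _ → _ → _ → ⊥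
          choose (inj₁ p) (inj₁ p′) _         = a∦b (parallel a∈ b∈ (inj₁ (p , p′)))
          choose (inj₂ p) (inj₂ p′) _         = a∦b (parallel a∈ b∈ (inj₂ (p , p′)))
          choose (inj₁ p) (inj₂ _)  (inj₁ p′) = a∦c (parallel a∈ c∈ (inj₁ (p , p′)))
          choose (inj₂ p) (inj₁ _)  (inj₂ p′) = a∦c (parallel a∈ c∈ (inj₂ (p , p′)))
          choose (inj₁ _) (inj₂ p)  (inj₂ p′) = b∦c (parallel b∈ c∈ (inj₂ (p , p′)))
          choose (inj₂ _) (inj₁ p)  (inj₁ p′) = b∦c (parallel b∈ c∈ (inj₁ (p , p′)))

-- Weights and constants

Λ : ℕ → ℕ → ℕ
Λ Q zero    = 0
Λ Q (suc i) = Q ℕ.^ i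

module _ {Q : ℕ} (1≤Q : 1 ≤ Q) where
  1≤^ : ∀ i → 1 ≤ Q ℕ.^ i
  1≤^ zero    = ℕₚ.≤-refl
  1≤^ (suc i) = ℕₚ.*-mono-≤ 1≤Q (1≤^ i)

  Λ-mono : ∀ {i j} → i ≤ j → Λ Q i ≤ Λ Q j
  Λ-mono {zero}                z≤n       = z≤n
  Λ-mono {suc zero}    {suc j} (s≤s le)  = 1≤^ j
  Λ-mono {suc (suc i)} {suc (suc j)} (s≤s le) = ℕₚ.*-monoʳ-≤ Q (Λ-mono le)

  1≤Λ : ∀ {i} → 1 ≤ i → 1 ≤ Λ Q i
  1≤Λ (s≤s {n = i} _) = 1≤^ i

Λ-step : ∀ Q i → Q ℕ.* Λ Q i ≤ Λ Q (suc i)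
Λ-step Q zero    = ≡.subst (_≤ 1) (≡.sym (ℕₚ.*-zeroʳ Q)) z≤n
Λ-step Q (suc i) = ℕₚ.≤-refl

-- C bounds the number of heavy points per unit of rank, and D = 1 + ℓ + ℓ² the number of points lost in a plane.
-- Q is so large that a positive fraction of k points, gaining one label each, outweighs all losses of three contractions.
module Constants (ℓ : ℕ) where
  C K₁ Q L D c : ℕ
  C  = Λ (ℓ ℕ.* ℓ) ℓ
  K₁ = (ℓ ℕ.* ℓ ℕ.* ℓ) ℕ.* (3 ℕ.+ 3 ℕ.* (ℓ ℕ.* C) ℕ.+ C)
  Q  = suc (ℓ ℕ.* ℓ ℕ.+ K₁)
  L  = Λ Q ℓ
  D  = suc (ℓ ℕ.* suc ℓ)
  c  = L ℕ.+ 2 ℕ.* D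

  quota : ℕ → ℕ
  quota k = k ℕ.* k ℕ.+ c ℕ.* k

-- Rooted contractions of the given matroid

module Extremal (R : CompleteOrderedField) {n m₀ : ℕ} (M : Matroid n) (v₀ : Fin n → Fin m₀ → CompleteOrderedField.Carrier R)
  (rep : ∀ I → (Indep M I → LinIndep R v₀ I) × (LinIndep R v₀ I → Indep M I))
  (r : ℕ) (rank≤ : ∀ I → Indep M I → ∣ I ∣ ≤ r)
  (ℓ : ℕ) (noLine : ¬ HasMinor M (UniformIndep 2 (ℓ ℕ.+ 2))) (1≤ℓ : 1 ≤ ℓ) where

  open Lines R
  open Constants ℓ using (C)
  open Representation M v₀ rep r rank≤ ℓ noLine

  Rooted : ∀ {m} → (Fin n → Vector (suc m)) → ℕ → Set
  Rooted w k = Contraction w (suc k) × Avail w root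

  level≤ℓ : ∀ {m k} {w : Fin n → Vector (suc m)} → Rooted w k → ∀ {p : Point m} → Valid w p → level p ≤ ℓ
  level≤ℓ (K , av) {p} (valid (j , nz) distinct _ avail) = ℕₚ.≮⇒≥ λ ℓ< → labels≤ℓ K av (dir p) j nz
    (λ i → lookup (labels p) (Fin.inject≤ i ℓ<))
    (λ i i′ i≢i′ → AllPairs-lookup (λ x≉y y≈x → x≉y (sym y≈x)) distinct _ _ (i≢i′ ∘ Finₚ.inject≤-injective ℓ< ℓ< i i′))
    (λ i → let (x , s , s≉0 , e) = All.lookup avail (∈ₚ.∈-lookup (Fin.inject≤ i ℓ<)) in x , s , s≉0 , e zero , e ∘ suc)

  tail : ∀ {m k} {w : Fin n → Vector (suc m)} → Rooted w k → Contraction (λ x → w x ∘ suc) k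
  tail (K , av) with contraction-unroot K av
  ... | _ , ≡.refl , K′ = K′

  reroot-rooted : ∀ {m k} {v : Fin n → Vector m} → Contraction v k → ∀ z j (zj≉0 : z j ≉ 0#) → Avail v z →
    ∃ λ k′ → k ≡ suc k′ × Rooted (reroot z j zj≉0 ∘ v) k′
  reroot-rooted K z j zj≉0 az = go K′ (contraction-unroot K′ av)
    where
    K′ = contraction-reroot K z j zj≉0
    av = Avail-resp (λ i → sym (reroot-self z j zj≉0 i)) (Avail-reroot z j zj≉0 az)
    go : ∀ {k} → Contraction _ k → (∃ λ k′ → k ≡ suc k′ × _) → ∃ λ k′ → k ≡ suc k′ × Rooted _ k′
    go K′ (k′ , ≡.refl , _) = k′ , ≡.refl , K′ , av

  module _ {m} (w : Fin n → Vector (suc m)) (α : Carrier) (u : Vector m) (j : Fin m) (uj≉0 : u j ≉ 0#) where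
    -- The pivot is a coordinate of the direction, where the root has entry zero. The projection
    -- therefore fixes the root, and coordinate zero still measures labels.
    contracted : Fin n → Vector (suc m)
    contracted x = proj (α ⊹ u) (suc j) uj≉0 (w x)

    Avail-contracted : ∀ {v} → Avail w v → Avail contracted (proj (α ⊹ u) (suc j) uj≉0 v)
    Avail-contracted av = Avail-tail (Avail-reroot (α ⊹ u) (suc j) uj≉0 av)

    Avail-contracted-⊹ : ∀ {a v} → Avail w (a ⊹ v) → Avail contracted ((a - coef u j uj≉0 v * α) ⊹ proj u j uj≉0 v)
    Avail-contracted-⊹ av = Avail-resp (λ { zero → refl ; (suc i) → refl }) (Avail-contracted av)

    contracted-rooted : ∀ {k} → Rooted w k → Avail w (α ⊹ u) → ∃ λ k′ → k ≡ suc k′ × Rooted contracted k′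
    contracted-rooted (K , av) az with reroot-rooted K (α ⊹ u) (suc j) uj≉0 az
    ... | k₁ , ≡.refl , K₁ , av₁ with contraction-unroot K₁ av₁
    -- The desired family is already given by `K₂`; forgetting the root once more only shows that
    -- some rank remains for it.
    ...   | _ , ≡.refl , K₂ = go (contraction-unroot K₂ av₂)
      where
      av₂ : Avail contracted root
      av₂ = Avail-resp (λ i → sym (trans (+-congˡ (-‿cong (trans (*-congʳ (zeroˡ _)) (zeroˡ _)))) (trans (+-congˡ -0#≈0#) (+-identityʳ _)))) (Avail-contracted av)
      go : (∃ λ k′ → _ ≡ suc k′ × Contraction (λ x → contracted x ∘ suc) k′) → ∃ λ k′ → _ ≡ suc k′ × Rooted contracted k′
      go (k′ , ≡.refl , _) = k′ , ≡.refl , K₂ , av₂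

  dir-avail : ∀ {m} {w : Fin n → Vector (suc m)} {p : Point m} → Valid w p → Avail (λ x → w x ∘ suc) (dir p)
  dir-avail {p = p} (valid _ _ ne av) = go (labels p) ne av
    where
    go : ∀ L → 1 ≤ length L → All (λ a → Avail _ (a ⊹ dir p)) L → Avail _ (dir p)
    go (a ∷ L) _ (av ∷ _) = Avail-tail av

  -- With z as a new root, the vectors on one line through z become labels of one point, so bounds
  -- for labels turn into bounds for points on lines. The argument `lvl` makes these groups the same
  -- as those of `Through`.
  module Reroot {A : Set} {m} (vec : A → Vector m) (lvl : A → ℕ) {v : Fin n → Vector m} (z : Vector m) (j : Fin m) (zj≉0 : z j ≉ 0#) where
    open Merging (λ x → proj z j zj≉0 (vec x)) lvl

    lab : A → List Carrier
    lab x = coef z j zj≉0 (vec x) ∷ []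

    reroot-valid : ∀ {xs} → All (λ x → Nonzero (vec x)) xs → All (λ x → ¬ vec x ∥ z) xs → All (λ x → Avail v (vec x)) xs →
      All (Valid (reroot z j zj≉0 ∘ v) ∘ merged lab) (groups xs)
    reroot-valid nz ∦z av = merged-valid lab (All.map (λ (p , q) → proj-nonzero z j zj≉0 p q) (All.zip (nz , ∦z))) (All.universal (λ _ → s≤s z≤n) _)
      (All.map (λ {x} a → Avail-resp (λ { zero → refl ; (suc i) → refl }) (Avail-reroot z j zj≉0 a) ∷ []) av)

    -- A label τ over the head determines its vector up to scaling, so pairwise nonparallel vectors
    -- yield different labels.
    size≤level : ∀ g → AllPairs (λ x y → ¬ vec x ∥ vec y) (elems g) → length (elems g) ≤ level (merged lab g)
    size≤level g ap = pigeonhole {R = On} (AllPairs.map (λ x∦y τ p q → x∦y (∥-trans p (∥-sym q))) ap) (All.tabulate found)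
      where
      On : A → Carrier → Set
      On x τ = vec x ∥ (λ i → τ * z i + proj z j zj≉0 (vec (head g)) i)
      found : ∀ {x} → x ∈ elems g → Any (On x) (labels (merged lab g))
      found {x} x∈ with elem⊆rawLabels lab g x∈
      ... | y , y≉0 , e , raw = Any.map on (dedup-∈ (rawLabels lab g) (raw (here refl) refl))
        where
        c = coef z j zj≉0 (vec x)
        on : ∀ {τ} → c * inv y y≉0 ≈ τ → On x τ
        on {τ} c≈ = y , y≉0 , λ i → begin
          vec x i ≈⟨ solve 2 (λ a b → a := (a :- b) :+ b) refl _ _ ⟩
          (vec x i - c * z i) + c * z i ≈⟨ +-cong (e i) (*-congʳ (trans (sym (*-identityʳ c)) (*-congˡ (sym (inv-* y y≉0))))) ⟩
          y * proj z j zj≉0 (vec (head g)) i + (c * (inv y y≉0 * y)) * z i ≈⟨ +-congˡ (*-congʳ (trans (sym (*-assoc _ _ _)) (*-congʳ c≈))) ⟩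
          y * proj z j zj≉0 (vec (head g)) i + (τ * y) * z i ≈⟨ solve 4 (λ y p τ z → y :* p :+ (τ :* y) :* z := y :* (τ :* z :+ p)) refl _ _ _ _ ⟩
          y * (τ * z i + proj z j zj≉0 (vec (head g)) i) ∎
          where open ≈-Reasoning

    size≤ℓ : ∀ {k} → Contraction v k → Avail v z → ∀ {xs} → All (λ x → Nonzero (vec x)) xs → All (λ x → ¬ vec x ∥ z) xs → All (λ x → Avail v (vec x)) xs →
      AllPairs (λ x y → ¬ vec x ∥ vec y) xs → All (λ g → length (elems g) ≤ ℓ) (groups xs)
    size≤ℓ K az nz ∦z av ap = All.map (λ {g} (p , q) → ℕₚ.≤-trans (size≤level g p) (level≤ℓ (proj₂ (proj₂ (reroot-rooted K z j zj≉0 az))) q))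
      (All.zip (groups-AllPairs (λ x∦y y∥x → x∦y (∥-sym y∥x)) ap , reroot-valid nz ∦z av))

  record Config {m} (w : Fin n → Vector (suc m)) (ps : List (Point m)) : Set where
    constructor config
    field
      allValid : All (Valid w) ps
      apart    : AllPairs _∦_ ps
  open Config

  Config-↭ : ∀ {m} {w : Fin n → Vector (suc m)} {ps qs : List (Point m)} → ps ↭ qs → Config w ps → Config w qs
  Config-↭ σ (config v a) = config (Permₚ.All-resp-↭ σ v) (AllPairs-resp-↭ (λ {p} {q} → ∦-sym {p = p} {q}) σ a)

  Ψ : ∀ {m} → ℕ → List (Point m) → ℕ
  Ψ Q = sumBy (Λ Q ∘ level)

  -- The o's whose weight is lost when u is contracted, and the points q with which they merge.
  record Losses {m} (u : Point m) (Isolated : Point m → Set) (ps : List (Point m)) : Set where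
    field
      os      : List (Point m)
      qs      : List (Point m)
      os⊆     : os ⊆ ps
      qs⊆     : qs ⊆ ps
      os-tight : All (λ o → ∃ λ q → q ∈ ps × Tight u o q × Isolated q) os
      qs-tight : All (λ q → ∃ λ o → o ∈ ps × Tight u o q) qs
      os≤2qs  : length os ≤ 2 ℕ.* length qs

  no-losses : ∀ {m} {u : Point m} {Isolated ps} → Losses u Isolated ps
  no-losses = record { os = [] ; qs = [] ; os⊆ = minimum _ ; qs⊆ = minimum _ ; os-tight = [] ; qs-tight = [] ; os≤2qs = z≤n }

  -- The point q is listed only if something is lost on its line, since each entry of `qs` has to be
  -- tight with some o.
  line-losses : ∀ {m} {u q : Point m} {Isolated os} → Isolated q → All (λ o → Tight u o q) os → length os ≤ 2 → Losses u Isolated (q ∷ os)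
  line-losses {os = []}     iso _       _  = no-losses
  line-losses {q = q} {os = o ∷ os} iso (t ∷ ts) ≤2 = record
    { os = o ∷ os ; qs = q ∷ [] ; os⊆ = q ∷ʳ ⊆-refl ; qs⊆ = ≡.refl ∷ minimum _
    ; os-tight = All.map (λ t → q , here ≡.refl , t , iso) (t ∷ ts) ; qs-tight = (o , there (here ≡.refl) , t) ∷ [] ; os≤2qs = ≤2 }

  length-line-losses : ∀ {m} {u q : Point m} {Isolated : Point m → Set} {os} (iso : Isolated q) (ts : All (λ o → Tight u o q) os) (≤2 : length os ≤ 2) →
    length (Losses.os (line-losses {Isolated = Isolated} iso ts ≤2)) ≡ length os
  length-line-losses iso []      _ = ≡.refl
  length-line-losses iso (_ ∷ _) _ = ≡.refl

  _⊕_ : ∀ {m} {u : Point m} {Isolated ps qs} → Losses u Isolated ps → Losses u Isolated qs → Losses u Isolated (ps ++ qs)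
  _⊕_ {ps = ps} L L′ = record
    { os = L.os ++ L′.os ; qs = L.qs ++ L′.qs
    ; os⊆ = Sublistₚ.++⁺ L.os⊆ L′.os⊆ ; qs⊆ = Sublistₚ.++⁺ L.qs⊆ L′.qs⊆
    ; os-tight = Allₚ.++⁺ (All.map (λ (q , q∈ , t) → q , ∈ₚ.∈-++⁺ˡ q∈ , t) L.os-tight) (All.map (λ (q , q∈ , t) → q , ∈ₚ.∈-++⁺ʳ ps q∈ , t) L′.os-tight)
    ; qs-tight = Allₚ.++⁺ (All.map (λ (o , o∈ , t) → o , ∈ₚ.∈-++⁺ˡ o∈ , t) L.qs-tight) (All.map (λ (o , o∈ , t) → o , ∈ₚ.∈-++⁺ʳ ps o∈ , t) L′.qs-tight)
    ; os≤2qs = begin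
        length (L.os ++ L′.os) ≡⟨ Listₚ.length-++ L.os ⟩
        length L.os ℕ.+ length L′.os ≤⟨ ℕₚ.+-mono-≤ L.os≤2qs L′.os≤2qs ⟩
        2 ℕ.* length L.qs ℕ.+ 2 ℕ.* length L′.qs ≡⟨ ℕₚ.*-distribˡ-+ 2 (length L.qs) _ ⟨
        2 ℕ.* (length L.qs ℕ.+ length L′.qs) ≡⟨ ≡.cong (2 ℕ.*_) (Listₚ.length-++ L.qs) ⟨
        2 ℕ.* length (L.qs ++ L′.qs) ∎
    }
    where
    module L = Losses L
    module L′ = Losses L′
    open ℕₚ.≤-Reasoning

  -- Averaging over the labels of a contracted point

  module Step {m k} {w : Fin n → Vector (suc m)} (rt : Rooted w k) {u : Point m} {rest : List (Point m)} (cfg : Config w (u ∷ rest))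
    (2≤u : 2 ≤ level u) (top : All (λ p → level p ≤ level u) rest) {Q : ℕ} (ℓ²≤Q : ℓ ℕ.* ℓ ≤ Q) where

    private
      1≤Q : 1 ≤ Q
      1≤Q = ℕₚ.≤-trans (ℕₚ.*-mono-≤ 1≤ℓ 1≤ℓ) ℓ²≤Q
      valid-u = All.head (allValid cfg)
      valid-rest = All.tail (allValid cfg)
      u∦ = AllPairs.head (apart cfg)
      j = proj₁ (Valid.nonzero valid-u)
      uj≉0 = proj₂ (Valid.nonzero valid-u)

    open Through u j uj≉0 public

    family : Carrier → Fin n → Vector (suc m)
    family α = contracted w α (dir u) j uj≉0

    points : Carrier → List (Point m)
    points α = map (merged (labelsAt α)) (groups rest)

    family-rooted : ∀ {α} → α ∈ labels u → ∃ λ k′ → k ≡ suc k′ × Rooted (family α) k′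
    family-rooted α∈ = contracted-rooted w _ (dir u) j uj≉0 rt (All.lookup (Valid.avail valid-u) α∈)

    rest-∦u : All (λ p → ¬ dir p ∥ dir u) rest
    rest-∦u = All.map (λ u∦p p∥u → u∦p (∥-sym p∥u)) u∦

    points-config : ∀ α → Config (family α) (points α)
    points-config α = config (Allₚ.map⁺ (merged-valid (labelsAt α)
        (All.map (λ (v , p∦u) → proj-nonzero (dir u) j uj≉0 (Valid.nonzero v) p∦u) (All.zip (valid-rest , rest-∦u)))
        (All.map (λ {p} v → ≡.subst (1 ≤_) (≡.sym (Listₚ.length-map _ (labels p))) (Valid.nonempty v)) valid-rest)
        (All.map (λ v → Allₚ.map⁺ (All.map (Avail-contracted-⊹ w α (dir u) j uj≉0) (Valid.avail v))) valid-rest)))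
      (merged-apart (labelsAt α) rest)

    groups-valid : All (All (Valid w) ∘ elems) (groups rest)
    groups-valid = groups-All valid-rest

    points-level : ∀ {c} α → All (λ p → c ≤ level p) rest → All (λ p → c ≤ level p) (points α)
    points-level α ps = Allₚ.map⁺ (All.map (λ { {g} (c≤ ∷ _ , v ∷ _) → ℕₚ.≤-trans c≤ (head-level≤merged α g (Valid.distinct v)) }) (All.zip (groups-All ps , groups-valid)))

    total : Carrier → List Group → ℕ
    total α = sumBy (λ g → Λ Q (level (merged (labelsAt α) g)))

    -- Among the points other than u on the line through u and q, only q can have several labels.
    -- This later prevents the plane of `Crossing` from degenerating to that line.
    Isolated : Point m → Set
    Isolated q = ∃ λ g → g ∈ groups rest × head g ≡ q × All (λ p → level p ≡ 1) (map proj₁ (members g))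

    -- Either some label of u lets the group outgrow its head, which pays for the whole group since Q ≥ ℓ², or all its other points are lost.
    GroupBound : Group → Set
    GroupBound g = Σ (Losses u Isolated (elems g)) λ L →
      level u ℕ.* Ψ Q (elems g) ≤ sumBy (λ α → Λ Q (level (merged (labelsAt α) g))) (labels u) ℕ.+ level u ℕ.* length (Losses.os L)

    group-bound : ∀ {g} → g ∈ groups rest → All (Valid w) (elems g) → AllPairs _∦_ (elems g) → Maximal g → level (head g) ≤ level u → length (elems g) ≤ ℓ → GroupBound g
    group-bound {g} g∈ vs@(v ∷ _) ap mx q≤u size with dichotomy g (Valid.distinct valid-u) 2≤u (All.map (λ v → Valid.distinct v , Valid.nonempty v) vs) ap q≤u
    ... | inj₁ out = no-losses , ℕₚ.≤-trans bound (ℕₚ.m≤m+n _ _)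
      where
      open ℕₚ.≤-Reasoning
      q = head g
      bound : level u ℕ.* Ψ Q (elems g) ≤ sumBy (λ α → Λ Q (level (merged (labelsAt α) g))) (labels u)
      bound with find out
      ... | α₀ , α₀∈ , grow = begin
        -- One factor ℓ counts the labels over which the average is taken, the other the points of
        -- the group. The growth at the single label `α₀` covers both.
        level u ℕ.* Ψ Q (elems g) ≤⟨ ℕₚ.*-mono-≤ (level≤ℓ rt valid-u) (sumBy-≤ {f = Λ Q ∘ level} {Λ Q (level q)} {elems g} (ℕₚ.≤-refl ∷ Allₚ.map⁺ (All.map (Λ-mono 1≤Q) mx))) ⟩
        ℓ ℕ.* (length (elems g) ℕ.* Λ Q (level q)) ≤⟨ ℕₚ.*-monoʳ-≤ ℓ (ℕₚ.*-monoˡ-≤ (Λ Q (level q)) size) ⟩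
        ℓ ℕ.* (ℓ ℕ.* Λ Q (level q)) ≡⟨ ℕₚ.*-assoc ℓ ℓ _ ⟨
        (ℓ ℕ.* ℓ) ℕ.* Λ Q (level q) ≤⟨ ℕₚ.*-monoˡ-≤ (Λ Q (level q)) ℓ²≤Q ⟩
        Q ℕ.* Λ Q (level q) ≤⟨ Λ-step Q (level q) ⟩
        Λ Q (suc (level q)) ≤⟨ Λ-mono 1≤Q grow ⟩
        Λ Q (level (merged (labelsAt α₀) g)) ≤⟨ ∈⇒≤sumBy (λ α → Λ Q (level (merged (labelsAt α) g))) α₀∈ ⟩
        sumBy (λ α → Λ Q (level (merged (labelsAt α) g))) (labels u) ∎
    ... | inj₂ (tight , ≤2) = line-losses iso tight ≤2 , (begin
        level u ℕ.* (Λ Q (level q) ℕ.+ sumBy (Λ Q ∘ level) ms) ≡⟨ ℕₚ.*-distribˡ-+ (level u) _ _ ⟩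
        level u ℕ.* Λ Q (level q) ℕ.+ level u ℕ.* sumBy (Λ Q ∘ level) ms ≤⟨ ℕₚ.+-mono-≤
          (sumBy-≥ (All.universal (λ α → Λ-mono 1≤Q (head-level≤merged α g (Valid.distinct v))) (labels u)))
          (ℕₚ.*-monoʳ-≤ (level u) (ℕₚ.≤-trans (sumBy-mono {g = λ _ → 1} (All.map (λ t → ℕₚ.≤-reflexive (≡.cong (Λ Q) (Tight.single t))) tight)) (ℕₚ.≤-reflexive (sumBy-1 ms)))) ⟩
        sumBy (λ α → Λ Q (level (merged (labelsAt α) g))) (labels u) ℕ.+ level u ℕ.* length ms ≡⟨ ≡.cong (λ x → sumBy (λ α → Λ Q (level (merged (labelsAt α) g))) (labels u) ℕ.+ level u ℕ.* x) (length-line-losses iso tight ≤2) ⟨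
        sumBy (λ α → Λ Q (level (merged (labelsAt α) g))) (labels u) ℕ.+ level u ℕ.* length (Losses.os (line-losses {Isolated = Isolated} iso tight ≤2)) ∎)
      where
      open ℕₚ.≤-Reasoning
      q = head g
      ms = map proj₁ (members g)
      iso : Isolated q
      iso = g , g∈ , ≡.refl , All.map Tight.single tight

    collect : ∀ gs → All GroupBound gs → Σ (Losses u Isolated (concatMap elems gs)) λ L →
      level u ℕ.* sumBy (Ψ Q ∘ elems) gs ≤ sumBy (λ α → total α gs) (labels u) ℕ.+ level u ℕ.* length (Losses.os L)
    collect []       []                  = no-losses , ℕₚ.≤-trans (ℕₚ.≤-reflexive (ℕₚ.*-zeroʳ (level u))) z≤n
    collect (g ∷ gs) ((L , bound) ∷ bs) = L ⊕ L′ , (begin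
        level u ℕ.* (Ψ Q (elems g) ℕ.+ sumBy (Ψ Q ∘ elems) gs) ≡⟨ ℕₚ.*-distribˡ-+ (level u) (Ψ Q (elems g)) _ ⟩
        level u ℕ.* Ψ Q (elems g) ℕ.+ level u ℕ.* sumBy (Ψ Q ∘ elems) gs ≤⟨ ℕₚ.+-mono-≤ bound bound′ ⟩
        (A ℕ.+ level u ℕ.* a) ℕ.+ (B ℕ.+ level u ℕ.* b) ≡⟨ interchange A (level u ℕ.* a) B (level u ℕ.* b) ⟩
        (A ℕ.+ B) ℕ.+ (level u ℕ.* a ℕ.+ level u ℕ.* b) ≡⟨ ≡.cong₂ ℕ._+_ (sumBy-+ (λ α → Λ Q (level (merged (labelsAt α) g))) (λ α → total α gs) (labels u))
                                                                               (≡.trans (≡.cong (level u ℕ.*_) (Listₚ.length-++ (Losses.os L))) (ℕₚ.*-distribˡ-+ (level u) a b)) ⟨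
        sumBy (λ α → total α (g ∷ gs)) (labels u) ℕ.+ level u ℕ.* length (Losses.os (L ⊕ L′)) ∎)
      where
      open ℕₚ.≤-Reasoning
      rec = collect gs bs
      L′ = proj₁ rec
      bound′ = proj₂ rec
      a = length (Losses.os L)
      b = length (Losses.os L′)
      A = sumBy (λ α → Λ Q (level (merged (labelsAt α) g))) (labels u)
      B = sumBy (λ α → total α gs) (labels u)

    all-groups : All GroupBound (groups rest)
    all-groups = All.map (λ { {g} (g∈ , vs , ap , mx , (q≤u ∷ _) , size) → group-bound g∈ vs ap mx q≤u size })
      (All.zip (All.tabulate id , All.zip (groups-valid , All.zip (groups-AllPairs (λ {p} {q} → ∦-sym {p = p} {q}) (AllPairs.tail (apart cfg)) , All.zip (groups-maximal rest , All.zip (groups-All top ,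
        Reroot.size≤ℓ dir level (dir u) j uj≉0 (tail rt) (dir-avail valid-u) (All.map Valid.nonzero valid-rest) rest-∦u (All.map dir-avail valid-rest) (AllPairs.tail (apart cfg))))))))

    losses : Losses u Isolated (concatMap elems (groups rest))
    losses = proj₁ (collect (groups rest) all-groups)

    -- The estimates of the groups are summed over all labels of u before dividing by their number.
    -- No single α has to be good for all lines at once.
    averaging : ∀ B → (∀ {α} → α ∈ labels u → Ψ Q (points α) ≤ B) → Ψ Q rest ≤ B ℕ.+ length (Losses.os losses)
    averaging B hyp = ℕₚ.*-cancelˡ-≤ (level u) {{ℕ.>-nonZero (ℕₚ.≤-trans (s≤s z≤n) 2≤u)}} (begin
      level u ℕ.* Ψ Q rest ≡⟨ ≡.cong (level u ℕ.*_) (sumBy-groups (Λ Q ∘ level) rest) ⟨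
      level u ℕ.* sumBy (Ψ Q ∘ elems) (groups rest) ≤⟨ proj₂ (collect (groups rest) all-groups) ⟩
      sumBy (λ α → total α (groups rest)) (labels u) ℕ.+ level u ℕ.* length (Losses.os losses)
        ≤⟨ ℕₚ.+-monoˡ-≤ (level u ℕ.* length (Losses.os losses)) (sumBy-≤ {f = λ α → total α (groups rest)} {B} {labels u} (All.tabulate total≤B)) ⟩
      level u ℕ.* B ℕ.+ level u ℕ.* length (Losses.os losses) ≡⟨ ℕₚ.*-distribˡ-+ (level u) B (length (Losses.os losses)) ⟨
      level u ℕ.* (B ℕ.+ length (Losses.os losses)) ∎)
      where
      open ℕₚ.≤-Reasoning
      total≤B : ∀ {α} → α ∈ labels u → total α (groups rest) ≤ B
      total≤B {α} α∈ = ≡.subst (_≤ B) (sumBy-map (Λ Q ∘ level) (merged (labelsAt α)) (groups rest)) (hyp α∈)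

  losses-level1 : ∀ {m} {u : Point m} {Iso ps} (L : Losses u Iso ps) → All (λ p → 2 ≤ level p) ps → length (Losses.os L) ≡ 0
  losses-level1 {Iso = Iso} L 2≤ = go (Sublistₚ.All-resp-⊆ os⊆ 2≤) os-tight
    where
    open Losses L
    go : ∀ {os} → All (λ p → 2 ≤ level p) os → All (λ o → ∃ λ q → q ∈ _ × Tight _ o q × Iso q) os → length os ≡ 0
    go [] [] = ≡.refl
    go (2≤ ∷ _) ((_ , _ , t , _) ∷ _) = ⊥-elim (ℕₚ.<-irrefl ≡.refl (≡.subst (2 ≤_) (Tight.single t) 2≤))

  some-label : ∀ {m} (p : Point m) → 1 ≤ level p → ∃ λ a → a ∈ labels p
  some-label p = go (labels p)
    where
    go : ∀ L → 1 ≤ length L → ∃ λ a → a ∈ L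
    go (a ∷ _) _ = a , here ≡.refl

  -- If every point has two labels, contracting a point of maximal level loses no more than its own weight on average.
  heavy-Ψ : ∀ {m} k {w : Fin n → Vector (suc m)} → Rooted w k → ∀ {Q} → ℓ ℕ.* ℓ ≤ Q → ∀ ps → Config w ps → All (λ p → 2 ≤ level p) ps → Ψ Q ps ≤ Λ Q ℓ ℕ.* k
  heavy-Ψ k rt ℓ²≤Q [] cfg _ = z≤n
  heavy-Ψ {m} k {w} rt {Q} ℓ²≤Q (p ∷ ps) cfg 2≤ps = bound k rt
    where
    1≤Q = ℕₚ.≤-trans (ℕₚ.*-mono-≤ 1≤ℓ 1≤ℓ) ℓ²≤Q
    max = argmax level p ps
    u = proj₁ max
    picked = pick (proj₁ (proj₂ max))
    rest = proj₁ picked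
    σ = proj₂ picked
    cfg′ = Config-↭ σ cfg
    2≤ = Permₚ.All-resp-↭ σ 2≤ps
    top = All.tail (Permₚ.All-resp-↭ σ (proj₂ (proj₂ max)))
    u-level≤ℓ : ∀ {k} → Rooted w k → level u ≤ ℓ
    u-level≤ℓ rt = level≤ℓ rt (All.head (allValid cfg′))

    bound : ∀ k → Rooted w k → Ψ Q (p ∷ ps) ≤ Λ Q ℓ ℕ.* k
    bound zero rt = ⊥-elim (impossible (family-rooted (proj₂ (some-label u (Valid.nonempty (All.head (allValid cfg′)))))))
      where
      open Step rt cfg′ (All.head 2≤) top ℓ²≤Q
      impossible : ∀ {A : ℕ → Set} → ¬ (∃ λ k′ → 0 ≡ suc k′ × A k′)
      impossible (_ , () , _)
    bound (suc k) rt = begin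
      Ψ Q (p ∷ ps) ≡⟨ sumBy-↭ (Λ Q ∘ level) σ ⟩
      Λ Q (level u) ℕ.+ Ψ Q rest ≤⟨ ℕₚ.+-mono-≤ (Λ-mono 1≤Q (u-level≤ℓ rt)) (averaging (Λ Q ℓ ℕ.* k) hyp) ⟩
      Λ Q ℓ ℕ.+ (Λ Q ℓ ℕ.* k ℕ.+ length (Losses.os losses)) ≡⟨ ≡.cong (λ x → Λ Q ℓ ℕ.+ (Λ Q ℓ ℕ.* k ℕ.+ x)) (losses-level1 losses (Permₚ.All-resp-↭ (↭-sym (groups-elems rest)) (All.tail 2≤))) ⟩
      Λ Q ℓ ℕ.+ (Λ Q ℓ ℕ.* k ℕ.+ 0) ≡⟨ ≡.cong (Λ Q ℓ ℕ.+_) (ℕₚ.+-identityʳ _) ⟩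
      Λ Q ℓ ℕ.+ Λ Q ℓ ℕ.* k ≡⟨ ℕₚ.*-suc (Λ Q ℓ) k ⟨
      Λ Q ℓ ℕ.* suc k ∎
      where
      open ℕₚ.≤-Reasoning
      open Step rt cfg′ (All.head 2≤) top ℓ²≤Q
      hyp : ∀ {α} → α ∈ labels u → Ψ Q (points α) ≤ Λ Q ℓ ℕ.* k
      hyp {α} α∈ = go (family-rooted α∈)
        where
        go : (∃ λ k′ → suc k ≡ suc k′ × Rooted (family α) k′) → Ψ Q (points α) ≤ Λ Q ℓ ℕ.* k
        go (_ , ≡.refl , rt′) = heavy-Ψ k rt′ ℓ²≤Q (points α) (points-config α) (points-level α (All.tail 2≤))

  -- Heavy points and the losses of a projection

  Heavy : ∀ {m} → Point m → Set
  Heavy p = 2 ≤ level p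

  heavy? : ∀ {m} (p : Point m) → Dec (Heavy p)
  heavy? p = 2 ℕ.≤? level p

  Config-filter : ∀ {m} {w : Fin n → Vector (suc m)} {P : Point m → Set} (P? : ∀ p → Dec (P p)) {ps} → Config w ps → Config w (filter P? ps)
  Config-filter P? (config v a) = config (Allₚ.filter⁺ P? v) (AllPairs-filter P? a)

  -- In base ℓ², the smallest base that `heavy-Ψ` admits, every heavy point still weighs at least 1.
  -- The resulting constant does not involve `Q`, which is defined through it.
  heavy-count : ∀ {m k} {w : Fin n → Vector (suc m)} → Rooted w k → ∀ {ps} → Config w ps → length (filter heavy? ps) ≤ C ℕ.* k
  heavy-count {k = k} rt {ps} cfg = begin
    length (filter heavy? ps) ≡⟨ ℕₚ.*-identityʳ _ ⟨
    length (filter heavy? ps) ℕ.* 1 ≤⟨ sumBy-≥ (All.map (λ 2≤ → 1≤Λ (ℕₚ.*-mono-≤ 1≤ℓ 1≤ℓ) (ℕₚ.≤-trans (s≤s z≤n) 2≤)) (Allₚ.all-filter heavy? ps)) ⟩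
    Ψ (ℓ ℕ.* ℓ) (filter heavy? ps) ≤⟨ heavy-Ψ k rt ℕₚ.≤-refl (filter heavy? ps) (Config-filter heavy? cfg) (Allₚ.all-filter heavy? ps) ⟩
    C ℕ.* k ∎
    where open ℕₚ.≤-Reasoning

  module _ {A : Set} {m} (vec : A → Vector m) {v : Fin n → Vector m} where

    record Spread (xs : List A) : Set where
      constructor spread
      field
        nonzeros : All (λ x → Nonzero (vec x)) xs
        avails   : All (λ x → Avail v (vec x)) xs
        separate : AllPairs (λ x y → ¬ vec x ∥ vec y) xs

    module _ {k} (K : Contraction v k) (z : Vector m) (j : Fin m) (zj≉0 : z j ≉ 0#) (az : Avail v z) {xs : List A} (sp : Spread xs) where
      open Spread sp
      open Merging (λ x → proj z j zj≉0 (vec x)) (λ _ → 0)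
      open Reroot vec (λ _ → 0) {v} z j zj≉0

      ∥z? : ∀ x → Dec (vec x ∥ z)
      ∥z? x = vec x ∥? z

      private
        transversal : List A
        transversal = filter (¬? ∘ ∥z?) xs

        gs = groups transversal
        ∦z = Allₚ.all-filter (¬? ∘ ∥z?) xs
        nz = Allₚ.filter⁺ (¬? ∘ ∥z?) nonzeros
        av = Allₚ.filter⁺ (¬? ∘ ∥z?) avails
        ap = AllPairs-filter (¬? ∘ ∥z?) separate
        rooted = reroot-rooted K z j zj≉0 az
        cfg : Config (reroot z j zj≉0 ∘ v) (map (merged lab) gs)
        cfg = config (Allₚ.map⁺ (reroot-valid nz ∦z av)) (merged-apart lab transversal)

        size : Group → ℕ
        size g = sumBy (λ _ → 1) (elems g)

        length≤ : length xs ≤ suc (sumBy size gs)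
        length≤ = begin
          length xs ≡⟨ length-filter-split ∥z? xs ⟩
          length (filter ∥z? xs) ℕ.+ length transversal ≤⟨ ℕₚ.+-monoˡ-≤ (length transversal) (pigeonhole {R = λ x (_ : ℕ) → vec x ∥ z} {ys = 0 ∷ []}
                                                            (AllPairs.map (λ x∦y _ p q → x∦y (∥-trans p (∥-sym q))) (AllPairs-filter ∥z? separate)) (All.map here (Allₚ.all-filter ∥z? xs))) ⟩
          suc (length transversal) ≡⟨ ≡.cong suc (≡.trans (sumBy-groups (λ _ → 1) transversal) (sumBy-1 transversal)) ⟨
          suc (sumBy size gs) ∎
          where open ℕₚ.≤-Reasoning

        size≤level′ : All (λ g → size g ≤ level (merged lab g)) gs
        size≤level′ = All.map (λ {g} p → ℕₚ.≤-trans (ℕₚ.≤-reflexive (sumBy-1 (elems g))) (size≤level g p)) (groups-AllPairs (λ x∦y y∥x → x∦y (∥-sym y∥x)) ap)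

      projected : List A
      projected = map head gs

      projected⊆ : All (_∈ xs) projected
      projected⊆ = Allₚ.map⁺ (All.map All.head (groups-All (Allₚ.filter⁺ (¬? ∘ ∥z?) (All.tabulate id))))

      projected-nonzero : All (λ x → Nonzero (proj z j zj≉0 (vec x))) projected
      projected-nonzero = Allₚ.map⁺ (All.map All.head (groups-All (All.map (λ (p , q) → proj-nonzero z j zj≉0 p q) (All.zip (nz , ∦z)))))

      projected-separate : AllPairs (λ x y → ¬ proj z j zj≉0 (vec x) ∥ proj z j zj≉0 (vec y)) projected
      projected-separate = AllPairsₚ.map⁺ (groups-apart transversal)

      -- At most one vector is parallel to z, and each line through z carries at most ℓ others. This
      -- bound is meant for lists so short that a loss linear in k could exhaust them.
      projected-*-bound : length xs ≤ suc (ℓ ℕ.* length projected)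
      projected-*-bound = ℕₚ.≤-trans length≤ (s≤s (ℕₚ.≤-trans (sumBy-≤ {f = size} {ℓ} {gs} (All.map (λ {g} (p , q) → ℕₚ.≤-trans p (level≤ℓ (proj₂ (proj₂ rooted)) q)) (All.zip (size≤level′ , Allₚ.map⁻ (allValid cfg)))))
        (ℕₚ.≤-reflexive (≡.trans (ℕₚ.*-comm (length gs) ℓ) (≡.cong (ℓ ℕ.*_) (≡.sym (Listₚ.length-map head gs)))))))

      -- A line through z that carries a single vector loses nothing. The other lines become heavy
      -- points once z is the root, so there are at most C k of them, each with at most ℓ vectors.
      -- The loss does not depend on the length of the list.
      projected-+-bound : length xs ≤ length projected ℕ.+ suc (ℓ ℕ.* (C ℕ.* k))
      projected-+-bound = begin
        length xs ≤⟨ length≤ ⟩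
        suc (sumBy size gs) ≤⟨ s≤s (sumBy-mono (All.map (λ {g} (p , q) → size≤ g p (level≤ℓ (proj₂ (proj₂ rooted)) q) (heavy? (merged lab g))) (All.zip (size≤level′ , Allₚ.map⁻ (allValid cfg))))) ⟩
        suc (sumBy (λ g → 1 ℕ.+ ℓ ℕ.* indicator (heavy? (merged lab g))) gs) ≡⟨ ≡.cong suc (sumBy-+ (λ _ → 1) (λ g → ℓ ℕ.* indicator (heavy? (merged lab g))) gs) ⟩
        suc (sumBy (λ _ → 1) gs ℕ.+ sumBy (λ g → ℓ ℕ.* indicator (heavy? (merged lab g))) gs)
          ≡⟨ ≡.cong₂ (λ a b → suc (a ℕ.+ b)) (≡.trans (sumBy-1 gs) (≡.sym (Listₚ.length-map head gs))) (sumBy-* ℓ (λ g → indicator (heavy? (merged lab g))) gs) ⟩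
        suc (length projected ℕ.+ ℓ ℕ.* sumBy (λ g → indicator (heavy? (merged lab g))) gs)
          ≡⟨ ≡.cong (λ a → suc (length projected ℕ.+ ℓ ℕ.* a)) (≡.trans (length-filter-sumBy heavy? (map (merged lab) gs)) (sumBy-map (indicator ∘ heavy?) (merged lab) gs)) ⟨
        suc (length projected ℕ.+ ℓ ℕ.* length (filter heavy? (map (merged lab) gs)))
          ≤⟨ s≤s (ℕₚ.+-monoʳ-≤ (length projected) (ℕₚ.*-monoʳ-≤ ℓ (ℕₚ.≤-trans (heavy-count (proj₂ (proj₂ rooted)) cfg) (ℕₚ.*-monoʳ-≤ C (ℕₚ.≤-trans (ℕₚ.n≤1+n _) (ℕₚ.≤-reflexive (≡.sym (proj₁ (proj₂ rooted))))))))) ⟩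
        suc (length projected ℕ.+ ℓ ℕ.* (C ℕ.* k)) ≡⟨ ℕₚ.+-suc (length projected) _ ⟨
        length projected ℕ.+ suc (ℓ ℕ.* (C ℕ.* k)) ∎
        where
        open ℕₚ.≤-Reasoning
        size≤ : ∀ g → size g ≤ level (merged lab g) → level (merged lab g) ≤ ℓ → (d : Dec (Heavy (merged lab g))) → size g ≤ 1 ℕ.+ ℓ ℕ.* indicator d
        size≤ g s≤ l≤ (yes _) = ℕₚ.≤-trans s≤ (ℕₚ.≤-trans l≤ (ℕₚ.≤-trans (ℕₚ.≤-reflexive (≡.sym (ℕₚ.*-identityʳ ℓ))) (ℕₚ.n≤1+n _)))
        size≤ g s≤ l≤ (no ¬h) = ℕₚ.≤-trans s≤ (ℕₚ.≤-trans (ℕₚ.≤-pred (ℕₚ.≰⇒> ¬h)) (ℕₚ.m≤m+n 1 _))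

  -- The first vector becomes the root, the other ones become labels.
  uproot : ∀ {m k} {v : Fin n → Vector m} → Contraction v k → ∀ z zs → Spread id {v} (z ∷ zs) →
    ∃ λ k′ → k ≡ suc k′ × ∃ λ (w : Fin n → Vector (suc m)) → Rooted w k′ × ∃ λ ps → Config w ps × length zs ≤ sumBy level ps
  uproot {v = v} K z zs (spread ((j , zj≉0) ∷ nz) (az ∷ av) (z∦ ∷ ap)) =
    proj₁ rooted , proj₁ (proj₂ rooted) , reroot z j zj≉0 ∘ v , proj₂ (proj₂ rooted) , map (merged lab) (groups zs) ,
    config (Allₚ.map⁺ (reroot-valid nz (All.map (λ z∦y y∥z → z∦y (∥-sym y∥z)) z∦) av)) (merged-apart lab zs) , bound
    where
    open ℕₚ.≤-Reasoning
    open Merging (λ x → proj z j zj≉0 x) (λ _ → 0)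
    open Reroot id (λ _ → 0) {v} z j zj≉0
    rooted = reroot-rooted K z j zj≉0 az
    bound : length zs ≤ sumBy level (map (merged lab) (groups zs))
    bound = begin
      length zs ≡⟨ sumBy-1 zs ⟨
      sumBy (λ _ → 1) zs ≡⟨ sumBy-groups (λ _ → 1) zs ⟨
      sumBy (sumBy (λ _ → 1) ∘ elems) (groups zs) ≤⟨ sumBy-mono (All.map (λ {g} p → ℕₚ.≤-trans (ℕₚ.≤-reflexive (sumBy-1 (elems g))) (size≤level g p)) (groups-AllPairs (λ x∦y y∥x → x∦y (∥-sym y∥x)) ap)) ⟩
      sumBy (level ∘ merged lab) (groups zs) ≡⟨ sumBy-map level (merged lab) (groups zs) ⟨
      sumBy level (map (merged lab) (groups zs)) ∎

  -- Iterated contractions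

  Linear : ∀ {a b} → (Vector a → Vector b) → Set
  Linear P = ∀ {v x y} s t → (∀ i → v i ≈ s * x i + t * y i) → ∀ i → P v i ≈ s * P x i + t * P y i

  proj-linear : ∀ {m} (z : Vector m) j zj≉0 → Linear (proj z j zj≉0)
  proj-linear z j zj≉0 {v} {x} {y} s t e i = trans (+-cong (e i) (-‿cong (*-congʳ (*-congʳ (e j)))))
    (solve 8 (λ s xi t yi xj yj c zi → (s :* xi :+ t :* yi) :- ((s :* xj :+ t :* yj) :* c) :* zi := s :* (xi :- (xj :* c) :* zi) :+ t :* (yi :- (yj :* c) :* zi)) refl s (x i) t (y i) (x j) (y j) _ (z i))

  module _ {a b} {P : Vector a → Vector b} (lin : Linear P) where
    linear-scale : ∀ {v x} s → (∀ i → v i ≈ s * x i) → ∀ i → P v i ≈ s * P x i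
    linear-scale {v} {x} s e i = trans (lin {v} {x} {x} s 0# (λ i → trans (e i) (sym (trans (+-congˡ (zeroˡ _)) (+-identityʳ _)))) i) (trans (+-congˡ (zeroˡ _)) (+-identityʳ _))

  -- A contraction of the rooted family w by part of its points; P acts on lifted vectors, π on directions.
  record Stage {m} (w : Fin n → Vector (suc m)) : Set where
    field
      family  : Fin n → Vector (suc m)
      rank    : ℕ
      rooted  : Rooted family rank
      P       : Vector (suc m) → Vector (suc m)
      π       : Vector m → Vector m
      P-linear : Linear P
      P-avail : ∀ {v} → Avail w v → Avail family (P v)
      P-dir   : ∀ a v i → P (a ⊹ v) (suc i) ≈ π v i
      P-label : ∀ a b v → P (a ⊹ v) zero ≈ P (b ⊹ v) zero + (a - b)

    π-avail : ∀ {a v} → Avail w (a ⊹ v) → Avail (λ x → family x ∘ suc) (π v)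
    π-avail {a} {v} av = Avail-resp (λ i → sym (P-dir a v i)) (Avail-tail (P-avail av))

  stage₀ : ∀ {m k} {w : Fin n → Vector (suc m)} → Rooted w k → Stage w
  stage₀ {k = k} {w} rt = record
    { family = w ; rank = k ; rooted = rt ; P = id ; π = id
    ; P-linear = λ s t e → e ; P-avail = id ; P-dir = λ _ _ _ → refl
    ; P-label = λ a b v → solve 2 (λ a b → a := b :+ (a :- b)) refl a b }

  -- Separate points stay numerous at a stage, up to the additive loss a and the distortion μ.
  Reach : ∀ {m} {w : Fin n → Vector (suc m)} → Stage w → ℕ → (ℕ → ℕ) → Set
  Reach {m} {w} S a μ = ∀ {xs : List (Point m)} → All (Valid w) xs → AllPairs _∦_ xs → ∃ λ ys → All (_∈ xs) ys ×
    Spread (λ p → Stage.π S (dir p)) {λ x → Stage.family S x ∘ suc} ys × length xs ≤ length ys ℕ.+ a × length xs ≤ μ (length ys)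

  reach₀ : ∀ {m k} {w : Fin n → Vector (suc m)} (rt : Rooted w k) → Reach (stage₀ rt) 0 id
  reach₀ rt {xs} vs ap = xs , All.tabulate id , spread (All.map Valid.nonzero vs) (All.map dir-avail vs) ap , ℕₚ.≤-reflexive (≡.sym (ℕₚ.+-identityʳ _)) , ℕₚ.≤-refl

  -- These are the consequences of contracting z that later arguments need, so that three
  -- contractions can be chained without unfolding coordinates. In particular, `collapse` turns
  -- parallelism after the contraction into a relation with z before it.
  record Advanced {m} {w : Fin n → Vector (suc m)} (S : Stage w) (z : Vector (suc m)) : Set where
    field
      stage       : Stage w
      rank≡       : Stage.rank S ≡ suc (Stage.rank stage)
      kills       : ∀ i → Stage.P stage z i ≈ 0#
      preserves-0 : ∀ {v} → (∀ i → Stage.P S v i ≈ 0#) → ∀ i → Stage.P stage v i ≈ 0#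
      nonzero     : ∀ {v} → Nonzero (Stage.π S v) → ¬ Stage.π S v ∥ (Stage.P S z ∘ suc) → Nonzero (Stage.π stage v)
      collapse    : ∀ {v v′} → Stage.π stage v ∥ Stage.π stage v′ → ∃ λ a → ∃ λ b → b ≉ 0# × (∀ i → Stage.π S v i ≈ a * (Stage.P S z ∘ suc) i + b * Stage.π S v′ i)
      reach       : ∀ {a μ} → (∀ {s t} → s ≤ t → μ s ≤ μ t) → Reach S a μ → Reach stage (suc (ℓ ℕ.* (C ℕ.* Stage.rank S)) ℕ.+ a) (λ t → μ (suc (ℓ ℕ.* t)))

  module Advance {m} {w : Fin n → Vector (suc m)} (S : Stage w) {z : Vector (suc m)} (Pz-avail : Avail (Stage.family S) (Stage.P S z))
    (j : Fin m) (nz : Stage.P S z (suc j) ≉ 0#) where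
    open Stage S

    private
      α = P z zero
      u = P z ∘ suc
      z-avail : Avail family (α ⊹ u)
      z-avail = Avail-resp (λ { zero → refl ; (suc i) → refl }) Pz-avail
      contraction = contracted-rooted family α u j nz rooted z-avail

      P′ : Vector (suc m) → Vector (suc m)
      P′ v = proj (α ⊹ u) (suc j) nz (P v)

    rank≡ : rank ≡ suc (proj₁ contraction)
    rank≡ = proj₁ (proj₂ contraction)

    stage : Stage w
    stage = record
      { family = contracted family α u j nz ; rank = proj₁ contraction ; rooted = proj₂ (proj₂ contraction)
      ; P = P′ ; π = λ v → proj u j nz (π v)
      ; P-linear = λ {v} {x} {y} s t e → proj-linear (α ⊹ u) (suc j) nz {P v} {P x} {P y} s t (P-linear {v} {x} {y} s t e)
      ; P-avail = λ av → Avail-contracted family α u j nz (P-avail av)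
      ; P-dir = λ a v i → +-cong (P-dir a v i) (-‿cong (*-congʳ (*-congʳ (P-dir a v j))))
      ; P-label = λ a b v → trans (+-cong (P-label a b v) (-‿cong (*-congʳ (*-congʳ (trans (P-dir a v j) (sym (P-dir b v j)))))))
          (solve 3 (λ x d y → (x :+ d) :- y := (x :- y) :+ d) refl _ _ _) }

    kills : ∀ i → Stage.P stage z i ≈ 0#
    kills i = trans (+-congʳ (P≈ i)) (trans (+-congˡ (-‿cong (trans (*-congʳ (*-inv _ nz)) (*-identityˡ _)))) (-‿inverseʳ _))
      where
      P≈ : ∀ i → P z i ≈ (α ⊹ u) i
      P≈ zero    = refl
      P≈ (suc i) = refl

    preserves-0 : ∀ {v} → (∀ i → P v i ≈ 0#) → ∀ i → Stage.P stage v i ≈ 0#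
    preserves-0 {v} e i = trans (linear-scale (proj-linear (α ⊹ u) (suc j) nz) {P v} {P v} 0# (λ i → trans (e i) (sym (zeroˡ _))) i) (zeroˡ _)

    module _ {xs : List (Point m)} (valids : All (Valid w) xs) (sp : Spread (π ∘ dir) {λ x → family x ∘ suc} xs) where
      survivors : List (Point m)
      survivors = projected (π ∘ dir) (tail rooted) u j nz (Avail-tail z-avail) sp

      survivors⊆ : All (_∈ xs) survivors
      survivors⊆ = projected⊆ (π ∘ dir) (tail rooted) u j nz (Avail-tail z-avail) sp

      survivors-spread : Spread (Stage.π stage ∘ dir) {λ x → Stage.family stage x ∘ suc} survivors
      survivors-spread = spread (projected-nonzero (π ∘ dir) (tail rooted) u j nz (Avail-tail z-avail) sp)
        (All.map (λ p∈ → avail-dir (All.lookup valids p∈)) survivors⊆)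
        (projected-separate (π ∘ dir) (tail rooted) u j nz (Avail-tail z-avail) sp)
        where
        avail-dir : ∀ {p} → Valid w p → Avail (λ x → Stage.family stage x ∘ suc) (Stage.π stage (dir p))
        avail-dir {p} v = let (a , a∈) = some-label p (Valid.nonempty v) in Stage.π-avail stage (All.lookup (Valid.avail v) a∈)

      survivors-valid : All (Valid w) survivors
      survivors-valid = All.map (λ p∈ → All.lookup valids p∈) survivors⊆

      survivors-* : length xs ≤ suc (ℓ ℕ.* length survivors)
      survivors-* = projected-*-bound (π ∘ dir) (tail rooted) u j nz (Avail-tail z-avail) sp

      survivors-+ : length xs ≤ length survivors ℕ.+ suc (ℓ ℕ.* (C ℕ.* rank))
      survivors-+ = projected-+-bound (π ∘ dir) (tail rooted) u j nz (Avail-tail z-avail) sp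

    advanced : Advanced S z
    advanced = record
      { stage = stage ; rank≡ = rank≡ ; kills = kills ; preserves-0 = preserves-0
      ; nonzero = λ nz′ ∦ → proj-nonzero u j nz nz′ ∦
      ; collapse = λ {v} {v′} p → _ , proj₁ p , proj₁ (proj₂ p) , proj-∥ u j nz {π v} {π v′} p
      ; reach = reach }
      where
      reach : ∀ {a μ} → (∀ {s t} → s ≤ t → μ s ≤ μ t) → Reach S a μ → Reach stage (suc (ℓ ℕ.* (C ℕ.* rank)) ℕ.+ a) (λ t → μ (suc (ℓ ℕ.* t)))
      reach {a} {μ} mono ρ {xs} vs ap = survivors vs′ sp , All.map (λ p∈ → All.lookup ys∈ p∈) (survivors⊆ vs′ sp) , survivors-spread vs′ sp ,
        (begin
          length xs ≤⟨ proj₁ (proj₂ (proj₂ (proj₂ (ρ vs ap)))) ⟩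
          length ys ℕ.+ a ≤⟨ ℕₚ.+-monoˡ-≤ a (survivors-+ vs′ sp) ⟩
          length (survivors vs′ sp) ℕ.+ suc (ℓ ℕ.* (C ℕ.* rank)) ℕ.+ a ≡⟨ ℕₚ.+-assoc (length (survivors vs′ sp)) _ a ⟩
          length (survivors vs′ sp) ℕ.+ (suc (ℓ ℕ.* (C ℕ.* rank)) ℕ.+ a) ∎) ,
        ℕₚ.≤-trans (proj₂ (proj₂ (proj₂ (proj₂ (ρ vs ap))))) (mono (survivors-* vs′ sp))
        where
        open ℕₚ.≤-Reasoning
        ys = proj₁ (ρ vs ap)
        ys∈ = proj₁ (proj₂ (ρ vs ap))
        sp = proj₁ (proj₂ (proj₂ (ρ vs ap)))
        vs′ : All (Valid w) ys
        vs′ = All.map (λ p∈ → All.lookup vs p∈) ys∈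

  -- The simplification of the points ps in the contraction at a stage.
  module Image {m} {w : Fin n → Vector (suc m)} (S : Stage w) {ps : List (Point m)} (cfg : Config w ps) where
    open Stage S

    open Merging (λ (p : Point m) → π (dir p)) (λ _ → 0) public

    nonzeroπ? : ∀ (p : Point m) → Dec (Nonzero (π (dir p)))
    nonzeroπ? p = nonzero? (π (dir p))

    items : List (Point m)
    items = filter nonzeroπ? ps

    lab : Point m → List Carrier
    lab p = map (λ a → P (a ⊹ dir p) zero) (labels p)

    image-points : List (Point m)
    image-points = map (merged lab) (groups items)

    image-config : Config family image-points
    image-config = config (Allₚ.map⁺ (merged-valid lab (Allₚ.all-filter nonzeroπ? ps)
        (All.map (λ {p} v → ≡.subst (1 ≤_) (≡.sym (Listₚ.length-map _ (labels p))) (Valid.nonempty v)) valids)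
        (All.map (λ v → Allₚ.map⁺ (All.map lift-avail (Valid.avail v))) valids)))
      (merged-apart lab items)
      where
      valids = Allₚ.filter⁺ nonzeroπ? (allValid cfg)
      lift-avail : ∀ {a v} → Avail w (a ⊹ v) → Avail family (P (a ⊹ v) zero ⊹ π v)
      lift-avail {a} {v} av = Avail-resp (λ { zero → refl ; (suc i) → sym (P-dir a v i) }) (P-avail av)

    image-group : ∀ {p} → p ∈ ps → Nonzero (π (dir p)) → ∃ λ g → g ∈ groups items × p ∈ elems g
    image-group p∈ nz = find (∈-groups (∈ₚ.∈-filter⁺ nonzeroπ? p∈ nz))

    same-group : ∀ {g g′} → g ∈ groups items → g′ ∈ groups items → ∀ {p q} → p ∈ elems g → q ∈ elems g′ → π (dir p) ∥ π (dir q) → g ≡ g′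
    same-group g∈ g′∈ {p} {q} p∈ q∈ p∥q = apart⇒≡ ∥-sym (groups-apart items) g∈ g′∈
      (∥-trans (∥-sym (All.lookup (elem~head _) p∈)) (∥-trans p∥q (All.lookup (elem~head _) q∈)))

    spread-groups : ∀ {xs : List (Point m)} {G : Group → Set} (G? : ∀ g → Dec (G g)) → Spread (π ∘ dir) {λ x → family x ∘ suc} xs → All (_∈ ps) xs →
      (∀ {p g} → p ∈ xs → g ∈ groups items → p ∈ elems g → G g) → length xs ≤ length (filter G? (groups items))
    spread-groups {xs} {G} G? (spread nz _ ap) xs⊆ good = pigeonhole {R = λ p g → p ∈ elems g}
      (AllPairs.map (λ x∦y g x∈ y∈ → x∦y (∥-trans (All.lookup (elem~head g) x∈) (∥-sym (All.lookup (elem~head g) y∈)))) ap)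
      (All.tabulate λ {p} p∈ → let (g , g∈ , p∈g) = image-group (All.lookup xs⊆ p∈) (All.lookup nz p∈) in lose (∈ₚ.∈-filter⁺ G? g∈ (good p∈ g∈ p∈g)) p∈g)

    -- If q acquires the label b₀ through o, then its image has more labels than q.
    boosted : ∀ {q o} → q ∈ ps → o ∈ ps → Distinct (labels q) → ∀ {b₀ γ y} → y ≉ 0# → γ ∈ labels o → ¬ b₀ ∈ₗ labels q →
      (∀ i → P (γ ⊹ dir o) i ≈ y * P (b₀ ⊹ dir q) i) → ∀ {g} → g ∈ groups items → q ∈ elems g → suc (level q) ≤ level (merged lab g)
    boosted {q} {o} q∈ o∈ dq {b₀} {γ} {y} y≉0 γ∈ b₀∉ o≈ {g} g∈ q∈g = grow (elem⊆rawLabels lab g q∈g)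
      where
      πo≈ : ∀ i → π (dir o) i ≈ y * π (dir q) i
      πo≈ i = trans (sym (P-dir γ (dir o) i)) (trans (o≈ (suc i)) (*-congˡ (P-dir b₀ (dir q) i)))
      o∥q : π (dir o) ∥ π (dir q)
      o∥q = y , y≉0 , πo≈
      q-nz : Nonzero (π (dir q))
      q-nz = proj₂ (∈ₚ.∈-filter⁻ nonzeroπ? {xs = ps} (All.lookup (groups-all-∈ g∈) q∈g))
        where
        groups-all-∈ : ∀ {g} → g ∈ groups items → All (_∈ items) (elems g)
        groups-all-∈ g∈ = All.lookup (groups-All (All.tabulate id)) g∈
      o∈g : o ∈ elems g
      o∈g = let (g′ , g′∈ , o∈g′) = image-group o∈ (∥-nonzero o∥q q-nz) in ≡.subst (λ g → o ∈ elems g) (same-group g′∈ g∈ o∈g′ q∈g o∥q) o∈g′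
      head-nz : Nonzero (π (dir (head g)))
      head-nz = ∥-nonzero (∥-sym (All.lookup (elem~head g) q∈g)) q-nz
      f : Carrier → Carrier
      f b = P (b ⊹ dir q) zero
      f-injective : ∀ {a b} → a ≉ b → f a ≉ f b
      -- By `P-label` the stage merely translates the labels over a fixed direction.
      f-injective {a} {b} a≉b e = a≉b (x∙y⁻¹≈ε⇒x≈y a b (trans (solve 2 (λ x d → d := (x :+ d) :- x) refl (f b) (a - b)) (trans (+-congʳ (trans (sym (P-label a b (dir q))) e)) (-‿inverseʳ _))))
      grow : (∃ λ y → Σ (y ≉ 0#) λ y≉0 → (∀ i → π (dir q) i ≈ y * π (dir (head g)) i) × (∀ {a b} → a ∈ₗ lab q → b ≈ a * inv y y≉0 → b ∈ₗ rawLabels lab g)) →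
        suc (level q) ≤ level (merged lab g)
      grow (y₁ , y₁≉0 , e₁ , raw) = ≡.subst (λ l → suc l ≤ level (merged lab g)) (Listₚ.length-map f′ (labels q))
        (level-merged lab g {map f′ (b₀ ∷ labels q)} (AllPairsₚ.map⁺ (AllPairs.map f′-injective (Allₚ.¬Any⇒All¬ _ b₀∉ ∷ dq)))
          (new (elem⊆rawLabels lab g o∈g) ∷ Allₚ.map⁺ (All.tabulate λ b∈ → raw (Anyₚ.map⁺ (lose b∈ refl)) refl)))
        where
        f′ : Carrier → Carrier
        f′ b = f b * inv y₁ y₁≉0
        f′-injective : ∀ {a b} → a ≉ b → f′ a ≉ f′ b
        f′-injective a≉b e = f-injective a≉b (*-cancelˡ (inv-≉0 y₁ y₁≉0) (trans (*-comm _ _) (trans e (*-comm _ _))))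
        new : (∃ λ y → Σ (y ≉ 0#) λ y≉0 → (∀ i → π (dir o) i ≈ y * π (dir (head g)) i) × (∀ {a b} → a ∈ₗ lab o → b ≈ a * inv y y≉0 → b ∈ₗ rawLabels lab g)) → f′ b₀ ∈ₗ rawLabels lab g
        -- Relative to the head, o has the factor y₂ = y y₁ and q the factor y₁. The image of γ over
        -- o is y times that of b₀ over q, so after division both give the same label of the head.
        new (y₂ , y₂≉0 , e₂ , raw₂) = raw₂ (Anyₚ.map⁺ (lose γ∈ refl)) (begin
          f b₀ * inv y₁ y₁≉0 ≈⟨ *-identityʳ _ ⟨
          (f b₀ * inv y₁ y₁≉0) * 1# ≈⟨ *-congˡ (*-inv y₂ y₂≉0) ⟨
          (f b₀ * inv y₁ y₁≉0) * (y₂ * inv y₂ y₂≉0) ≈⟨ *-congˡ (*-congʳ y₂≈) ⟩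
          (f b₀ * inv y₁ y₁≉0) * ((y * y₁) * inv y₂ y₂≉0) ≈⟨ solve 5 (λ f i y y₁ i₂ → (f :* i) :* ((y :* y₁) :* i₂) := ((y :* f) :* i₂) :* (y₁ :* i)) refl _ _ _ _ _ ⟩
          ((y * f b₀) * inv y₂ y₂≉0) * (y₁ * inv y₁ y₁≉0) ≈⟨ trans (*-congˡ (*-inv y₁ y₁≉0)) (*-identityʳ _) ⟩
          (y * f b₀) * inv y₂ y₂≉0 ≈⟨ *-congʳ (o≈ zero) ⟨
          P (γ ⊹ dir o) zero * inv y₂ y₂≉0 ∎)
          where
          open ≈-Reasoning
          j = proj₁ head-nz
          y₂≈ : y₂ ≈ y * y₁
          y₂≈ = *-cancelˡ (proj₂ head-nz) (begin
            π (dir (head g)) j * y₂ ≈⟨ *-comm _ _ ⟩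
            y₂ * π (dir (head g)) j ≈⟨ e₂ j ⟨
            π (dir o) j ≈⟨ πo≈ j ⟩
            y * π (dir q) j ≈⟨ *-congˡ (e₁ j) ⟩
            y * (y₁ * π (dir (head g)) j) ≈⟨ solve 3 (λ y y₁ h → y :* (y₁ :* h) := h :* (y :* y₁)) refl _ _ _ ⟩
            π (dir (head g)) j * (y * y₁) ∎)

  -- The quadratic bound and its minimal counterexample

  open Constants ℓ using (K₁; Q; L; D; c; quota)

  1≤Q : 1 ≤ Q
  1≤Q = s≤s z≤n

  ℓ²≤Q : ℓ ℕ.* ℓ ≤ Q
  ℓ²≤Q = ℕₚ.≤-trans (ℕₚ.m≤m+n _ K₁) (ℕₚ.n≤1+n _)

  2≤Q : 2 ≤ Q
  2≤Q = s≤s (ℕₚ.≤-trans (ℕₚ.*-mono-≤ 1≤ℓ 1≤ℓ) (ℕₚ.m≤m+n _ K₁))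

  level≤Λ : ∀ i → i ≤ Λ Q i
  level≤Λ zero          = z≤n
  level≤Λ (suc zero)    = s≤s z≤n
  level≤Λ (suc (suc i)) = begin
    suc (suc i) ≤⟨ s≤s (ℕₚ.m≤n+m (suc i) i) ⟩
    suc (i ℕ.+ suc i) ≡⟨ ≡.cong (suc i ℕ.+_) (ℕₚ.+-identityʳ (suc i)) ⟨
    2 ℕ.* suc i ≤⟨ ℕₚ.*-mono-≤ 2≤Q (level≤Λ (suc i)) ⟩
    Q ℕ.* Λ Q (suc i) ∎
    where open ℕₚ.≤-Reasoning

  quota-suc : ∀ k → quota (suc k) ≡ quota k ℕ.+ (2 ℕ.* k ℕ.+ 1 ℕ.+ c)
  quota-suc k = Arithmetic.quadratic-suc k c

  quota-mono : ∀ {j k} → j ≤ k → quota j ≤ quota k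
  quota-mono j≤k = ℕₚ.+-mono-≤ (ℕₚ.*-mono-≤ j≤k j≤k) (ℕₚ.*-monoʳ-≤ c j≤k)

  RootedBound : ℕ → Set
  RootedBound k = ∀ {m} {w : Fin n → Vector (suc m)} → Rooted w k → ∀ {ps} → Config w ps → Ψ Q ps ≤ quota k

  -- One vector becomes the root and lowers the rank. The others are labels, a point has no more
  -- labels than its weight, and the growth of `quota` has room for the root.
  plain-bound : ∀ {m k} {v : Fin n → Vector m} → (∀ {j} → j < k → RootedBound j) → Contraction v k → ∀ vs → Spread id {v} vs → length vs ≤ quota k
  plain-bound ih K []       sp = z≤n
  plain-bound {k = k} ih K (z ∷ zs) sp = bound (uproot K z zs sp)
    where
    bound : (∃ λ k′ → k ≡ suc k′ × ∃ λ (w : Fin n → Vector (suc _)) → Rooted w k′ × ∃ λ ps → Config w ps × length zs ≤ sumBy level ps) → suc (length zs) ≤ quota k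
    bound (k′ , ≡.refl , w , rt , ps , cfg , zs≤) = begin
      suc (length zs) ≤⟨ s≤s zs≤ ⟩
      suc (sumBy level ps) ≤⟨ s≤s (sumBy-mono (All.universal (λ p → level≤Λ (level p)) ps)) ⟩
      suc (Ψ Q ps) ≤⟨ s≤s (ih ℕₚ.≤-refl rt cfg) ⟩
      suc (quota k′) ≡⟨ ℕₚ.+-comm 1 (quota k′) ⟩
      quota k′ ℕ.+ 1 ≤⟨ ℕₚ.+-monoʳ-≤ (quota k′) (ℕₚ.≤-trans (ℕₚ.m≤n+m 1 (2 ℕ.* k′)) (ℕₚ.m≤m+n _ c)) ⟩
      quota k′ ℕ.+ (2 ℕ.* k′ ℕ.+ 1 ℕ.+ c) ≡⟨ quota-suc k′ ⟨
      quota (suc k′) ∎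
      where open ℕₚ.≤-Reasoning

  -- What minimality forces on a point u of maximal level.
  record Top {m} (k : ℕ) (ps : List (Point m)) (u : Point m) : Set where
    field
      u∈       : u ∈ ps
      os qs    : List (Point m)
      os∈      : All (_∈ ps) os
      qs∈      : All (_∈ ps) qs
      os-apart : AllPairs _∦_ os
      qs-apart : AllPairs _∦_ qs
      u∦qs     : All (u ∦_) qs
      os-tight : All (λ o → ∃ λ q → q ∈ ps × u ∦ q × Tight u o q ×
                   (∀ p → p ∈ ps → u ∦ p → 2 ≤ level p → ∀ a b → b ≉ 0# → (∀ i → dir p i ≈ a * dir u i + b * dir q i) → p ≡ q)) os
      qs-tight : All (λ q → ∃ λ o → o ∈ ps × Tight u o q) qs
      os≤2qs   : length os ≤ 2 ℕ.* length qs
      many     : 2 ℕ.* k ℕ.+ c ≤ length os ℕ.+ Λ Q (level u)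
      1≤k      : 1 ≤ k

  module Critical {m k} (ih : ∀ {j} → j < k → RootedBound j) {w : Fin n → Vector (suc m)} (rt : Rooted w k) {ps : List (Point m)} (cfg : Config w ps)
    (big : quota k < Ψ Q ps) {u₀ : Point m} (2≤u₀ : 2 ≤ level u₀) (max : All (λ p → level p ≤ level u₀) ps) where

    make-top : ∀ {u} → u ∈ ps → level u ≡ level u₀ → Top k ps u
    make-top {u} u∈ u≡ = go k rt (λ j → ih j) big
      where
      rest = proj₁ (pick u∈)
      σ : ps ↭ u ∷ rest
      σ = proj₂ (pick u∈)
      cfg′ = Config-↭ σ cfg
      2≤u = ≡.subst (2 ≤_) (≡.sym u≡) 2≤u₀
      top = All.map (λ le → ℕₚ.≤-trans le (ℕₚ.≤-reflexive (≡.sym u≡))) (All.tail (Permₚ.All-resp-↭ σ max))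
      rest∈ : ∀ {p} → p ∈ rest → p ∈ ps
      rest∈ p∈ = Permₚ.∈-resp-↭ (↭-sym σ) (there p∈)
      ∈rest : ∀ {p} → p ∈ ps → u ∦ p → p ∈ rest
      ∈rest p∈ u∦p with Permₚ.∈-resp-↭ σ p∈
      ... | here ≡.refl = ⊥-elim (u∦p ∥-refl)
      ... | there p∈′   = p∈′

      go : ∀ k → Rooted w k → (∀ {j} → j < k → RootedBound j) → quota k < Ψ Q ps → Top k ps u
      go zero rt ih big = ⊥-elim (impossible (family-rooted (proj₂ (some-label u (Valid.nonempty (All.head (allValid cfg′)))))))
        where
        open Step rt cfg′ 2≤u top ℓ²≤Q
        impossible : ∀ {A : ℕ → Set} → ¬ (∃ λ k′ → 0 ≡ suc k′ × A k′)
        impossible (_ , () , _)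
      go (suc k) rt ih big = record
        { u∈ = u∈ ; os = Losses.os losses ; qs = Losses.qs losses
        ; os∈ = All.map rest∈ os∈rest ; qs∈ = All.map rest∈ qs∈rest
        ; os-apart = AllPairs-resp-⊆ (Losses.os⊆ losses) elems-apart
        ; qs-apart = AllPairs-resp-⊆ (Losses.qs⊆ losses) elems-apart
        ; u∦qs = All.map (All.lookup (AllPairs.head (apart cfg′))) qs∈rest
        ; os-tight = All.map (λ { {o} (q , q∈ , t , iso) → q , rest∈ (elems∈ q∈) , All.lookup (AllPairs.head (apart cfg′)) (elems∈ q∈) , t , isolated iso }) (Losses.os-tight losses)
        ; qs-tight = All.map (λ (o , o∈ , t) → o , rest∈ (elems∈ o∈) , t) (Losses.qs-tight losses)
        ; os≤2qs = Losses.os≤2qs losses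
        ; many = many ; 1≤k = s≤s z≤n }
        where
        open Step rt cfg′ 2≤u top ℓ²≤Q
        τ = groups-elems rest
        elems∈ : ∀ {p} → p ∈ concatMap elems (groups rest) → p ∈ rest
        elems∈ = Permₚ.∈-resp-↭ τ
        elems-apart : AllPairs _∦_ (concatMap elems (groups rest))
        elems-apart = AllPairs-resp-↭ (λ {p} {q} → ∦-sym {p = p} {q}) (↭-sym τ) (AllPairs.tail (apart cfg′))
        os∈rest : All (_∈ rest) (Losses.os losses)
        os∈rest = Sublistₚ.All-resp-⊆ (Losses.os⊆ losses) (All.tabulate elems∈)
        qs∈rest : All (_∈ rest) (Losses.qs losses)
        qs∈rest = Sublistₚ.All-resp-⊆ (Losses.qs⊆ losses) (All.tabulate elems∈)
        j = proj₁ (Valid.nonzero (All.head (allValid cfg′)))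
        uj≉0 = proj₂ (Valid.nonzero (All.head (allValid cfg′)))

        isolated : ∀ {q} → Isolated q → ∀ p → p ∈ ps → u ∦ p → 2 ≤ level p → ∀ a b → b ≉ 0# → (∀ i → dir p i ≈ a * dir u i + b * dir q i) → p ≡ q
        isolated {q} (g , g∈ , ≡.refl , light) p p∈ u∦p 2≤p a b b≉0 e = same (find (∈-groups (∈rest p∈ u∦p)))
          where
          p∥q : proj (dir u) j uj≉0 (dir p) ∥ proj (dir u) j uj≉0 (dir q)
          p∥q = b , b≉0 , λ i → trans (proj-linear (dir u) j uj≉0 {dir p} {dir u} {dir q} a b e i)
            (trans (+-congʳ (trans (*-congˡ (trans (+-congˡ (-‿cong (trans (*-congʳ (*-inv _ uj≉0)) (*-identityˡ _)))) (-‿inverseʳ _))) (zeroʳ a))) (+-identityˡ _))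
          same : (∃ λ g′ → g′ ∈ groups rest × p ∈ elems g′) → p ≡ head g
          same (g′ , g′∈ , p∈g′) = inside (≡.subst (λ g → p ∈ elems g) (apart⇒≡ ∥-sym (groups-apart rest) g′∈ g∈ (∥-trans (∥-sym (All.lookup (elem~head g′) p∈g′)) p∥q)) p∈g′)
            where
            inside : p ∈ elems g → p ≡ head g
            inside (here p≡)  = p≡
            inside (there p∈) = ⊥-elim (ℕₚ.<-irrefl (≡.sym (All.lookup light p∈)) 2≤p)

        hyp : ∀ {α} → α ∈ labels u → Ψ Q (points α) ≤ quota k
        hyp {α} α∈ = use (family-rooted α∈)
          where
          use : (∃ λ k′ → suc k ≡ suc k′ × Rooted (family α) k′) → Ψ Q (points α) ≤ quota k
          use (_ , ≡.refl , rt′) = ih ℕₚ.≤-refl rt′ (points-config α)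

        many : 2 ℕ.* suc k ℕ.+ c ≤ length (Losses.os losses) ℕ.+ Λ Q (level u)
        -- The quota grows by 2 k + 1 + c, and the strict inequality `big` adds one. Whatever the
        -- contractions do not retain on average is the weight of u or a lost point.
        many = ℕₚ.+-cancelˡ-≤ (quota k) _ _ (begin
          quota k ℕ.+ (2 ℕ.* suc k ℕ.+ c) ≡⟨ Arithmetic.shift (quota k) k c ⟩
          suc (quota k ℕ.+ (2 ℕ.* k ℕ.+ 1 ℕ.+ c)) ≡⟨ ≡.cong suc (quota-suc k) ⟨
          suc (quota (suc k)) ≤⟨ big ⟩
          Ψ Q ps ≡⟨ sumBy-↭ (Λ Q ∘ level) σ ⟩
          Λ Q (level u) ℕ.+ Ψ Q rest ≤⟨ ℕₚ.+-monoʳ-≤ (Λ Q (level u)) (averaging (quota k) hyp) ⟩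
          Λ Q (level u) ℕ.+ (quota k ℕ.+ length (Losses.os losses)) ≡⟨ Arithmetic.rotate (Λ Q (level u)) (quota k) _ ⟩
          quota k ℕ.+ (length (Losses.os losses) ℕ.+ Λ Q (level u)) ∎)
          where
          open ℕₚ.≤-Reasoning

  -- This isolates the weight comparison from the geometry that produces `β₀`: any stage of smaller
  -- rank that kills `β₀` over u′ and keeps enough points apart makes all surviving partners of u′
  -- exceed the top level.
  module Boosted {m k} (ih : ∀ {j} → j < k → RootedBound j) {w : Fin n → Vector (suc m)} (rt : Rooted w k) {ps : List (Point m)} (cfg : Config w ps)
    (big : quota k < Ψ Q ps) {J : ℕ} (2≤J : 2 ≤ J) (max : All (λ p → level p ≤ J) ps)
    {u′ : Point m} (u′≡J : level u′ ≡ J) (T′ : Top k ps u′) {β₀ : Carrier} (β₀∉ : ¬ β₀ ∈ₗ labels u′)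
    (S₃ : Stage w) (rank₃<k : Stage.rank S₃ < k) (kills : ∀ i → Stage.P S₃ (β₀ ⊹ dir u′) i ≈ 0#)
    {a : ℕ} (a≤ : a ≤ suc (ℓ ℕ.* (C ℕ.* k)) ℕ.+ suc (ℓ ℕ.* (C ℕ.* k)) ℕ.+ suc (ℓ ℕ.* (C ℕ.* k)))
    (reach : Reach S₃ a (λ t → suc (ℓ ℕ.* suc (ℓ ℕ.* suc (ℓ ℕ.* t))))) where

    private
      valid-of : ∀ {p} → p ∈ ps → Valid w p
      valid-of p∈ = All.lookup (allValid cfg) p∈
      vu′ = valid-of (Top.u∈ T′)

      û′ : Vector (suc m)
      û′ = β₀ ⊹ dir u′

      module S₃ = Stage S₃
      module I = Image S₃ cfg

      qs : List (Point m)
      qs = Top.qs T′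

      E : ℕ
      E = suc (ℓ ℕ.* (C ℕ.* k))

      Good : I.Group → Set
      Good g = suc J ≤ level (I.merged I.lab g)

      good? : ∀ g → Dec (Good g)
      good? g = suc J ℕ.≤? level (I.merged I.lab g)

      good : ∀ {q g} → q ∈ qs → g ∈ I.groups I.items → q ∈ I.elems g → Good g
      good {q} {g} q∈ g∈ q∈g = boost (All.lookup (Top.qs-tight T′) q∈)
        where
        q∈ps = All.lookup (Top.qs∈ T′) q∈
        boost : (∃ λ o₂ → o₂ ∈ ps × Tight u′ o₂ q) → Good g
        boost (o₂ , o₂∈ , tt) = ≡.subst (λ l → suc l ≤ level (I.merged I.lab g)) (≡.trans s.same u′≡J)
          (I.boosted {q} {o₂} q∈ps o₂∈ (Valid.distinct (valid-of q∈ps)) {b₀} {γ} s.y≉0 γ∈ b₀∉ P≈ g∈ q∈g)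
          where
          module s = Tight tt
          label = some-label o₂ (Valid.nonempty (valid-of o₂∈))
          γ = proj₁ label
          γ∈ = proj₂ label
          sl = slope {u = u′} {o₂} {q} s.y≉0 s.fits
          off = offset {u = u′} {o₂} {q} s.y≉0 s.fits γ
          sl≉0 : sl ≉ 0#
          sl≉0 = slope≉0 {u = u′} {o₂} {q} s.y≉0 s.fits s.x≉0
          into = fits-affine {u = u′} {o₂} {q} s.y≉0 s.fits γ∈
          b₀ = affine off sl β₀
          b₀∉ : ¬ b₀ ∈ₗ labels q
          -- The affine map of the tight triple is a bijection from the labels of u′ to those of q.
          -- Its value at a number outside the former lies outside the latter.
          b₀∉ b₀∈ = β₀∉ (Any.map (λ {s} e → decidable-stable (β₀ ≟ s) λ β₀≉s → affine-injective sl≉0 β₀≉s e)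
            (Affine.onto (Valid.distinct vu′) (ℕₚ.≤-reflexive s.same) {off} {sl} {off} {sl} sl≉0 sl≉0 into into sl≉0 into b₀∈))
          lifted : ∀ i → (γ ⊹ dir o₂) i ≈ s.x * û′ i + s.y * (b₀ ⊹ dir q) i
          lifted zero    = sym (begin
            s.x * β₀ + s.y * (γ * c′ + - (s.x * c′) * β₀) ≈⟨ solve 5 (λ x β y γ c → x :* β :+ y :* (γ :* c :+ (:- (x :* c)) :* β) := (x :* β :+ (y :* c) :* γ) :- (y :* c) :* (x :* β)) refl s.x β₀ s.y γ c′ ⟩
            (s.x * β₀ + (s.y * c′) * γ) - (s.y * c′) * (s.x * β₀) ≈⟨ +-cong (+-congˡ (trans (*-congʳ (*-inv _ s.y≉0)) (*-identityˡ γ))) (-‿cong (trans (*-congʳ (*-inv _ s.y≉0)) (*-identityˡ _))) ⟩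
            (s.x * β₀ + γ) - s.x * β₀ ≈⟨ solve 2 (λ a b → (a :+ b) :- a := b) refl _ γ ⟩
            γ ∎)
            where
            open ≈-Reasoning
            c′ = inv s.y s.y≉0
          lifted (suc i) = s.dir≈ i
          P≈ : ∀ i → S₃.P (γ ⊹ dir o₂) i ≈ s.y * S₃.P (b₀ ⊹ dir q) i
          P≈ i = trans (S₃.P-linear {γ ⊹ dir o₂} {û′} {b₀ ⊹ dir q} s.x s.y lifted i) (trans (+-congʳ (trans (*-congˡ (kills i)) (zeroʳ _))) (+-identityˡ _))

      λJ B : ℕ
      λJ = Λ Q J
      -- This is (Q - 1) `λJ`. A point with more than `J` labels weighs at least Q `λJ`, and the
      -- difference `λJ` covers the 1 counted for each group.
      B = (ℓ ℕ.* ℓ ℕ.+ K₁) ℕ.* λJ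

      gs = I.groups I.items

      1≤λJ : 1 ≤ λJ
      1≤λJ = 1≤Λ 1≤Q (ℕₚ.≤-trans (s≤s z≤n) 2≤J)

      image-bound : length gs ℕ.+ B ℕ.* length (filter good? gs) ≤ quota k
      image-bound = begin
        length gs ℕ.+ B ℕ.* length (filter good? gs) ≡⟨ ≡.cong₂ ℕ._+_ (≡.sym (sumBy-1 gs)) (≡.trans (≡.cong (B ℕ.*_) (length-filter-sumBy good? gs)) (≡.sym (sumBy-* B (indicator ∘ good?) gs))) ⟩
        sumBy (λ _ → 1) gs ℕ.+ sumBy (λ g → B ℕ.* indicator (good? g)) gs ≡⟨ sumBy-+ (λ _ → 1) (λ g → B ℕ.* indicator (good? g)) gs ⟨
        sumBy (λ g → 1 ℕ.+ B ℕ.* indicator (good? g)) gs ≤⟨ sumBy-mono (All.map (λ {g} v → weigh g (Valid.nonempty v) (good? g)) (Allₚ.map⁻ (allValid I.image-config))) ⟩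
        sumBy (Λ Q ∘ level ∘ I.merged I.lab) gs ≡⟨ sumBy-map (Λ Q ∘ level) (I.merged I.lab) gs ⟨
        Ψ Q I.image-points ≤⟨ ih rank₃<k S₃.rooted I.image-config ⟩
        quota S₃.rank ≤⟨ quota-mono (ℕₚ.<⇒≤ rank₃<k) ⟩
        quota k ∎
        where
        open ℕₚ.≤-Reasoning
        weigh : ∀ g → 1 ≤ level (I.merged I.lab g) → (d : Dec (Good g)) → 1 ℕ.+ B ℕ.* indicator d ≤ Λ Q (level (I.merged I.lab g))
        weigh g 1≤ (no _)  = ≡.subst (λ x → 1 ℕ.+ x ≤ Λ Q (level (I.merged I.lab g))) (≡.sym (ℕₚ.*-zeroʳ B)) (1≤Λ 1≤Q 1≤)
        weigh g 1≤ (yes h) = begin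
          1 ℕ.+ B ℕ.* 1 ≡⟨ ≡.cong suc (ℕₚ.*-identityʳ B) ⟩
          1 ℕ.+ B ≤⟨ ℕₚ.+-monoˡ-≤ B 1≤λJ ⟩
          Q ℕ.* λJ ≤⟨ Λ-step Q J ⟩
          Λ Q (suc J) ≤⟨ Λ-mono 1≤Q h ⟩
          Λ Q (level (I.merged I.lab g)) ∎

      Ψ-bound : Ψ Q ps ≤ length ps ℕ.+ λJ ℕ.* (C ℕ.* k)
      Ψ-bound = begin
        Ψ Q ps ≤⟨ sumBy-mono (All.map (λ {p} le → weigh p le (heavy? p)) max) ⟩
        sumBy (λ p → 1 ℕ.+ λJ ℕ.* indicator (heavy? p)) ps ≡⟨ sumBy-+ (λ _ → 1) (λ p → λJ ℕ.* indicator (heavy? p)) ps ⟩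
        sumBy (λ _ → 1) ps ℕ.+ sumBy (λ p → λJ ℕ.* indicator (heavy? p)) ps ≡⟨ ≡.cong₂ ℕ._+_ (sumBy-1 ps) (≡.trans (sumBy-* λJ (indicator ∘ heavy?) ps) (≡.cong (λJ ℕ.*_) (≡.sym (length-filter-sumBy heavy? ps)))) ⟩
        length ps ℕ.+ λJ ℕ.* length (filter heavy? ps) ≤⟨ ℕₚ.+-monoʳ-≤ (length ps) (ℕₚ.*-monoʳ-≤ λJ (heavy-count rt cfg)) ⟩
        length ps ℕ.+ λJ ℕ.* (C ℕ.* k) ∎
        where
        open ℕₚ.≤-Reasoning
        weigh : ∀ p → level p ≤ J → (d : Dec (Heavy p)) → Λ Q (level p) ≤ 1 ℕ.+ λJ ℕ.* indicator d
        weigh p le (yes _) = ℕₚ.≤-trans (Λ-mono 1≤Q le) (ℕₚ.≤-trans (ℕₚ.≤-reflexive (≡.sym (ℕₚ.*-identityʳ λJ))) (ℕₚ.n≤1+n _))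
        weigh p le (no ¬h) = ℕₚ.≤-trans (Λ-mono 1≤Q {j = 1} (ℕₚ.≤-pred (ℕₚ.≰⇒> ¬h))) (ℕₚ.m≤m+n 1 _)

      -- For all points the additive bound is used, as a loss of order k can be repaid. The partners
      -- may number only about k, so for them the multiplicative bound is used.
      all-reach = reach (allValid cfg) (apart cfg)
      partners-reach = reach (All.map valid-of (Top.qs∈ T′)) (Top.qs-apart T′)

      all₃ partners₃ : List (Point m)
      all₃ = proj₁ all-reach
      partners₃ = proj₁ partners-reach

      points≤gs : length all₃ ≤ length gs
      points≤gs = ℕₚ.≤-trans (I.spread-groups {G = λ _ → 0 ≡ 0} (λ _ → yes ≡.refl) (proj₁ (proj₂ (proj₂ all-reach))) (proj₁ (proj₂ all-reach)) (λ _ _ _ → ≡.refl))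
        (Listₚ.length-filter (λ _ → yes ≡.refl) gs)

      partners≤good : length partners₃ ≤ length (filter good? gs)
      partners≤good = I.spread-groups good? (proj₁ (proj₂ (proj₂ partners-reach))) (All.map (λ q∈ → All.lookup (Top.qs∈ T′) q∈) (proj₁ (proj₂ partners-reach)))
        λ p∈ → good (All.lookup (proj₁ (proj₂ partners-reach)) p∈)

      gain : E ℕ.+ E ℕ.+ E ℕ.+ λJ ℕ.* (C ℕ.* k) ≤ B ℕ.* length (filter good? gs)
      gain = Arithmetic.lost≤gained ℓ C k 1≤λJ (Top.1≤k T′)
        (Arithmetic.partners-survive ℓ C k {L = L} (Top.many T′) (Top.os≤2qs T′) (Λ-mono 1≤Q (level≤ℓ rt vu′)) (proj₂ (proj₂ (proj₂ (proj₂ partners-reach)))))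
        partners≤good

    contradiction : ⊥
    contradiction = ℕₚ.<-irrefl ≡.refl (begin-strict
      quota k <⟨ big ⟩
      Ψ Q ps ≤⟨ Ψ-bound ⟩
      length ps ℕ.+ λJ ℕ.* (C ℕ.* k) ≤⟨ ℕₚ.+-monoˡ-≤ (λJ ℕ.* (C ℕ.* k)) (ℕₚ.≤-trans (proj₁ (proj₂ (proj₂ (proj₂ all-reach)))) (ℕₚ.+-monoʳ-≤ (length all₃) a≤)) ⟩
      length all₃ ℕ.+ (E ℕ.+ E ℕ.+ E) ℕ.+ λJ ℕ.* (C ℕ.* k) ≡⟨ ℕₚ.+-assoc (length all₃) (E ℕ.+ E ℕ.+ E) (λJ ℕ.* (C ℕ.* k)) ⟩
      length all₃ ℕ.+ (E ℕ.+ E ℕ.+ E ℕ.+ λJ ℕ.* (C ℕ.* k)) ≤⟨ ℕₚ.+-mono-≤ points≤gs gain ⟩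
      length gs ℕ.+ B ℕ.* length (filter good? gs) ≤⟨ image-bound ⟩
      quota k ∎)
      where
      open ℕₚ.≤-Reasoning

  -- Two tight lines {u,n,o} and {u′,n′,o} through o span a plane in which n, u′, n′ become collinear once u is contracted.
  -- Contracting n with a suitable label then gives u′ a new label β₀, and contracting u′ with that label
  -- gives a new label to every q with which u′ is tight.
  module Crossing {m k} (ih : ∀ {j} → j < k → RootedBound j) {w : Fin n → Vector (suc m)} (rt : Rooted w k) {ps : List (Point m)} (cfg : Config w ps)
    (big : quota k < Ψ Q ps) {J : ℕ} (2≤J : 2 ≤ J) (max : All (λ p → level p ≤ J) ps)
    {u n₁ u′ n′ o : Point m} (u∈ : u ∈ ps) (n∈ : n₁ ∈ ps) (n′∈ : n′ ∈ ps)
    (u≡J : level u ≡ J) (u′≡J : level u′ ≡ J) (tight : Tight u o n₁) (tight′ : Tight u′ o n′)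
    (u∦n : u ∦ n₁) (u∦u′ : u ∦ u′) (isolated : ∀ a b → b ≉ 0# → ¬ (∀ i → dir u′ i ≈ a * dir u i + b * dir n₁ i)) (T′ : Top k ps u′) where

    private
      module t = Tight tight
      module t′ = Tight tight′
      valid-of : ∀ {p} → p ∈ ps → Valid w p
      valid-of p∈ = All.lookup (allValid cfg) p∈
      vu = valid-of u∈
      vn = valid-of n∈
      vu′ = valid-of (Top.u∈ T′)
      vn′ = valid-of n′∈

      α = proj₁ (some-label u (Valid.nonempty vu))
      α∈ = proj₂ (some-label u (Valid.nonempty vu))

      x′⁻¹ : Carrier
      x′⁻¹ = inv t′.x t′.x≉0

      new : Carrier → Carrier → Carrier
      new α′ a′ = ((t.x * α + t.y * α′) - t′.y * a′) * x′⁻¹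

      NewLabel : Set
      NewLabel = Any (λ α′ → Any (λ a′ → ¬ new α′ a′ ∈ₗ labels u′) (labels n′)) (labels n₁)

      -- Otherwise each label `α′` of n₁ yields a map from the labels of n′ to those of u′, all of
      -- the same slope. By `affine-offset` the offsets agree, although n₁ has at least two labels.
      new-label : NewLabel
      new-label = decide (Any.any? (λ α′ → Any.any? (λ a′ → ¬? (new α′ a′ ∈ₗ? labels u′)) (labels n′)) (labels n₁))
        where
        slope′ : Carrier
        slope′ = - (t′.y * x′⁻¹)
        slope′≉0 : slope′ ≉ 0#
        slope′≉0 = neg-≉0 (*-≉0 t′.y≉0 (inv-≉0 _ _))
        offset′ : Carrier → Carrier
        offset′ α′ = (t.x * α + t.y * α′) * x′⁻¹
        decide : Dec NewLabel → NewLabel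
        decide (yes p) = p
        decide (no ¬p) = ⊥-elim (clash (labels n₁) (Valid.distinct vn) (≡.subst (2 ≤_) (≡.sym (≡.trans t.same u≡J)) 2≤J) id)
          where
          into : ∀ {α′} → α′ ∈ labels n₁ → All (λ a′ → affine (offset′ α′) slope′ a′ ∈ₗ labels u′) (labels n′)
          into {α′} α′∈ = All.tabulate λ {a′} a′∈ → ∈ₗ-resp (solve 7 (λ x α y α′ c yy a′ → (x :* α :+ y :* α′) :* c :+ (:- (yy :* c)) :* a′ := ((x :* α :+ y :* α′) :- yy :* a′) :* c)
            refl t.x α t.y α′ x′⁻¹ t′.y a′) (found a′∈)
            where
            found : ∀ {a′} → a′ ∈ labels n′ → new α′ a′ ∈ₗ labels u′
            found {a′} a′∈ with new α′ a′ ∈ₗ? labels u′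
            ... | yes p = p
            ... | no ¬q = ⊥-elim (¬p (lose α′∈ (lose a′∈ ¬q)))
          clash : ∀ S → Distinct S → 2 ≤ length S → (∀ {s} → s ∈ S → s ∈ labels n₁) → ⊥
          clash (s ∷ [])     _ (s≤s ()) _
          clash (s ∷ s′ ∷ S) ((s≉s′ ∷ _) ∷ _) _ sub = s≉s′ (*-cancelˡ t.y≉0 (begin
            t.y * s ≈⟨ solve 2 (λ a b → b := (a :+ b) :- a) refl (t.x * α) _ ⟩
            (t.x * α + t.y * s) - t.x * α ≈⟨ +-congʳ (*-cancelˡ (inv-≉0 _ t′.x≉0) (trans (*-comm _ _) (trans offsets (*-comm _ _)))) ⟩
            (t.x * α + t.y * s′) - t.x * α ≈⟨ solve 2 (λ a b → (a :+ b) :- a := b) refl (t.x * α) _ ⟩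
            t.y * s′ ∎))
            where
            open ≈-Reasoning
            offsets : offset′ s ≈ offset′ s′
            offsets = affine-offset (Valid.distinct vn′) (Valid.nonempty vn′) (ℕₚ.≤-reflexive (≡.sym t′.same)) slope′≉0
              (into (sub (here ≡.refl))) (into (sub (there (here ≡.refl))))

      found = find new-label
      α′ = proj₁ found
      α′∈ = proj₁ (proj₂ found)
      found′ = find (proj₂ (proj₂ found))
      a′ = proj₁ found′
      a′∈ = proj₁ (proj₂ found′)
      β₀ = new α′ a′
      β₀∉ : ¬ β₀ ∈ₗ labels u′
      β₀∉ = proj₂ (proj₂ found′)

      û n̂ û′ ô : Vector (suc m)
      û  = α ⊹ dir u
      n̂  = α′ ⊹ dir n₁
      û′ = β₀ ⊹ dir u′
      -- This vector over o need not represent an element. It is a point common to the line of `û`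
      -- and `n̂` and the line of `û′` and a′ over n′, and `β₀` is solved from that condition.
      ô i = t.x * û i + t.y * n̂ i

      β₀-relation : t.x * α + t.y * α′ ≈ t′.x * β₀ + t′.y * a′
      β₀-relation = sym (begin
        t′.x * (((t.x * α + t.y * α′) - t′.y * a′) * x′⁻¹) + t′.y * a′ ≈⟨ solve 4 (λ x e i b → x :* ((e :- b) :* i) :+ b := (x :* i) :* (e :- b) :+ b) refl t′.x _ x′⁻¹ _ ⟩
        (t′.x * x′⁻¹) * ((t.x * α + t.y * α′) - t′.y * a′) + t′.y * a′ ≈⟨ +-congʳ (trans (*-congʳ (*-inv _ _)) (*-identityˡ _)) ⟩
        ((t.x * α + t.y * α′) - t′.y * a′) + t′.y * a′ ≈⟨ solve 2 (λ e b → (e :- b) :+ b := e) refl _ _ ⟩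
        t.x * α + t.y * α′ ∎)
        where open ≈-Reasoning

      ô-relation : ∀ i → ô i ≈ t′.x * û′ i + t′.y * (a′ ⊹ dir n′) i
      ô-relation zero    = β₀-relation
      ô-relation (suc i) = trans (sym (t.dir≈ i)) (t′.dir≈ i)

      ju = Valid.nonzero vu

      step₃ : (A₁ : Advanced (stage₀ rt) û) (A₂ : Advanced (Advanced.stage A₁) n̂) → Advanced (Advanced.stage A₂) û′ → ⊥
      step₃ A₁ A₂ A₃ = Boosted.contradiction ih rt cfg big 2≤J max u′≡J T′ β₀∉ (Advanced.stage A₃) rank₃<k (Advanced.kills A₃) bound reach₃
        where
        E = suc (ℓ ℕ.* (C ℕ.* k))
        rank₁≤k : Stage.rank (Advanced.stage A₁) ≤ k
        rank₁≤k = ℕₚ.≤-trans (ℕₚ.n≤1+n _) (ℕₚ.≤-reflexive (≡.sym (Advanced.rank≡ A₁)))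
        rank₂≤k : Stage.rank (Advanced.stage A₂) ≤ k
        rank₂≤k = ℕₚ.≤-trans (ℕₚ.n≤1+n _) (ℕₚ.≤-trans (ℕₚ.≤-reflexive (≡.sym (Advanced.rank≡ A₂))) rank₁≤k)
        rank₃<k : Stage.rank (Advanced.stage A₃) < k
        rank₃<k = ℕₚ.≤-trans (ℕₚ.≤-reflexive (≡.sym (Advanced.rank≡ A₃))) rank₂≤k
        E-mono : ∀ {j} → j ≤ k → suc (ℓ ℕ.* (C ℕ.* j)) ≤ E
        E-mono j≤k = s≤s (ℕₚ.*-monoʳ-≤ ℓ (ℕₚ.*-monoʳ-≤ C j≤k))
        stretch : ∀ {s t} → s ≤ t → suc (ℓ ℕ.* s) ≤ suc (ℓ ℕ.* t)
        stretch s≤t = s≤s (ℕₚ.*-monoʳ-≤ ℓ s≤t)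
        reach₃ = Advanced.reach A₃ (λ s≤t → stretch (stretch s≤t)) (Advanced.reach A₂ stretch (Advanced.reach A₁ id (reach₀ rt)))
        bound : suc (ℓ ℕ.* (C ℕ.* Stage.rank (Advanced.stage A₂))) ℕ.+ (suc (ℓ ℕ.* (C ℕ.* Stage.rank (Advanced.stage A₁))) ℕ.+ (E ℕ.+ 0)) ≤ E ℕ.+ E ℕ.+ E
        bound = ℕₚ.≤-trans (ℕₚ.+-mono-≤ (E-mono rank₂≤k) (ℕₚ.+-mono-≤ (E-mono rank₁≤k) (ℕₚ.≤-reflexive (ℕₚ.+-identityʳ E)))) (ℕₚ.≤-reflexive (≡.sym (ℕₚ.+-assoc E E E)))

      step₂ : (A₁ : Advanced (stage₀ rt) û) → Advanced (Advanced.stage A₁) n̂ → ⊥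
      step₂ A₁ A₂ = step₃ A₁ A₂ (Advance.advanced S₂ {û′} û′-avail (proj₁ u′-nonzero) Pû′≉0)
        where
        S₂ = Advanced.stage A₂
        module S₁ = Stage (Advanced.stage A₁)
        module S₂ = Stage (Advanced.stage A₂)
        u′-nonzero : Nonzero (S₂.π (dir u′))
        -- If u′ vanished here, its direction would be a combination of those of u and n₁, against
        -- `isolated`.
        u′-nonzero = Advanced.nonzero A₂ (Advanced.nonzero A₁ (Valid.nonzero vu′) (λ u′∥u → u∦u′ (∥-sym u′∥u)))
          λ (y , y≉0 , e) → let (a , b , b≉0 , e′) = Advanced.collapse A₁ {dir u′} {dir n₁} (y , y≉0 , λ i → trans (e i) (*-congˡ (S₁.P-dir α′ (dir n₁) i))) in isolated a b b≉0 e′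
        Pû′≉0 : S₂.P û′ (suc (proj₁ u′-nonzero)) ≉ 0#
        Pû′≉0 e = proj₂ u′-nonzero (trans (sym (S₂.P-dir β₀ (dir u′) (proj₁ u′-nonzero))) e)
        P₂ô≈0 : ∀ i → S₂.P ô i ≈ 0#
        P₂ô≈0 i = trans (S₂.P-linear {ô} {û} {n̂} t.x t.y (λ _ → refl) i) (trans (+-cong
          (trans (*-congˡ (Advanced.preserves-0 A₂ {û} (Advanced.kills A₁) i)) (zeroʳ _)) (trans (*-congˡ (Advanced.kills A₂ i)) (zeroʳ _))) (+-identityˡ 0#))
        û′-avail : Avail S₂.family (S₂.P û′)
        -- As `ô` has been killed, `û′` is now parallel to a′ over n′. An element thus realises the
        -- label `β₀`, which u′ did not have before.
        û′-avail = Avail-scale {s = - (t′.y * x′⁻¹)} (neg-≉0 (*-≉0 t′.y≉0 (inv-≉0 _ _))) relation (S₂.P-avail (All.lookup (Valid.avail vn′) a′∈))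
          where
          relation : ∀ i → S₂.P û′ i ≈ - (t′.y * x′⁻¹) * S₂.P (a′ ⊹ dir n′) i
          relation i = *-cancelˡ t′.x≉0 (begin
            t′.x * U ≈⟨ solve 2 (λ a b → a := (a :+ b) :- b) refl _ (t′.y * N) ⟩
            (t′.x * U + t′.y * N) - t′.y * N ≈⟨ +-congʳ (trans (sym (S₂.P-linear {ô} {û′} {a′ ⊹ dir n′} t′.x t′.y ô-relation i)) (P₂ô≈0 i)) ⟩
            0# - t′.y * N ≈⟨ +-congˡ (-‿cong (trans (sym (*-identityˡ _)) (*-congʳ (sym (*-inv t′.x t′.x≉0))))) ⟩
            0# - (t′.x * x′⁻¹) * (t′.y * N) ≈⟨ solve 4 (λ x i y n → con ℤ.0ℤ :- (x :* i) :* (y :* n) := x :* (:- (y :* i) :* n)) refl t′.x x′⁻¹ t′.y N ⟩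
            t′.x * (- (t′.y * x′⁻¹) * N) ∎)
            where
            open ≈-Reasoning
            U = S₂.P û′ i
            N = S₂.P (a′ ⊹ dir n′) i

      step₁ : Advanced (stage₀ rt) û → ⊥
      step₁ A₁ = step₂ A₁ (Advance.advanced (Advanced.stage A₁) {n̂} (S₁.P-avail (All.lookup (Valid.avail vn) α′∈)) (proj₁ n-nonzero) Pn̂≉0)
        where
        module S₁ = Stage (Advanced.stage A₁)
        n-nonzero : Nonzero (S₁.π (dir n₁))
        n-nonzero = Advanced.nonzero A₁ (Valid.nonzero vn) (λ n∥u → u∦n (∥-sym n∥u))
        Pn̂≉0 : S₁.P n̂ (suc (proj₁ n-nonzero)) ≉ 0#
        Pn̂≉0 e = proj₂ n-nonzero (trans (sym (S₁.P-dir α′ (dir n₁) (proj₁ n-nonzero))) e)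

    contradiction : ⊥
    contradiction = step₁ (Advance.advanced (stage₀ rt) {û} (All.lookup (Valid.avail vu) α∈) (proj₁ ju) (proj₂ ju))

  -- Double counting top points against light points

  module Count {m k} (ih : ∀ {j} → j < k → RootedBound j) {w : Fin n → Vector (suc m)} (rt : Rooted w k) {ps : List (Point m)} (cfg : Config w ps)
    (big : quota k < Ψ Q ps) (almost : Ψ Q ps ≤ suc (quota k)) {u₀ : Point m} (u₀∈ : u₀ ∈ ps) (2≤u₀ : 2 ≤ level u₀) (max : All (λ p → level p ≤ level u₀) ps) where

    private
      J = level u₀
      x = Λ Q J

      top-level? : ∀ (p : Point m) → Dec (level p ≡ J)
      top-level? p = level p ℕ.≟ J

      light? : ∀ (p : Point m) → Dec (level p ≡ 1)
      light? p = level p ℕ.≟ 1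

      tops lights : List (Point m)
      tops = filter top-level? ps
      lights = filter light? ps

      TopPoint : Set
      TopPoint = Σ (Point m) λ u → level u ≡ J × Top k ps u

      top-of : ∀ {u} → u ∈ ps → level u ≡ J → TopPoint
      top-of {u} u∈ u≡ = u , u≡ , Critical.make-top ih rt cfg big {u₀ = u₀} 2≤u₀ max u∈ u≡

      tagged : ∀ {us} → All (λ u → u ∈ ps × level u ≡ J) us → ∃ λ (ts : List TopPoint) → map proj₁ ts ≡ us
      tagged []               = [] , ≡.refl
      tagged ((u∈ , u≡) ∷ us) = let (ts , e) = tagged us in top-of u∈ u≡ ∷ ts , ≡.cong (_ ∷_) e

      tops-tagged : ∃ λ (ts : List TopPoint) → map proj₁ ts ≡ tops
      tops-tagged = tagged (All.zip (Allₚ.filter⁺ top-level? (All.tabulate id) , Allₚ.all-filter top-level? ps))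

      ts : List TopPoint
      ts = proj₁ tops-tagged

      length-ts : length ts ≡ length tops
      length-ts = ≡.trans (≡.sym (Listₚ.length-map proj₁ ts)) (≡.cong length (proj₂ tops-tagged))

      ts-apart : AllPairs (λ s t → proj₁ s ∦ proj₁ t) ts
      ts-apart = AllPairsₚ.map⁻ (≡.subst (AllPairs _∦_) (≡.sym (proj₂ tops-tagged)) (AllPairs-filter top-level? (apart cfg)))

      os : TopPoint → List (Point m)
      os t = Top.os (proj₂ (proj₂ t))

      same-point : ∀ {p q : Point m} → p ∈ ps → q ∈ ps → dir p ∥ dir q → p ≡ q
      same-point = apart⇒≡ ∥-sym (apart cfg)

      Hits : TopPoint → Point m → Set
      Hits t o = Any (λ o′ → dir o ∥ dir o′) (os t)

      hits? : ∀ t o → Dec (Hits t o)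
      hits? t o = Any.any? (λ o′ → dir o ∥? dir o′) (os t)

      ≢-apart : ∀ {xs : List (Point m)} → AllPairs _∦_ xs → AllPairs (λ p q → ∀ y → p ≡ y → q ≡ y → ⊥) xs
      ≢-apart = AllPairs.map λ { p∦q y ≡.refl ≡.refl → p∦q ∥-refl }

      os≤hits : ∀ t → length (os t) ≤ sumBy (λ o → indicator (hits? t o)) lights
      os≤hits t@(u , _ , T) = ≡.subst (length (os t) ≤_) (length-filter-sumBy (hits? t) lights)
        (pigeonhole {R = _≡_} (≢-apart (Top.os-apart T)) (All.tabulate found))
        where
        found : ∀ {o} → o ∈ os t → o ∈ filter (hits? t) lights
        found {o} o∈ = let (_ , _ , _ , tight , _) = All.lookup (Top.os-tight T) o∈ in
          ∈ₚ.∈-filter⁺ (hits? t) (∈ₚ.∈-filter⁺ light? (All.lookup (Top.os∈ T) o∈) (Tight.single tight)) (lose o∈ ∥-refl)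

      hit : ∀ {t o} → o ∈ ps → Hits t o → o ∈ os t
      hit {t@(_ , _ , T)} o∈ h = let (o′ , o′∈ , o∥o′) = find h in ≡.subst (_∈ os t) (≡.sym (same-point o∈ (All.lookup (Top.os∈ T) o′∈) o∥o′)) o′∈

      -- By Crossing, all top points that hit o lie on one line through o, which carries only two of them.
      hits≤2 : ∀ {o} → o ∈ ps → ∀ ts → All (λ t → Hits t o) ts → AllPairs (λ s t → proj₁ s ∦ proj₁ t) ts → length ts ≤ 2
      hits≤2 o∈ [] _ _ = z≤n
      hits≤2 {o} o∈ (t₀@(u , u≡ , T) ∷ ts) (h₀ ∷ hs) ap = aligned (All.lookup (Top.os-tight T) (hit {t₀} o∈ h₀))
        where
        aligned : (∃ λ q → q ∈ ps × u ∦ q × Tight u o q ×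
                   (∀ p → p ∈ ps → u ∦ p → 2 ≤ level p → ∀ a b → b ≉ 0# → (∀ i → dir p i ≈ a * dir u i + b * dir q i) → p ≡ q)) → length (t₀ ∷ ts) ≤ 2
        aligned (q , q∈ , u∦q , tight , isolated) = pigeonhole {R = λ t y → dir (proj₁ t) ∥ dir y} {ys = u ∷ q ∷ []}
          (AllPairs.map (λ s∦t y p p′ → s∦t (∥-trans p (∥-sym p′))) ap) (here ∥-refl ∷ All.map (λ {t} → place t) hs)
          where
          place : ∀ t → Hits t o → Any (λ y → dir (proj₁ t) ∥ dir y) (u ∷ q ∷ [])
          place t@(u′ , u′≡ , T′) h with dir u′ ∥? dir u | dir u′ ∥? dir q
          ... | yes p | _     = here p
          ... | no _  | yes p = there (here p)
          ... | no u′∦u | no u′∦q = ⊥-elim (cross (All.lookup (Top.os-tight T′) (hit {t} o∈ h)))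
            where
            u∦u′ : u ∦ u′
            u∦u′ p = u′∦u (∥-sym p)
            isolated′ : ∀ a b → b ≉ 0# → ¬ (∀ i → dir u′ i ≈ a * dir u i + b * dir q i)
            isolated′ a b b≉0 e = u′∦q (≡.subst (λ p → dir u′ ∥ dir p) (isolated u′ (Top.u∈ T′) u∦u′ (≡.subst (2 ≤_) (≡.sym u′≡) 2≤u₀) a b b≉0 e) ∥-refl)
            cross : (∃ λ q′ → q′ ∈ ps × u′ ∦ q′ × Tight u′ o q′ × _) → ⊥
            cross (q′ , q′∈ , _ , tight′ , _) = Crossing.contradiction ih rt cfg big 2≤u₀ max (Top.u∈ T) q∈ q′∈ u≡ u′≡ tight tight′ u∦q u∦u′ isolated′ T′

      -- Tight pairs are counted twice over: every top point has at least 2 k + c - x of them, every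
      -- light point at most two.
      edges : length tops ℕ.* (2 ℕ.* k ℕ.+ c) ≤ 2 ℕ.* length lights ℕ.+ length tops ℕ.* x
      edges = begin
        length tops ℕ.* (2 ℕ.* k ℕ.+ c) ≡⟨ ≡.cong (ℕ._* (2 ℕ.* k ℕ.+ c)) length-ts ⟨
        length ts ℕ.* (2 ℕ.* k ℕ.+ c) ≤⟨ sumBy-≥ {f = λ t → length (os t) ℕ.+ x} (All.universal (λ t → ≡.subst (λ l → 2 ℕ.* k ℕ.+ c ≤ length (os t) ℕ.+ Λ Q l) (proj₁ (proj₂ t)) (Top.many (proj₂ (proj₂ t)))) ts) ⟩
        sumBy (λ t → length (os t) ℕ.+ x) ts ≡⟨ sumBy-+ (λ t → length (os t)) (λ _ → x) ts ⟩
        sumBy (λ t → length (os t)) ts ℕ.+ sumBy (λ _ → x) ts ≤⟨ ℕₚ.+-mono-≤ (sumBy-mono (All.universal os≤hits ts)) (ℕₚ.≤-reflexive (≡.trans (sumBy-const x ts) (≡.cong (ℕ._* x) length-ts))) ⟩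
        sumBy (λ t → sumBy (λ o → indicator (hits? t o)) lights) ts ℕ.+ length tops ℕ.* x ≡⟨ ≡.cong (ℕ._+ length tops ℕ.* x) (sumBy-swap (λ t o → indicator (hits? t o)) ts lights) ⟩
        sumBy (λ o → sumBy (λ t → indicator (hits? t o)) ts) lights ℕ.+ length tops ℕ.* x ≤⟨ ℕₚ.+-monoˡ-≤ (length tops ℕ.* x) (sumBy-≤ {c = 2} (Allₚ.filter⁺ light? (All.tabulate two))) ⟩
        length lights ℕ.* 2 ℕ.+ length tops ℕ.* x ≡⟨ ≡.cong (ℕ._+ length tops ℕ.* x) (ℕₚ.*-comm (length lights) 2) ⟩
        2 ℕ.* length lights ℕ.+ length tops ℕ.* x ∎
        where
        open ℕₚ.≤-Reasoning
        two : ∀ {o} → o ∈ ps → sumBy (λ t → indicator (hits? t o)) ts ≤ 2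
        two {o} o∈ = ≡.subst (_≤ 2) (length-filter-sumBy (λ t → hits? t o) ts)
          (hits≤2 o∈ (filter (λ t → hits? t o) ts) (Allₚ.all-filter (λ t → hits? t o) ts) (AllPairs-filter (λ t → hits? t o) ts-apart))

      -- The partners q of `u₀` have maximal level themselves, and no more than two lost points
      -- share a partner. The point `u₀` is one further top point, which accounts for the summand 2.
      degree : 2 ℕ.* k ℕ.+ c ℕ.+ 2 ≤ 2 ℕ.* length tops ℕ.+ x
      degree = begin
        2 ℕ.* k ℕ.+ c ℕ.+ 2 ≤⟨ ℕₚ.+-monoˡ-≤ 2 (ℕₚ.≤-trans (Top.many T₀) (ℕₚ.+-monoˡ-≤ x (Top.os≤2qs T₀))) ⟩
        2 ℕ.* length qs ℕ.+ x ℕ.+ 2 ≡⟨ Arithmetic.double-suc (length qs) x ⟩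
        2 ℕ.* suc (length qs) ℕ.+ x ≤⟨ ℕₚ.+-monoˡ-≤ x (ℕₚ.*-monoʳ-≤ 2 partners) ⟩
        2 ℕ.* length tops ℕ.+ x ∎
        where
        open ℕₚ.≤-Reasoning
        T₀ : Top k ps u₀
        T₀ = proj₂ (proj₂ (top-of u₀∈ ≡.refl))
        qs = Top.qs T₀
        partners : length (u₀ ∷ qs) ≤ length tops
        partners = pigeonhole {R = _≡_} (≢-apart (Top.u∦qs T₀ ∷ Top.qs-apart T₀))
          (∈ₚ.∈-filter⁺ top-level? u₀∈ ≡.refl ∷ All.map (λ { {q} (q∈ , _ , _ , tight) → ∈ₚ.∈-filter⁺ top-level? q∈ (Tight.same tight) }) (All.zip (Top.qs∈ T₀ , Top.qs-tight T₀)))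

      -- Since the maximal level is at least 2, no point is both top and light.
      weight : x ℕ.* length tops ℕ.+ length lights ≤ Ψ Q ps
      weight = begin
        x ℕ.* length tops ℕ.+ length lights ≡⟨ ≡.cong₂ ℕ._+_ (≡.trans (≡.cong (x ℕ.*_) (length-filter-sumBy top-level? ps)) (≡.sym (sumBy-* x (indicator ∘ top-level?) ps))) (length-filter-sumBy light? ps) ⟩
        sumBy (λ p → x ℕ.* indicator (top-level? p)) ps ℕ.+ sumBy (indicator ∘ light?) ps ≡⟨ sumBy-+ (λ p → x ℕ.* indicator (top-level? p)) (indicator ∘ light?) ps ⟨
        sumBy (λ p → x ℕ.* indicator (top-level? p) ℕ.+ indicator (light? p)) ps ≤⟨ sumBy-mono (All.universal (λ p → weigh (level p) (level p ℕ.≟ J) (level p ℕ.≟ 1)) ps) ⟩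
        Ψ Q ps ∎
        where
        open ℕₚ.≤-Reasoning
        weigh : ∀ l (d : Dec (l ≡ J)) (e : Dec (l ≡ 1)) → x ℕ.* indicator d ℕ.+ indicator e ≤ Λ Q l
        weigh l (yes l≡J) (yes l≡1)  = ⊥-elim (ℕₚ.<-irrefl (≡.trans (≡.sym l≡1) l≡J) 2≤u₀)
        weigh l (yes l≡J) (no _)     = ℕₚ.≤-reflexive (≡.trans (ℕₚ.+-identityʳ _) (≡.trans (ℕₚ.*-identityʳ x) (≡.cong (Λ Q) (≡.sym l≡J))))
        weigh l (no _)    (yes ≡.refl) = ℕₚ.≤-reflexive (≡.cong (ℕ._+ 1) (ℕₚ.*-zeroʳ x))
        weigh l (no _)    (no _)     = ≡.subst (_≤ Λ Q l) (≡.sym (≡.trans (ℕₚ.+-identityʳ _) (ℕₚ.*-zeroʳ x))) z≤n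

    contradiction : ⊥
    contradiction = Arithmetic.clash ℓ C k (Λ-mono 1≤Q (level≤ℓ rt (All.lookup (allValid cfg) u₀∈))) (1≤Λ 1≤Q (ℕₚ.≤-trans (s≤s z≤n) 2≤u₀)) edges degree weight almost

  -- Induction on rank and number of points

  -- A counterexample has a light point, as otherwise `heavy-Ψ` bounds its weight linearly. It has a
  -- heavy point too, as otherwise its weight is its number of points, and making one of them the
  -- root lowers the rank. The inner induction on the number of points allows a light point to be
  -- deleted, which leaves the weight at most one above the quota.
  rooted-bound-step : ∀ k → (∀ {j} → j < k → RootedBound j) → RootedBound k
  rooted-bound-step k ih rt {ps} cfg = by-size (length ps) rt ps cfg ℕₚ.≤-refl
    where
    by-size : ∀ N {m} {w : Fin n → Vector (suc m)} → Rooted w k → ∀ ps → Config w ps → length ps ≤ N → Ψ Q ps ≤ quota k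
    by-size N rt [] cfg _ = z≤n
    by-size (suc N) {m} {w} rt ps@(p₁ ∷ ps₁) cfg (s≤s ≤N) = ℕₚ.≮⇒≥ absurd
      where
      best = argmax level p₁ ps₁
      u = proj₁ best
      u∈ = proj₁ (proj₂ best)
      max = proj₂ (proj₂ best)
      levels : All (λ p → 1 ≤ level p) ps
      levels = All.map Valid.nonempty (allValid cfg)

      light-case : level u ≤ 1 → ¬ quota k < Ψ Q ps
      light-case u≤1 big = ℕₚ.<-irrefl ≡.refl (begin-strict
        quota k <⟨ big ⟩
        Ψ Q ps ≤⟨ sumBy-mono {g = λ _ → 1} (All.map (λ le → Λ-mono 1≤Q {j = 1} (ℕₚ.≤-trans le u≤1)) max) ⟩
        sumBy (λ _ → 1) ps ≡⟨ sumBy-1 ps ⟩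
        length ps ≡⟨ Listₚ.length-map dir ps ⟨
        length (map dir ps) ≤⟨ plain-bound ih (tail rt) (map dir ps) (spread (Allₚ.map⁺ (All.map Valid.nonzero (allValid cfg))) (Allₚ.map⁺ (All.map dir-avail (allValid cfg))) (AllPairsₚ.map⁺ (apart cfg))) ⟩
        quota k ∎)
        where open ℕₚ.≤-Reasoning

      absurd : ¬ quota k < Ψ Q ps
      absurd big with Any.any? (λ p → level p ℕ.≟ 1) ps
      ... | no ¬light = ℕₚ.<-irrefl ≡.refl (begin-strict
        quota k <⟨ big ⟩
        Ψ Q ps ≤⟨ heavy-Ψ k rt ℓ²≤Q ps cfg (All.map (λ (1≤ , ≢1) → ℕₚ.≤∧≢⇒< 1≤ (≢1 ∘ ≡.sym)) (All.zip (levels , Allₚ.¬Any⇒All¬ ps ¬light))) ⟩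
        L ℕ.* k ≤⟨ ℕₚ.*-monoˡ-≤ k (ℕₚ.m≤m+n L (2 ℕ.* D)) ⟩
        c ℕ.* k ≤⟨ ℕₚ.m≤n+m (c ℕ.* k) (k ℕ.* k) ⟩
        quota k ∎)
        where open ℕₚ.≤-Reasoning
      ... | yes light = cases (ℕₚ.<-cmp 1 (level u))
        where
        found = find light
        o = proj₁ found
        o≡1 : level o ≡ 1
        o≡1 = proj₂ (proj₂ found)
        rest = proj₁ (pick (proj₁ (proj₂ found)))
        σ : ps ↭ o ∷ rest
        σ = proj₂ (pick (proj₁ (proj₂ found)))
        cfg′ = Config-↭ σ cfg
        almost : Ψ Q ps ≤ suc (quota k)
        almost = begin
          Ψ Q ps ≡⟨ sumBy-↭ (Λ Q ∘ level) σ ⟩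
          Λ Q (level o) ℕ.+ Ψ Q rest ≡⟨ ≡.cong (λ l → Λ Q l ℕ.+ Ψ Q rest) o≡1 ⟩
          suc (Ψ Q rest) ≤⟨ s≤s (by-size N rt rest (config (All.tail (allValid cfg′)) (AllPairs.tail (apart cfg′)))
                                          (ℕₚ.≤-trans (ℕₚ.≤-reflexive (ℕₚ.suc-injective (≡.sym (Permₚ.↭-length σ)))) ≤N)) ⟩
          suc (quota k) ∎
          where open ℕₚ.≤-Reasoning
        cases : _ → ⊥
        cases (tri< 2≤u _ _) = Count.contradiction ih rt cfg big almost u∈ 2≤u max
        cases (tri≈ _ e _)   = light-case (ℕₚ.≤-reflexive (≡.sym e)) big
        cases (tri> _ _ u<1) = light-case (ℕₚ.<⇒≤ u<1) big

  rooted-bound : ∀ k → RootedBound k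
  rooted-bound = <-rec RootedBound λ k ih → rooted-bound-step k ih

  open Subset using (⁅_⁆; _∪_)

  -- A zero vector or two parallel vectors would yield a relation on one or two elements, contrary
  -- to simplicity. So all n vectors together form a list to which `plain-bound` applies.
  size-bound : Simple M → n ≤ quota r
  size-bound (loopless , parallel-free) = ≡.subst (_≤ quota r) (Listₚ.length-tabulate v₀)
    (plain-bound (λ {j} _ → rooted-bound j) contraction-initial (tabulate v₀) (spread (Allₚ.tabulate⁺ nonzero) (Allₚ.tabulate⁺ avail) (AllPairsₚ.tabulate⁺ separate)))
    where
    avail : ∀ x → Avail v₀ (v₀ x)
    avail x = x , 1# , 1≉0 , λ j → sym (*-identityˡ _)

    nonzero : ∀ x → Nonzero (v₀ x)
    nonzero x with nonzero? (v₀ x)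
    ... | yes nz = nz
    ... | no ¬nz = ⊥-elim (1≉0 (trans (sym (δ-same x 1#)) (proj₁ (rep ⁅ x ⁆) (loopless x) (δ x 1#)
      (λ y y∉ → δ-other x y 1# (λ { ≡.refl → y∉ (Subₚ.x∈⁅x⁆ x) }))
      (λ j → trans (comb-δ x 1# v₀ j) (trans (*-congˡ (¬nonzero⇒≈0 ¬nz j)) (zeroʳ 1#))) x)))

    separate : ∀ {x y} → x ≢ y → ¬ v₀ x ∥ v₀ y
    separate {x} {y} x≢y (s , _ , e) = 1≉0 (trans (sym a≈1) (proj₁ (rep _) (parallel-free x y x≢y) a outside vanishes x))
      where
      a : Vector n
      a z = δ x 1# z + δ y (- s) z
      a≈1 : a x ≈ 1#
      a≈1 = trans (+-cong (δ-same x 1#) (δ-other y x (- s) x≢y)) (+-identityʳ 1#)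
      outside : ∀ z → z Subset.∉ ⁅ x ⁆ ∪ ⁅ y ⁆ → a z ≈ 0#
      outside z z∉ = trans (+-cong (δ-other x z 1# λ { ≡.refl → z∉ (Subₚ.x∈p∪q⁺ (inj₁ (Subₚ.x∈⁅x⁆ x))) })
        (δ-other y z (- s) λ { ≡.refl → z∉ (Subₚ.x∈p∪q⁺ {p = ⁅ x ⁆} (inj₂ (Subₚ.x∈⁅x⁆ y))) })) (+-identityˡ 0#)
      vanishes : ∀ j → comb a v₀ j ≈ 0#
      vanishes j = trans (comb-+ (δ x 1#) (δ y (- s)) v₀ j) (trans (+-cong (trans (comb-δ x 1# v₀ j) (*-congˡ (e j))) (comb-δ y (- s) v₀ j))
        (trans (+-congʳ (*-identityˡ _)) (solve 2 (λ s v → s :* v :+ (:- s) :* v := con ℤ.0ℤ) refl s (v₀ y j))))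

open import Data.Nat using (_+_; _*_)
open import Data.Product using (∃; _×_)
open import Relation.Nullary using (¬_)

theorem1p6 : (ℝ : CompleteOrderedField) → (ℓ : ℕ) → 3 ≤ ℓ →
    ∃ λ (c : ℕ) → ∀ (n r : ℕ) (M : Matroid n) →
    Simple M → HasRank M r → Representable ℝ M →
    ¬ HasMinor M (UniformIndep 2 (ℓ + 2)) →
    n ≤ r * r + c * r
theorem1p6 ℝ ℓ 3≤ℓ = Constants.c ℓ , λ n r M simple (_ , rank≤) (m , v , rep) noLine →
  Extremal.size-bound ℝ M v rep r rank≤ ℓ noLine (ℕₚ.≤-trans (s≤s z≤n) 3≤ℓ) simple
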